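{- Fix an integer $k\ge1$ and $\overline\alpha,\overline\beta,\overline\pi,\overline\tau\in\mathbb{R}_+^k$ with $\alpha_1,\beta_1>0$. Let $\{\upsilon_n=\lambda^{(n)}/\mu^{(n)}\}$ be a sequence of connected skew shapes such that $\lambda^{(n)}\to(\overline\alpha,\overline\beta)$ and $\mu^{(n)}\to(\overline\pi,\overline\tau)$ in the sense of Thoma–Vershik–Kerov limits. Then $$\log e(\upsilon_n)=c\,n+o(n)\qquad\text{as } n\to\infty,$$ where $$c=\gamma\log\gamma-\sum_{i=1}^k(\alpha_i-\pi_i)\log(\alpha_i-\pi_i)-\sum_{i=1}^k(\beta_i-\tau_i)\log(\beta_i-\tau_i),\qquad \gamma=\sum_{i=1}^k(\alpha_i+\beta_i-\pi_i-\tau_i).$$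
   Context: $e(\lambda/\mu)$ is the number of standard Young tableaux of skew shape $\lambda/\mu$; $\log$ is the natural logarithm, with the convention $0\log 0=0$; $\mathbb{R}_+=[0,\infty)$. $d(\lambda)$ is the size of the Durfee square of $\lambda$ (the largest $d$ such that the $d\times d$ square fits in the Young diagram of $\lambda$). The Frobenius coordinates of $\lambda$ are $a_i=\lambda_i-i$ and $b_i=\lambda'_i-i$ for $1\le i\le d(\lambda)$, and $a_i=b_i=0$ for $i>d(\lambda)$. A sequence of partitions $\{\lambda^{(n)}\}$ has Thoma–Vershik–Kerov limit $(\overline\alpha,\overline\beta)$, written $\lambda^{(n)}\to(\overline\alpha,\overline\beta)$, with $\overline\alpha=(\alpha_1,\ldots,\alpha_k)$, $\overline\beta=(\beta_1,\ldots,\beta_k)\in\mathbb{R}_+^k$, if $a_i(\lambda^{(n)})/n\to\alpha_i$ and $b_i(\lambda^{(n)})/n\to\beta_i$ as $n\to\infty$ for all $1\le i\le k$, and $d(\lambda^{(n)})\le k$ for all $n\ge1$. (The same $k$ is used for both sequences.) -}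

module Defs where

open import Data.Bool.Base using (if_then_else_)
open import Data.Fin.Base as Fin using (Fin)
import Data.Fin.Properties as Fin
open import Data.Integer.Base as ℤ using (+_)
import Data.Integer.Properties as ℤ
open import Data.List.Base as List using (List; []; _∷_; length; applyUpTo; upTo; filter; cartesianProductWith; allFin)
open import Data.List.Membership.Propositional using (_∈_)
open import Data.List.Membership.Propositional.Properties using (∈-filter⁺; ∈-cartesianProductWith⁺; ∈-allFin; ∈-length; ∈-lookup)
open import Data.List.Relation.Unary.Any using (here)
open import Data.List.Relation.Unary.All as All using (All; []; _∷_)
import Data.List.Relation.Unary.All.Properties as All
open import Data.List.Relation.Unary.AllPairs using (AllPairs; []; _∷_)
import Data.List.Relation.Unary.AllPairs.Properties as AllPairs
open import Data.Nat.Base as ℕ using (ℕ; zero; suc)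
import Data.Nat.Properties as ℕ
open import Data.Product.Base using (∃-syntax; _×_; _,_; proj₁; proj₂)
open import Data.Rational.Base as ℚ using (ℚ; 0ℚ; 1ℚ; ½)
import Data.Rational.Properties as ℚ
open import Data.Rational.Solver using (module +-*-Solver)
import Data.Rational.Unnormalised.Base as ℚᵘ
import Data.Rational.Unnormalised.Properties as ℚᵘ
open import Data.Sum.Base using (_⊎_; inj₁; inj₂)
open import Data.Vec.Base as Vec using (Vec; []; _∷_)
import Data.Vec.Properties as Vec
import Data.Vec.Functional as Vector
open import Function.Base using (_∘_)
open import Relation.Binary.Construct.Closure.ReflexiveTransitive using (Star)
open import Relation.Binary.Definitions using (tri<; tri≈; tri>)
open import Relation.Binary.PropositionalEquality
open import Relation.Nullary using (yes; no; contradiction; does)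
open import Relation.Nullary.Decidable using (_→-dec_; _×-dec_)
open import Relation.Unary using (Decidable)

Eventually : (ℕ → Set) → Set
Eventually P = ∃[ N ] ∀ n → N ℕ.≤ n → P n

IsCauchy : (ℕ → ℚ) → Set
IsCauchy x = ∀ ε → 0ℚ ℚ.< ε →
  ∃[ N ] ∀ m n → N ℕ.≤ m → N ℕ.≤ n → ℚ.∣ x m ℚ.- x n ∣ ℚ.≤ ε

-- The value at 0 is a placeholder; it influences no limit taken below.
recip : ℚ → ℚ
recip p with p ℚ.≟ 0ℚ
... | yes _   = 0ℚ
... | no  p≢0 = ℚ.1/_ p {{ℚ.≢-nonZero p≢0}}

-- The Riemann sum of ∫ₐᵇ dt/t over 2ᵏ equal steps, each step (positive or
-- negative) being weighted by the value of 1/t at the end nearer to a.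
riemann : ℕ → ℚ → ℚ → ℚ
riemann zero    a b = (b ℚ.- a) ℚ.* recip a
riemann (suc k) a b = riemann k a mid ℚ.+ riemann k mid b
  where mid = ½ ℚ.* (a ℚ.+ b)

module Rationals where

  open import Data.Rational.Base using (_+_; _*_; _-_; -_; ∣_∣; _≤_; _<_; _⊔_)
  open ℚ.≤-Reasoning

  private
    S : Set
    S = ℕ → ℚ

  open +-*-Solver using (solve; _:=_; _:+_; _:*_; _:-_; :-_; con)

  ≤-by : ∀ {p q} r → 0ℚ ≤ r → p + r ≡ q → p ≤ q
  ≤-by {p} {q} r 0≤r eq = begin
    p       ≡⟨ ℚ.+-identityʳ p ⟨
    p + 0ℚ  ≤⟨ ℚ.+-monoʳ-≤ p 0≤r ⟩
    p + r   ≡⟨ eq ⟩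
    q       ∎

  ≤⇒0≤- : ∀ {p q} → p ≤ q → 0ℚ ≤ q - p
  ≤⇒0≤- {p} {q} p≤q = begin
    0ℚ     ≡⟨ ℚ.+-inverseʳ p ⟨
    p - p  ≤⟨ ℚ.+-monoˡ-≤ (- p) p≤q ⟩
    q - p  ∎

  0≤* : ∀ {p q} → 0ℚ ≤ p → 0ℚ ≤ q → 0ℚ ≤ p * q
  0≤* {p} {q} 0≤p 0≤q = ℚ.nonNegative⁻¹ (p * q)
    {{ℚ.nonNeg*nonNeg⇒nonNeg p {{ℚ.nonNegative 0≤p}} q {{ℚ.nonNegative 0≤q}}}}

  0<* : ∀ {p q} → 0ℚ < p → 0ℚ < q → 0ℚ < p * q
  0<* {p} {q} 0<p 0<q = ℚ.positive⁻¹ (p * q)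
    {{ℚ.pos*pos⇒pos p {{ℚ.positive 0<p}} q {{ℚ.positive 0<q}}}}

  0≤+ : ∀ {p q} → 0ℚ ≤ p → 0ℚ ≤ q → 0ℚ ≤ p + q
  0≤+ {p} {q} 0≤p 0≤q = subst (_≤ p + q) (ℚ.+-identityʳ 0ℚ) (ℚ.+-mono-≤ 0≤p 0≤q)

  0<+ : ∀ {p q} → 0ℚ < p → 0ℚ ≤ q → 0ℚ < p + q
  0<+ {p} {q} 0<p 0≤q = subst (_< p + q) (ℚ.+-identityʳ 0ℚ) (ℚ.+-mono-<-≤ 0<p 0≤q)

  0≤∣∣ : ∀ p → 0ℚ ≤ ∣ p ∣
  0≤∣∣ p = ℚ.0≤∣p∣ p

  0<½ : 0ℚ < ½
  0<½ = ℚ.positive⁻¹ ½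

  0<1 : 0ℚ < 1ℚ
  0<1 = ℚ.positive⁻¹ 1ℚ

  *-mono-≤ : ∀ {p q r s} → 0ℚ ≤ p → 0ℚ ≤ s → p ≤ q → r ≤ s → p * r ≤ q * s
  *-mono-≤ {p} {q} {r} {s} 0≤p 0≤s p≤q r≤s = begin
    p * r  ≤⟨ ℚ.*-monoˡ-≤-nonNeg p {{ℚ.nonNegative 0≤p}} r≤s ⟩
    p * s  ≤⟨ ℚ.*-monoʳ-≤-nonNeg s {{ℚ.nonNegative 0≤s}} p≤q ⟩
    q * s  ∎

  ∣-∣-sym : ∀ p q → ∣ p - q ∣ ≡ ∣ q - p ∣
  ∣-∣-sym p q = trans (cong ∣_∣ (solve 2 (λ p q → p :- q := :- (q :- p)) refl p q))
                      (ℚ.∣-p∣≡∣p∣ (q - p))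

  ≤∣∣ : ∀ p → p ≤ ∣ p ∣
  ≤∣∣ p with ℚ.≤-total 0ℚ p
  ... | inj₁ 0≤p = ℚ.≤-reflexive (sym (ℚ.0≤p⇒∣p∣≡p 0≤p))
  ... | inj₂ p≤0 = ℚ.≤-trans p≤0 (0≤∣∣ p)

  -≤∣∣ : ∀ p → - p ≤ ∣ p ∣
  -≤∣∣ p = subst (- p ≤_) (ℚ.∣-p∣≡∣p∣ p) (≤∣∣ (- p))

  ∣∣≤ : ∀ {p q} → p ≤ q → - p ≤ q → ∣ p ∣ ≤ q
  ∣∣≤ {p} {q} p≤q -p≤q with ℚ.∣p∣≡p∨∣p∣≡-p p
  ... | inj₁ eq = subst (_≤ q) (sym eq) p≤q
  ... | inj₂ eq = subst (_≤ q) (sym eq) -p≤q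

  triangle : ∀ p q r → ∣ p - r ∣ ≤ ∣ p - q ∣ + ∣ q - r ∣
  triangle p q r = begin
    ∣ p - r ∣               ≡⟨ cong ∣_∣ (solve 3 (λ p q r → p :- r := (p :- q) :+ (q :- r)) refl p q r) ⟩
    ∣ (p - q) + (q - r) ∣   ≤⟨ ℚ.∣p+q∣≤∣p∣+∣q∣ (p - q) (q - r) ⟩
    ∣ p - q ∣ + ∣ q - r ∣   ∎

  half+half : ∀ ε → ½ * ε + ½ * ε ≡ ε
  half+half = solve 1 (λ ε → con ½ :* ε :+ con ½ :* ε := ε) refl

  recip-inverse : ∀ {p} → 0ℚ < p → p * recip p ≡ 1ℚ
  recip-inverse {p} 0<p with p ℚ.≟ 0ℚ
  ... | yes p≡0 = contradiction (sym p≡0) (ℚ.<⇒≢ 0<p)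
  ... | no  p≢0 = ℚ.*-inverseʳ p {{ℚ.≢-nonZero p≢0}}

  0<recip : ∀ {p} → 0ℚ < p → 0ℚ < recip p
  0<recip {p} 0<p with p ℚ.≟ 0ℚ
  ... | yes p≡0 = contradiction (sym p≡0) (ℚ.<⇒≢ 0<p)
  ... | no  p≢0 = ℚ.positive⁻¹ (ℚ.1/_ p {{ℚ.≢-nonZero p≢0}}) {{ℚ.1/pos⇒pos p {{ℚ.positive 0<p}}}}

  0≤recip : ∀ {p} → 0ℚ < p → 0ℚ ≤ recip p
  0≤recip 0<p = ℚ.<⇒≤ (0<recip 0<p)

  recip-difference : ∀ {p q} → 0ℚ < p → 0ℚ < q → recip p - recip q ≡ (q - p) * (recip p * recip q)
  recip-difference {p} {q} 0<p 0<q = begin-equality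
    recip p - recip q
      ≡⟨ cong₂ _-_ (ℚ.*-identityˡ (recip p)) (ℚ.*-identityˡ (recip q)) ⟨
    1ℚ * recip p - 1ℚ * recip q
      ≡⟨ cong₂ (λ u v → u * recip p - v * recip q) (recip-inverse 0<q) (recip-inverse 0<p) ⟨
    (q * recip q) * recip p - (p * recip p) * recip q
      ≡⟨ solve 4 (λ p q u v → (q :* v) :* u :- (p :* u) :* v := (q :- p) :* (u :* v)) refl p q (recip p) (recip q) ⟩
    (q - p) * (recip p * recip q) ∎

  recip-antitone : ∀ {p q} → 0ℚ < p → p ≤ q → recip q ≤ recip p
  recip-antitone {p} {q} 0<p p≤q = ≤-by (recip p - recip q)
    (subst (0ℚ ≤_) (sym (recip-difference 0<p 0<q))
      (0≤* (≤⇒0≤- p≤q) (0≤* (0≤recip 0<p) (0≤recip 0<q))))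
    (solve 2 (λ u v → v :+ (u :- v) := u) refl (recip p) (recip q))
    where 0<q = ℚ.<-≤-trans 0<p p≤q

  fromℕ-suc : ∀ n → (+ suc n) ℚ./ 1 ≡ (+ n) ℚ./ 1 + 1ℚ
  fromℕ-suc n = ℚ.toℚᵘ-injective (ℚᵘ.≃-trans (ℚ.toℚᵘ-fromℚᵘ (ℚᵘ.mkℚᵘ (+ suc n) 0))
    (ℚᵘ.≃-sym (ℚᵘ.≃-trans (ℚ.toℚᵘ-homo-+ ((+ n) ℚ./ 1) 1ℚ)
      (ℚᵘ.≃-trans (ℚᵘ.+-cong {x = ℚ.toℚᵘ ((+ n) ℚ./ 1)} {y = ℚᵘ.mkℚᵘ (+ n) 0} {u = ℚᵘ.1ℚᵘ} {v = ℚᵘ.1ℚᵘ}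
                    (ℚ.toℚᵘ-fromℚᵘ (ℚᵘ.mkℚᵘ (+ n) 0)) ℚᵘ.≃-refl)
        (ℚᵘ.*≡* (cong (ℤ._* (+ 1)) (trans (ℤ.+-comm (+ n ℤ.* + 1) (+ 1))
          (cong (λ z → + 1 ℤ.+ z) (ℤ.*-identityʳ (+ n))))))))))

  archimedean : ∀ q → ∃[ N ] q ≤ (+ N) ℚ./ 1
  archimedean q@record{} = ℤ.∣ ℚ.↥ q ∣ , ℚ.toℚᵘ-cancel-≤
    (ℚᵘ.≤-respʳ-≃ (ℚᵘ.≃-sym (ℚ.toℚᵘ-fromℚᵘ (ℚᵘ.mkℚᵘ (+ ℤ.∣ ℚ.↥ q ∣) 0)))
      (ℚᵘ.*≤* (lemma (ℚ.↥ q) (ℚ.ℚ.denominator-1 q))))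
    where
    lemma : ∀ z d → z ℤ.* + 1 ℤ.≤ + ℤ.∣ z ∣ ℤ.* + suc d
    lemma (+ n)          d = ℤ.≤-trans (ℤ.≤-reflexive (trans (ℤ.*-identityʳ (+ n)) refl))
      (ℤ.≤-trans (ℤ.+≤+ (ℕ.m≤m*n n (suc d))) (ℤ.≤-reflexive (ℤ.pos-* n (suc d))))
    lemma ℤ.-[1+ n ] d = ℤ.-≤+

  half^ : ℕ → ℚ
  half^ zero    = 1ℚ
  half^ (suc k) = ½ * half^ k

  0≤half^ : ∀ k → 0ℚ ≤ half^ k
  0≤half^ zero    = ℚ.<⇒≤ 0<1
  0≤half^ (suc k) = 0≤* (ℚ.<⇒≤ 0<½) (0≤half^ k)

  half^≤1 : ∀ k → half^ k ≤ 1ℚ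
  half^≤1 zero    = ℚ.≤-refl
  half^≤1 (suc k) = *-mono-≤ (ℚ.<⇒≤ 0<½) (ℚ.<⇒≤ 0<1) (ℚ.≤ᵇ⇒≤ {½} {1ℚ} _) (half^≤1 k)

  half^*ℕ≤1 : ∀ k → half^ k * ((+ k) ℚ./ 1) ≤ 1ℚ
  half^*ℕ≤1 zero    = ℚ.≤-trans (ℚ.≤-reflexive (ℚ.*-zeroʳ 1ℚ)) (ℚ.<⇒≤ 0<1)
  half^*ℕ≤1 (suc k) = begin
    ½ * h * ((+ suc k) ℚ./ 1)   ≡⟨ cong (½ * h *_) (fromℕ-suc k) ⟩
    ½ * h * (κ + 1ℚ)            ≡⟨ solve 2 (λ h κ → con ½ :* h :* (κ :+ con 1ℚ) := con ½ :* (h :* κ) :+ con ½ :* h) refl h κ ⟩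
    ½ * (h * κ) + ½ * h         ≤⟨ ℚ.+-mono-≤ (ℚ.*-monoˡ-≤-nonNeg ½ (half^*ℕ≤1 k)) (ℚ.*-monoˡ-≤-nonNeg ½ (half^≤1 k)) ⟩
    ½ * 1ℚ + ½ * 1ℚ             ≡⟨ half+half 1ℚ ⟩
    1ℚ                          ∎
    where h = half^ k
          κ = (+ k) ℚ./ 1

  half^-small : ∀ K ε → 0ℚ < ε → ∃[ N ] half^ N * K ≤ ε
  half^-small K ε 0<ε with archimedean (K * recip ε)
  ... | N , K/ε≤N = N , (begin
    half^ N * K                      ≡⟨ cong (half^ N *_) (ℚ.*-identityʳ K) ⟨
    half^ N * (K * 1ℚ)               ≡⟨ cong (λ u → half^ N * (K * u)) (recip-inverse 0<ε) ⟨
    half^ N * (K * (ε * recip ε))    ≡⟨ solve 4 (λ h K ε r → h :* (K :* (ε :* r)) := (h :* (K :* r)) :* ε) refl (half^ N) K ε (recip ε) ⟩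
    half^ N * (K * recip ε) * ε      ≤⟨ ℚ.*-monoʳ-≤-nonNeg ε {{0≤ε}} (ℚ.*-monoˡ-≤-nonNeg (half^ N) {{ℚ.nonNegative (0≤half^ N)}} K/ε≤N) ⟩
    half^ N * ((+ N) ℚ./ 1) * ε      ≤⟨ ℚ.*-monoʳ-≤-nonNeg ε {{0≤ε}} (half^*ℕ≤1 N) ⟩
    1ℚ * ε                           ≡⟨ ℚ.*-identityˡ ε ⟩
    ε                                ∎)
    where 0≤ε = ℚ.nonNegative (ℚ.<⇒≤ 0<ε)

  both : ∀ {P Q : ℕ → Set} → Eventually P → Eventually Q → Eventually λ n → P n × Q n
  both (M , p) (N , q) = M ℕ.⊔ N , λ n h →
    p n (ℕ.≤-trans (ℕ.m≤m⊔n M N) h) , q n (ℕ.≤-trans (ℕ.m≤n⊔m M N) h)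

  const-cauchy : ∀ p → IsCauchy λ _ → p
  const-cauchy p ε 0<ε = 0 , λ _ _ _ _ →
    subst (_≤ ε) (sym (cong ∣_∣ (ℚ.+-inverseʳ p))) (ℚ.<⇒≤ 0<ε)

  module _ {x y : S} (f : ℚ → ℚ → ℚ) (z : S) (z≡ : ∀ n → z n ≡ f (x n) (y n))
           (K L : ℚ) (0<K : 0ℚ < K) (0<L : 0ℚ < L)
           (D : ℚ → ℚ → Set) (inD : Eventually λ n → D (x n) (y n))
           (lipschitz : ∀ {p q p′ q′} → D p q → D p′ q′ → ∣ f p q - f p′ q′ ∣ ≤ K * ∣ p - p′ ∣ + L * ∣ q - q′ ∣) where

    lipschitz-cauchy : IsCauchy x → IsCauchy y → IsCauchy z
    lipschitz-cauchy cx cy ε 0<ε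
      with cx (½ * ε * recip K) (0<* (0<* 0<½ 0<ε) (0<recip 0<K))
         | cy (½ * ε * recip L) (0<* (0<* 0<½ 0<ε) (0<recip 0<L))
    ... | M , X | N , Y = proj₁ inD ℕ.⊔ (M ℕ.⊔ N) , λ m n hm hn → begin
      ∣ z m - z n ∣
        ≡⟨ cong₂ (λ u v → ∣ u - v ∣) (z≡ m) (z≡ n) ⟩
      ∣ f (x m) (y m) - f (x n) (y n) ∣
        ≤⟨ lipschitz (proj₂ inD m (ℕ.m⊔n≤o⇒m≤o (proj₁ inD) _ hm)) (proj₂ inD n (ℕ.m⊔n≤o⇒m≤o (proj₁ inD) _ hn)) ⟩
      K * ∣ x m - x n ∣ + L * ∣ y m - y n ∣
        ≤⟨ ℚ.+-mono-≤
             (ℚ.*-monoˡ-≤-nonNeg K {{ℚ.nonNegative (ℚ.<⇒≤ 0<K)}}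
               (X m n (ℕ.m⊔n≤o⇒m≤o M N (tail hm)) (ℕ.m⊔n≤o⇒m≤o M N (tail hn))))
             (ℚ.*-monoˡ-≤-nonNeg L {{ℚ.nonNegative (ℚ.<⇒≤ 0<L)}}
               (Y m n (ℕ.m⊔n≤o⇒n≤o M N (tail hm)) (ℕ.m⊔n≤o⇒n≤o M N (tail hn)))) ⟩
      K * (½ * ε * recip K) + L * (½ * ε * recip L)
        ≡⟨ solve 5 (λ K L h r s → K :* (h :* r) :+ L :* (h :* s) := h :* (K :* r) :+ h :* (L :* s)) refl K L (½ * ε) (recip K) (recip L) ⟩
      ½ * ε * (K * recip K) + ½ * ε * (L * recip L)
        ≡⟨ cong₂ (λ u v → ½ * ε * u + ½ * ε * v) (recip-inverse 0<K) (recip-inverse 0<L) ⟩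
      ½ * ε * 1ℚ + ½ * ε * 1ℚ
        ≡⟨ cong₂ _+_ (ℚ.*-identityʳ (½ * ε)) (ℚ.*-identityʳ (½ * ε)) ⟩
      ½ * ε + ½ * ε
        ≡⟨ half+half ε ⟩
      ε ∎
      where
      tail : ∀ {n} → proj₁ inD ℕ.⊔ (M ℕ.⊔ N) ℕ.≤ n → M ℕ.⊔ N ℕ.≤ n
      tail = ℕ.m⊔n≤o⇒n≤o (proj₁ inD) _

  Bounded : S → Set
  Bounded x = ∃[ B ] (0ℚ < B) × Eventually λ n → ∣ x n ∣ ≤ B

  bounded : ∀ {x} → IsCauchy x → Bounded x
  bounded {x} cx with cx 1ℚ 0<1
  ... | N , X = 1ℚ + ∣ x N ∣ , 0<+ 0<1 (0≤∣∣ (x N)) , N , λ n h → begin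
    ∣ x n ∣                  ≡⟨ cong ∣_∣ (solve 2 (λ p q → p := (p :- q) :+ q) refl (x n) (x N)) ⟩
    ∣ (x n - x N) + x N ∣    ≤⟨ ℚ.∣p+q∣≤∣p∣+∣q∣ (x n - x N) (x N) ⟩
    ∣ x n - x N ∣ + ∣ x N ∣  ≤⟨ ℚ.+-monoˡ-≤ ∣ x N ∣ (X n N h ℕ.≤-refl) ⟩
    1ℚ + ∣ x N ∣             ∎

  +-cauchy : ∀ {x y} → IsCauchy x → IsCauchy y → IsCauchy λ n → x n + y n
  +-cauchy {x} {y} = lipschitz-cauchy {x} {y} _+_ _ (λ _ → refl) 1ℚ 1ℚ 0<1 0<1 (λ p q → p ≡ p) (0 , λ _ _ → refl)
    λ {p} {q} {p′} {q′} _ _ → begin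
      ∣ (p + q) - (p′ + q′) ∣               ≡⟨ cong ∣_∣ (solve 4 (λ p q p′ q′ → (p :+ q) :- (p′ :+ q′) := (p :- p′) :+ (q :- q′)) refl p q p′ q′) ⟩
      ∣ (p - p′) + (q - q′) ∣               ≤⟨ ℚ.∣p+q∣≤∣p∣+∣q∣ (p - p′) (q - q′) ⟩
      ∣ p - p′ ∣ + ∣ q - q′ ∣               ≡⟨ cong₂ _+_ (ℚ.*-identityˡ ∣ p - p′ ∣) (ℚ.*-identityˡ ∣ q - q′ ∣) ⟨
      1ℚ * ∣ p - p′ ∣ + 1ℚ * ∣ q - q′ ∣     ∎

  1-lipschitz-cauchy : ∀ {x} (f : ℚ → ℚ) → (∀ p q → ∣ f p - f q ∣ ≤ ∣ p - q ∣) → IsCauchy x → IsCauchy (f ∘ x)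
  1-lipschitz-cauchy {x} f lip cx ε 0<ε with cx ε 0<ε
  ... | N , X = N , λ m n hm hn → ℚ.≤-trans (lip (x m) (x n)) (X m n hm hn)

  neg-cauchy : ∀ {x} → IsCauchy x → IsCauchy λ n → - x n
  neg-cauchy {x} = 1-lipschitz-cauchy {x} -_ λ p q → ℚ.≤-reflexive
    (trans (cong ∣_∣ (solve 2 (λ p q → (:- p) :- (:- q) := q :- p) refl p q)) (∣-∣-sym q p))

  abs-cauchy : ∀ {x} → IsCauchy x → IsCauchy λ n → ∣ x n ∣
  abs-cauchy {x} = 1-lipschitz-cauchy {x} ∣_∣ λ p q → ∣∣≤ (half p q)
    (subst₂ _≤_ (solve 2 (λ u v → v :- u := :- (u :- v)) refl ∣ p ∣ ∣ q ∣) (∣-∣-sym q p) (half q p))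
    where
    half : ∀ p q → ∣ p ∣ - ∣ q ∣ ≤ ∣ p - q ∣
    half p q = begin
      ∣ p ∣ - ∣ q ∣                  ≡⟨ cong (λ u → ∣ u ∣ - ∣ q ∣) (solve 2 (λ p q → p := (p :- q) :+ q) refl p q) ⟩
      ∣ (p - q) + q ∣ - ∣ q ∣        ≤⟨ ℚ.+-monoˡ-≤ (- ∣ q ∣) (ℚ.∣p+q∣≤∣p∣+∣q∣ (p - q) q) ⟩
      ∣ p - q ∣ + ∣ q ∣ - ∣ q ∣      ≡⟨ solve 2 (λ u v → u :+ v :- v := u) refl ∣ p - q ∣ ∣ q ∣ ⟩
      ∣ p - q ∣                      ∎

  ⊔0-cauchy : ∀ {x} → IsCauchy x → IsCauchy λ n → x n ⊔ 0ℚ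
  ⊔0-cauchy {x} = 1-lipschitz-cauchy {x} (_⊔ 0ℚ) λ p q → ∣∣≤ (half p q)
    (subst₂ _≤_ (solve 2 (λ u v → v :- u := :- (u :- v)) refl (p ⊔ 0ℚ) (q ⊔ 0ℚ)) (∣-∣-sym q p) (half q p))
    where
    half : ∀ p q → (p ⊔ 0ℚ) - (q ⊔ 0ℚ) ≤ ∣ p - q ∣
    half p q with ℚ.≤-total p 0ℚ
    ... | inj₁ p≤0 = begin
      (p ⊔ 0ℚ) - (q ⊔ 0ℚ)  ≡⟨ cong (_- (q ⊔ 0ℚ)) (ℚ.p≤q⇒p⊔q≡q p≤0) ⟩
      0ℚ - (q ⊔ 0ℚ)        ≤⟨ ℚ.+-monoʳ-≤ 0ℚ (ℚ.neg-antimono-≤ (ℚ.p≤q⊔p q 0ℚ)) ⟩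
      0ℚ                   ≤⟨ 0≤∣∣ (p - q) ⟩
      ∣ p - q ∣            ∎
    ... | inj₂ 0≤p = begin
      (p ⊔ 0ℚ) - (q ⊔ 0ℚ)  ≡⟨ cong (_- (q ⊔ 0ℚ)) (ℚ.p≥q⇒p⊔q≡p 0≤p) ⟩
      p - (q ⊔ 0ℚ)         ≤⟨ ℚ.+-monoʳ-≤ p (ℚ.neg-antimono-≤ (ℚ.p≤p⊔q q 0ℚ)) ⟩
      p - q                ≤⟨ ≤∣∣ (p - q) ⟩
      ∣ p - q ∣            ∎

  *-lipschitz : ∀ {A B p q p′ q′} → ∣ q ∣ ≤ B → ∣ p′ ∣ ≤ A →
                ∣ p * q - p′ * q′ ∣ ≤ B * ∣ p - p′ ∣ + A * ∣ q - q′ ∣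
  *-lipschitz {A} {B} {p} {q} {p′} {q′} qB p′A = begin
    ∣ p * q - p′ * q′ ∣                         ≡⟨ cong ∣_∣ (solve 4 (λ p q p′ q′ → p :* q :- p′ :* q′ := q :* (p :- p′) :+ p′ :* (q :- q′)) refl p q p′ q′) ⟩
    ∣ q * (p - p′) + p′ * (q - q′) ∣            ≤⟨ ℚ.∣p+q∣≤∣p∣+∣q∣ (q * (p - p′)) (p′ * (q - q′)) ⟩
    ∣ q * (p - p′) ∣ + ∣ p′ * (q - q′) ∣        ≡⟨ cong₂ _+_ (ℚ.∣p*q∣≡∣p∣*∣q∣ q (p - p′)) (ℚ.∣p*q∣≡∣p∣*∣q∣ p′ (q - q′)) ⟩
    ∣ q ∣ * ∣ p - p′ ∣ + ∣ p′ ∣ * ∣ q - q′ ∣    ≤⟨ ℚ.+-mono-≤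
                                                    (*-mono-≤ (0≤∣∣ q) (0≤∣∣ (p - p′)) qB ℚ.≤-refl)
                                                    (*-mono-≤ (0≤∣∣ p′) (0≤∣∣ (q - q′)) p′A ℚ.≤-refl) ⟩
    B * ∣ p - p′ ∣ + A * ∣ q - q′ ∣             ∎

  *-cauchy : ∀ {x y} → IsCauchy x → IsCauchy y → IsCauchy λ n → x n * y n
  *-cauchy {x} {y} cx cy = from-bounds (bounded cx) (bounded cy)
    where
    from-bounds : Bounded x → Bounded y → IsCauchy λ n → x n * y n
    from-bounds (A , 0<A , xA) (B , 0<B , yB) =
      lipschitz-cauchy {x} {y} _*_ (λ n → x n * y n) (λ _ → refl) B A 0<B 0<A
        (λ p q → ∣ p ∣ ≤ A × ∣ q ∣ ≤ B) (both xA yB)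
        (λ {p} {q} {p′} {q′} (pA , qB) (p′A , q′B) → *-lipschitz {A} {B} {p} {q} {p′} {q′} qB p′A) cx cy

  recip-cauchy : ∀ {x} δ → 0ℚ < δ → Eventually (λ n → δ ≤ x n) → IsCauchy x → IsCauchy λ n → recip (x n)
  recip-cauchy {x} δ 0<δ δ≤x cx =
    lipschitz-cauchy {x} {x} (λ p _ → recip p) _ (λ _ → refl) (r * r) 1ℚ (0<* 0<r 0<r) 0<1 (λ p _ → δ ≤ p) δ≤x
      (λ {p} {q} {p′} {q′} δ≤p δ≤p′ → let 0<p = ℚ.<-≤-trans 0<δ δ≤p ; 0<p′ = ℚ.<-≤-trans 0<δ δ≤p′ in begin
        ∣ recip p - recip p′ ∣                      ≡⟨ cong ∣_∣ (recip-difference 0<p 0<p′) ⟩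
        ∣ (p′ - p) * (recip p * recip p′) ∣         ≡⟨ ℚ.∣p*q∣≡∣p∣*∣q∣ (p′ - p) (recip p * recip p′) ⟩
        ∣ p′ - p ∣ * ∣ recip p * recip p′ ∣         ≡⟨ cong₂ _*_ (∣-∣-sym p′ p) (ℚ.0≤p⇒∣p∣≡p (0≤* (0≤recip 0<p) (0≤recip 0<p′))) ⟩
        ∣ p - p′ ∣ * (recip p * recip p′)           ≤⟨ ℚ.*-monoˡ-≤-nonNeg ∣ p - p′ ∣ {{ℚ.nonNegative (0≤∣∣ (p - p′))}}
                                                        (*-mono-≤ (0≤recip 0<p) (ℚ.<⇒≤ 0<r) (recip-antitone 0<δ δ≤p) (recip-antitone 0<δ δ≤p′)) ⟩
        ∣ p - p′ ∣ * (r * r)                        ≤⟨ ≤-by (1ℚ * ∣ q - q′ ∣) (0≤* (ℚ.<⇒≤ 0<1) (0≤∣∣ (q - q′)))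
                                                        (cong (_+ 1ℚ * ∣ q - q′ ∣) (ℚ.*-comm ∣ p - p′ ∣ (r * r))) ⟩
        r * r * ∣ p - p′ ∣ + 1ℚ * ∣ q - q′ ∣        ∎)
      cx cx
    where r = recip δ
          0<r = 0<recip 0<δ

  riemann-cauchy : ∀ k {a b} δ → 0ℚ < δ → Eventually (λ n → δ ≤ a n) → Eventually (λ n → 0ℚ ≤ b n) →
                   IsCauchy a → IsCauchy b → IsCauchy λ n → riemann k (a n) (b n)
  riemann-cauchy zero    {a} {b} δ 0<δ δ≤a 0≤b ca cb =
    *-cauchy {λ n → b n - a n} {λ n → recip (a n)}
      (+-cauchy {b} {λ n → - a n} cb (neg-cauchy {a} ca)) (recip-cauchy {a} δ 0<δ δ≤a ca)
  riemann-cauchy (suc k) {a} {b} δ 0<δ δ≤a 0≤b ca cb =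
    +-cauchy {λ n → riemann k (a n) (mid n)} {λ n → riemann k (mid n) (b n)}
      (riemann-cauchy k {a} {mid} δ 0<δ δ≤a (N , λ n h → ℚ.≤-trans (ℚ.<⇒≤ 0<½δ) (½δ≤mid n h)) ca cmid)
      (riemann-cauchy k {mid} {b} (½ * δ) 0<½δ (N , ½δ≤mid) 0≤b cmid cb)
    where
    mid : S
    mid n = ½ * (a n + b n)
    N = proj₁ δ≤a ℕ.⊔ proj₁ 0≤b
    0<½δ = 0<* 0<½ 0<δ
    cmid : IsCauchy mid
    cmid = *-cauchy {λ _ → ½} {λ n → a n + b n} (const-cauchy ½) (+-cauchy {a} {b} ca cb)
    ½δ≤mid : ∀ n → N ℕ.≤ n → ½ * δ ≤ mid n
    ½δ≤mid n h = ℚ.*-monoˡ-≤-nonNeg ½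
      (subst (_≤ a n + b n) (ℚ.+-identityʳ δ)
        (ℚ.+-mono-≤ (proj₂ δ≤a n (ℕ.m⊔n≤o⇒m≤o (proj₁ δ≤a) (proj₁ 0≤b) h))
                    (proj₂ 0≤b n (ℕ.m⊔n≤o⇒n≤o (proj₁ δ≤a) (proj₁ 0≤b) h))))

  mid>0 : ∀ {a b} → 0ℚ < a → 0ℚ < b → 0ℚ < ½ * (a + b)
  mid>0 0<a 0<b = 0<* 0<½ (0<+ 0<a (ℚ.<⇒≤ 0<b))

  square≥0 : ∀ p → 0ℚ ≤ p * p
  square≥0 p with ℚ.≤-total 0ℚ p
  ... | inj₁ 0≤p = 0≤* 0≤p 0≤p
  ... | inj₂ p≤0 = subst (0ℚ ≤_) (solve 1 (λ p → (:- p) :* (:- p) := p :* p) refl p)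
                     (0≤* (ℚ.neg-antimono-≤ p≤0) (ℚ.neg-antimono-≤ p≤0))

  step : ∀ {p q} → 0ℚ < p → 0ℚ < q → (q - p) * recip q ≤ (q - p) * recip p
  step {p} {q} 0<p 0<q = ≤-by ((q - p) * (q - p) * (recip p * recip q))
    (0≤* (square≥0 (q - p)) (0≤* (0≤recip 0<p) (0≤recip 0<q)))
    (begin-equality
      (q - p) * recip q + (q - p) * (q - p) * (recip p * recip q)
        ≡⟨ solve 3 (λ d u v → d :* v :+ d :* d :* (u :* v) := d :* v :+ d :* (d :* (u :* v))) refl (q - p) (recip p) (recip q) ⟩
      (q - p) * recip q + (q - p) * ((q - p) * (recip p * recip q))
        ≡⟨ cong (λ w → (q - p) * recip q + (q - p) * w) (recip-difference 0<p 0<q) ⟨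
      (q - p) * recip q + (q - p) * (recip p - recip q)
        ≡⟨ solve 3 (λ d u v → d :* v :+ d :* (u :- v) := d :* u) refl (q - p) (recip p) (recip q) ⟩
      (q - p) * recip p ∎)

  module _ (a b : ℚ) where
    private
      mid = ½ * (a + b)

    left-half : mid - a ≡ ½ * (b - a)
    left-half = solve 2 (λ a b → con ½ :* (a :+ b) :- a := con ½ :* (b :- a)) refl a b

    right-half : b - mid ≡ ½ * (b - a)
    right-half = solve 2 (λ a b → b :- con ½ :* (a :+ b) := con ½ :* (b :- a)) refl a b

  riemann-upper : ∀ k {a b} → 0ℚ < a → 0ℚ < b → riemann k a b ≤ (b - a) * recip a
  riemann-upper zero    0<a 0<b = ℚ.≤-refl
  riemann-upper (suc k) {a} {b} 0<a 0<b = begin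
    riemann k a mid + riemann k mid b
      ≤⟨ ℚ.+-mono-≤ (riemann-upper k 0<a 0<mid) (riemann-upper k 0<mid 0<b) ⟩
    (mid - a) * recip a + (b - mid) * recip mid
      ≡⟨ cong (λ d → (mid - a) * recip a + d * recip mid) (trans (right-half a b) (sym (left-half a b))) ⟩
    (mid - a) * recip a + (mid - a) * recip mid
      ≤⟨ ℚ.+-monoʳ-≤ ((mid - a) * recip a) (step 0<a 0<mid) ⟩
    (mid - a) * recip a + (mid - a) * recip a
      ≡⟨ cong (λ d → d * recip a + d * recip a) (left-half a b) ⟩
    ½ * (b - a) * recip a + ½ * (b - a) * recip a
      ≡⟨ solve 2 (λ d u → con ½ :* d :* u :+ con ½ :* d :* u := d :* u) refl (b - a) (recip a) ⟩
    (b - a) * recip a ∎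
    where mid = ½ * (a + b)
          0<mid = mid>0 0<a 0<b

  riemann-lower : ∀ k {a b} → 0ℚ < a → 0ℚ < b → (b - a) * recip b ≤ riemann k a b
  riemann-lower zero    0<a 0<b = step 0<a 0<b
  riemann-lower (suc k) {a} {b} 0<a 0<b = begin
    (b - a) * recip b
      ≡⟨ solve 2 (λ d u → con ½ :* d :* u :+ con ½ :* d :* u := d :* u) refl (b - a) (recip b) ⟨
    ½ * (b - a) * recip b + ½ * (b - a) * recip b
      ≡⟨ cong (λ d → d * recip b + d * recip b) (right-half a b) ⟨
    (b - mid) * recip b + (b - mid) * recip b
      ≤⟨ ℚ.+-monoˡ-≤ ((b - mid) * recip b) (step 0<mid 0<b) ⟩
    (b - mid) * recip mid + (b - mid) * recip b
      ≡⟨ cong (λ d → d * recip mid + (b - mid) * recip b) (trans (right-half a b) (sym (left-half a b))) ⟩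
    (mid - a) * recip mid + (b - mid) * recip b
      ≤⟨ ℚ.+-mono-≤ (riemann-lower k 0<a 0<mid) (riemann-lower k 0<mid 0<b) ⟩
    riemann k a mid + riemann k mid b ∎
    where mid = ½ * (a + b)
          0<mid = mid>0 0<a 0<b

  gap : ℚ → ℚ → ℚ
  gap a b = (b - a) * (recip a - recip b)

  refine-≥ : ∀ k j {a b} → 0ℚ < a → 0ℚ < b → 0ℚ ≤ riemann k a b - riemann (k ℕ.+ j) a b
  refine-≥ zero    j 0<a 0<b = ≤⇒0≤- (riemann-upper j 0<a 0<b)
  refine-≥ (suc k) j {a} {b} 0<a 0<b = subst (0ℚ ≤_)
    (solve 4 (λ p q r s → (p :- r) :+ (q :- s) := (p :+ q) :- (r :+ s)) refl
      (riemann k a mid) (riemann k mid b) (riemann (k ℕ.+ j) a mid) (riemann (k ℕ.+ j) mid b))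
    (0≤+ (refine-≥ k j 0<a 0<mid) (refine-≥ k j 0<mid 0<b))
    where mid = ½ * (a + b)
          0<mid = mid>0 0<a 0<b

  refine-≤ : ∀ k j {a b} → 0ℚ < a → 0ℚ < b → riemann k a b - riemann (k ℕ.+ j) a b ≤ half^ k * gap a b
  refine-≤ zero    j {a} {b} 0<a 0<b = begin
    (b - a) * recip a - riemann j a b      ≤⟨ ℚ.+-monoʳ-≤ ((b - a) * recip a) (ℚ.neg-antimono-≤ (riemann-lower j 0<a 0<b)) ⟩
    (b - a) * recip a - (b - a) * recip b  ≡⟨ solve 3 (λ d u v → d :* u :- d :* v := con 1ℚ :* (d :* (u :- v))) refl (b - a) (recip a) (recip b) ⟩
    1ℚ * gap a b                           ∎
  refine-≤ (suc k) j {a} {b} 0<a 0<b = begin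
    (riemann k a mid + riemann k mid b) - (riemann (k ℕ.+ j) a mid + riemann (k ℕ.+ j) mid b)
      ≡⟨ solve 4 (λ p q r s → (p :- r) :+ (q :- s) := (p :+ q) :- (r :+ s)) refl
           (riemann k a mid) (riemann k mid b) (riemann (k ℕ.+ j) a mid) (riemann (k ℕ.+ j) mid b) ⟨
    (riemann k a mid - riemann (k ℕ.+ j) a mid) + (riemann k mid b - riemann (k ℕ.+ j) mid b)
      ≤⟨ ℚ.+-mono-≤ (refine-≤ k j 0<a 0<mid) (refine-≤ k j 0<mid 0<b) ⟩
    half^ k * ((mid - a) * (recip a - recip mid)) + half^ k * ((b - mid) * (recip mid - recip b))
      ≡⟨ cong₂ (λ d e → half^ k * (d * (recip a - recip mid)) + half^ k * (e * (recip mid - recip b))) (left-half a b) (right-half a b) ⟩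
    half^ k * (½ * (b - a) * (recip a - recip mid)) + half^ k * (½ * (b - a) * (recip mid - recip b))
      ≡⟨ solve 5 (λ h d u v w → h :* (con ½ :* d :* (u :- v)) :+ h :* (con ½ :* d :* (v :- w)) := con ½ :* h :* (d :* (u :- w))) refl
           (half^ k) (b - a) (recip a) (recip mid) (recip b) ⟩
    ½ * half^ k * gap a b ∎
    where mid = ½ * (a + b)
          0<mid = mid>0 0<a 0<b

  diagonal-cauchy : (F : ℕ → S) → (∀ k → IsCauchy (F k)) →
    (∀ ε → 0ℚ < ε → ∃[ N ] ∀ k n → N ℕ.≤ k → N ℕ.≤ n → ∣ F N n - F k n ∣ ≤ ε) →
    IsCauchy λ n → F n n
  diagonal-cauchy F cauchy-at uniform ε 0<ε
    with uniform (½ * (½ * ε)) (0<* 0<½ (0<* 0<½ 0<ε))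
  ... | N , U with cauchy-at N (½ * ε) (0<* 0<½ 0<ε)
  ... | M , C = N ℕ.⊔ M , λ m n hm hn → begin
    ∣ F m m - F n n ∣
      ≤⟨ triangle (F m m) (F N m) (F n n) ⟩
    ∣ F m m - F N m ∣ + ∣ F N m - F n n ∣
      ≤⟨ ℚ.+-monoʳ-≤ ∣ F m m - F N m ∣ (triangle (F N m) (F N n) (F n n)) ⟩
    ∣ F m m - F N m ∣ + (∣ F N m - F N n ∣ + ∣ F N n - F n n ∣)
      ≤⟨ ℚ.+-mono-≤ (subst (_≤ δ) (∣-∣-sym (F N m) (F m m)) (U m m (l hm) (l hm)))
           (ℚ.+-mono-≤ (C m n (r hm) (r hn)) (U n n (l hn) (l hn))) ⟩
    δ + (½ * ε + δ)
      ≡⟨ solve 1 (λ ε → con ½ :* (con ½ :* ε) :+ (con ½ :* ε :+ con ½ :* (con ½ :* ε)) := ε) refl ε ⟩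
    ε ∎
    where
    δ = ½ * (½ * ε)
    l : ∀ {n} → N ℕ.⊔ M ℕ.≤ n → N ℕ.≤ n
    l = ℕ.m⊔n≤o⇒m≤o N M
    r : ∀ {n} → N ℕ.⊔ M ℕ.≤ n → M ℕ.≤ n
    r = ℕ.m⊔n≤o⇒n≤o N M

  logSeq xlogxSeq : S → S
  logSeq   x n = riemann n 1ℚ (x n)
  xlogxSeq x n = (x n ⊔ 0ℚ) * riemann n 1ℚ (x n ⊔ 0ℚ)

  gap₁ : ∀ {q} → 0ℚ < q → gap 1ℚ q ≡ q + recip q - (1ℚ + 1ℚ)
  gap₁ {q} 0<q = begin-equality
    (q - 1ℚ) * (1ℚ - recip q)
      ≡⟨ solve 2 (λ q r → (q :- con 1ℚ) :* (con 1ℚ :- r) := q :+ r :- (con 1ℚ :+ q :* r)) refl q (recip q) ⟩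
    q + recip q - (1ℚ + q * recip q)
      ≡⟨ cong (λ u → q + recip q - (1ℚ + u)) (recip-inverse 0<q) ⟩
    q + recip q - (1ℚ + 1ℚ) ∎

  gap₁-≤ : ∀ {q} → 0ℚ < q → gap 1ℚ q ≤ q + recip q
  gap₁-≤ {q} 0<q = ≤-by (1ℚ + 1ℚ) (0≤+ (ℚ.<⇒≤ 0<1) (ℚ.<⇒≤ 0<1))
    (trans (cong (_+ (1ℚ + 1ℚ)) (gap₁ 0<q))
      (solve 2 (λ u v → u :- v :+ v := u) refl (q + recip q) (1ℚ + 1ℚ)))

  q*gap₁-≤ : ∀ {q} → 0ℚ < q → q * gap 1ℚ q ≤ q * q + 1ℚ
  q*gap₁-≤ {q} 0<q = begin
    q * gap 1ℚ q            ≤⟨ ℚ.*-monoˡ-≤-nonNeg q {{ℚ.nonNegative (ℚ.<⇒≤ 0<q)}} (gap₁-≤ 0<q) ⟩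
    q * (q + recip q)       ≡⟨ ℚ.*-distribˡ-+ q q (recip q) ⟩
    q * q + q * recip q     ≡⟨ cong (_+_ (q * q)) (recip-inverse 0<q) ⟩
    q * q + 1ℚ              ∎

  refine : ∀ N k {q} → N ℕ.≤ k → 0ℚ < q → ∣ riemann N 1ℚ q - riemann k 1ℚ q ∣ ≤ half^ N * gap 1ℚ q
  refine N k {q} N≤k 0<q = subst (λ k → ∣ riemann N 1ℚ q - riemann k 1ℚ q ∣ ≤ half^ N * gap 1ℚ q) (ℕ.m+[n∸m]≡n N≤k)
    (subst (_≤ half^ N * gap 1ℚ q) (sym (ℚ.0≤p⇒∣p∣≡p (refine-≥ N (k ℕ.∸ N) 0<1 0<q))) (refine-≤ N (k ℕ.∸ N) 0<1 0<q))

  zero-times : ∀ {q} u v → q ≡ 0ℚ → ∣ q * u - q * v ∣ ≡ 0ℚ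
  zero-times u v refl = cong₂ (λ s t → ∣ s - t ∣) (ℚ.*-zeroˡ u) (ℚ.*-zeroˡ v)

  refine* : ∀ N k {q} → N ℕ.≤ k → 0ℚ ≤ q → ∣ q * riemann N 1ℚ q - q * riemann k 1ℚ q ∣ ≤ half^ N * (q * q + 1ℚ)
  refine* N k {q} N≤k 0≤q with q ℚ.≟ 0ℚ
  ... | yes q≡0 = begin
    ∣ q * riemann N 1ℚ q - q * riemann k 1ℚ q ∣  ≡⟨ zero-times (riemann N 1ℚ q) (riemann k 1ℚ q) q≡0 ⟩
    0ℚ                                           ≤⟨ 0≤* (0≤half^ N) (0≤+ (square≥0 q) (ℚ.<⇒≤ 0<1)) ⟩
    half^ N * (q * q + 1ℚ)                       ∎
  ... | no q≢0 = begin
    ∣ q * riemann N 1ℚ q - q * riemann k 1ℚ q ∣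
      ≡⟨ cong ∣_∣ (solve 3 (λ q u v → q :* u :- q :* v := q :* (u :- v)) refl q (riemann N 1ℚ q) (riemann k 1ℚ q)) ⟩
    ∣ q * (riemann N 1ℚ q - riemann k 1ℚ q) ∣
      ≡⟨ trans (ℚ.∣p*q∣≡∣p∣*∣q∣ q _) (cong (_* ∣ riemann N 1ℚ q - riemann k 1ℚ q ∣) (ℚ.0≤p⇒∣p∣≡p 0≤q)) ⟩
    q * ∣ riemann N 1ℚ q - riemann k 1ℚ q ∣
      ≤⟨ ℚ.*-monoˡ-≤-nonNeg q {{ℚ.nonNegative 0≤q}} (refine N k N≤k 0<q) ⟩
    q * (half^ N * gap 1ℚ q)
      ≡⟨ solve 3 (λ q h g → q :* (h :* g) := h :* (q :* g)) refl q (half^ N) (gap 1ℚ q) ⟩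
    half^ N * (q * gap 1ℚ q)
      ≤⟨ ℚ.*-monoˡ-≤-nonNeg (half^ N) {{ℚ.nonNegative (0≤half^ N)}} (q*gap₁-≤ 0<q) ⟩
    half^ N * (q * q + 1ℚ) ∎
    where
    0<q : 0ℚ < q
    0<q = ℚ.≰⇒> (λ q≤0 → q≢0 (ℚ.≤-antisym q≤0 0≤q))

  uniformly : ∀ {F : ℕ → S} K → 0ℚ ≤ K →
    Eventually (λ n → ∀ N k → N ℕ.≤ k → ∣ F N n - F k n ∣ ≤ half^ N * K) →
    ∀ ε → 0ℚ < ε → ∃[ N ] ∀ k n → N ℕ.≤ k → N ℕ.≤ n → ∣ F N n - F k n ∣ ≤ ε
  uniformly {F} K 0≤K (M , small) ε 0<ε = from-small (half^-small K ε 0<ε)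
    where
    decreasing : ∀ N M → half^ (N ℕ.+ M) ≤ half^ N
    decreasing zero    M = half^≤1 M
    decreasing (suc N) M = ℚ.*-monoˡ-≤-nonNeg ½ (decreasing N M)
    from-small : ∃[ N ] half^ N * K ≤ ε → ∃[ N ] ∀ k n → N ℕ.≤ k → N ℕ.≤ n → ∣ F N n - F k n ∣ ≤ ε
    from-small (N , hN) = N ℕ.+ M , λ k n hk hn → begin
      ∣ F (N ℕ.+ M) n - F k n ∣  ≤⟨ small n (ℕ.≤-trans (ℕ.m≤n+m M N) hn) (N ℕ.+ M) k hk ⟩
      half^ (N ℕ.+ M) * K        ≤⟨ ℚ.*-monoʳ-≤-nonNeg K {{ℚ.nonNegative 0≤K}} (decreasing N M) ⟩
      half^ N * K                ≤⟨ hN ⟩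
      ε                          ∎

  logSeq-cauchy : ∀ {x} δ → 0ℚ < δ → Eventually (λ n → δ ≤ x n) → IsCauchy x → IsCauchy (logSeq x)
  logSeq-cauchy {x} δ 0<δ δ≤x cx = from-bound (bounded cx)
    where
    F : ℕ → S
    F k n = riemann k 1ℚ (x n)
    from-bound : Bounded x → IsCauchy (logSeq x)
    from-bound (B , 0<B , xB) = diagonal-cauchy F
      (λ k → riemann-cauchy k {λ _ → 1ℚ} {x} 1ℚ 0<1 (0 , λ _ _ → ℚ.≤-refl)
               (proj₁ δ≤x , λ n h → ℚ.≤-trans (ℚ.<⇒≤ 0<δ) (proj₂ δ≤x n h)) (const-cauchy 1ℚ) cx)
      (uniformly {F} (B + recip δ) (0≤+ (ℚ.<⇒≤ 0<B) (0≤recip 0<δ))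
        (proj₁ ev , λ n h N k N≤k →
          let δ≤q = proj₁ (proj₂ ev n h) ; q≤B = proj₂ (proj₂ ev n h)
              0<q = ℚ.<-≤-trans 0<δ δ≤q in
          ℚ.≤-trans (refine N k N≤k 0<q)
            (ℚ.*-monoˡ-≤-nonNeg (half^ N) {{ℚ.nonNegative (0≤half^ N)}}
              (ℚ.≤-trans (gap₁-≤ 0<q)
                (ℚ.+-mono-≤ (ℚ.≤-trans (≤∣∣ (x n)) q≤B) (recip-antitone 0<δ δ≤q))))))
      where ev = both δ≤x xB

  xlogxSeq-cauchy : ∀ {x} → IsCauchy x → IsCauchy (xlogxSeq x)
  xlogxSeq-cauchy {x} cx = from-bound (bounded {x⁺} (⊔0-cauchy {x} cx))
    where
    x⁺ : S
    x⁺ n = x n ⊔ 0ℚ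
    0≤x⁺ : ∀ n → 0ℚ ≤ x⁺ n
    0≤x⁺ n = ℚ.p≤q⊔p (x n) 0ℚ
    F : ℕ → S
    F k n = x⁺ n * riemann k 1ℚ (x⁺ n)
    from-bound : Bounded x⁺ → IsCauchy (xlogxSeq x)
    from-bound (B , 0<B , M , xB) = diagonal-cauchy F
      (λ k → *-cauchy {x⁺} {λ n → riemann k 1ℚ (x⁺ n)} (⊔0-cauchy {x} cx)
               (riemann-cauchy k {λ _ → 1ℚ} {x⁺} 1ℚ 0<1 (0 , λ _ _ → ℚ.≤-refl) (0 , λ n _ → 0≤x⁺ n)
                 (const-cauchy 1ℚ) (⊔0-cauchy {x} cx)))
      (uniformly {F} (B * B + 1ℚ) (0≤+ (square≥0 B) (ℚ.<⇒≤ 0<1))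
        (M , λ n h N k N≤k → let x⁺≤B = ℚ.≤-trans (≤∣∣ (x⁺ n)) (xB n h) in
          ℚ.≤-trans (refine* N k N≤k (0≤x⁺ n))
            (ℚ.*-monoˡ-≤-nonNeg (half^ N) {{ℚ.nonNegative (0≤half^ N)}}
              (ℚ.+-monoˡ-≤ 1ℚ (*-mono-≤ (0≤x⁺ n) (ℚ.<⇒≤ 0<B) x⁺≤B x⁺≤B)))))

open Rationals

-- Cantor reals. The quotient is not formed: everything below respects the
-- equality "the difference tends to 0".
record ℝ : Set where
  constructor mkℝ
  field
    seq    : ℕ → ℚ
    cauchy : IsCauchy seq

open ℝ public

infix 4 _≈_ _≤_ _<_

_≈_ _≤_ _<_ : ℝ → ℝ → Set
x ≈ y = ∀ ε → 0ℚ ℚ.< ε → Eventually λ n → ℚ.∣ seq x n ℚ.- seq y n ∣ ℚ.≤ ε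
x ≤ y = ∀ ε → 0ℚ ℚ.< ε → Eventually λ n → seq x n ℚ.≤ seq y n ℚ.+ ε
x < y = ∃[ δ ] (0ℚ ℚ.< δ) × Eventually λ n → seq x n ℚ.+ δ ℚ.≤ seq y n

fromℚ : ℚ → ℝ
fromℚ q = mkℝ (λ _ → q) (const-cauchy q)

fromℕ : ℕ → ℝ
fromℕ n = fromℚ ((+ n) ℚ./ 1)

0ℝ : ℝ
0ℝ = fromℚ 0ℚ

0<fromℕ : ∀ {n} → 1 ℕ.≤ n → 0ℝ < fromℕ n
0<fromℕ {suc m} _ = 1ℚ , 0<1 , 0 , λ _ _ → subst (0ℚ ℚ.+ 1ℚ ℚ.≤_) (sym (fromℕ-suc m))
  (ℚ.+-monoˡ-≤ 1ℚ (ℚ.nonNegative⁻¹ ((+ m) ℚ./ 1) {{ℚ.normalize-nonNeg m 1}}))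

infixl 6 _+_ _-_
infixl 7 _*_
infix  8 -_

-_ ∣_∣ : ℝ → ℝ
- x   = mkℝ (λ n → ℚ.- seq x n) (neg-cauchy {seq x} (cauchy x))
∣ x ∣ = mkℝ (λ n → ℚ.∣ seq x n ∣) (abs-cauchy {seq x} (cauchy x))

_+_ _*_ : ℝ → ℝ → ℝ
x + y = mkℝ (λ n → seq x n ℚ.+ seq y n) (+-cauchy {seq x} {seq y} (cauchy x) (cauchy y))
x * y = mkℝ (λ n → seq x n ℚ.* seq y n) (*-cauchy {seq x} {seq y} (cauchy x) (cauchy y))

_-_ : ℝ → ℝ → ℝ
x - y = x + (- y)

∑ : ∀ {k} → (Fin k → ℝ) → ℝ
∑ = Vector.foldr _+_ 0ℝ

-- log x = ∫₁ˣ dt/t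
log : (x : ℝ) → 0ℝ < x → ℝ
log x (δ , 0<δ , N , δ≤x) = mkℝ (logSeq (seq x))
  (logSeq-cauchy {seq x} δ 0<δ (N , λ n h → subst (ℚ._≤ seq x n) (ℚ.+-identityˡ δ) (δ≤x n h)) (cauchy x))

-- x log x on [0,∞), with 0 log 0 = 0. Constructively x = 0 and x > 0 cannot be
-- told apart, so this is a single sequence, the product of x with the sequence
-- of log x; xlogx-pos and xlogx-zero are the two cases of the convention.
-- Negative arguments, where the value is 0, do not matter.
xlogx : ℝ → ℝ
xlogx x = mkℝ (xlogxSeq (seq x)) (xlogxSeq-cauchy {seq x} (cauchy x))

xlogx-pos : ∀ x (0<x : 0ℝ < x) → xlogx x ≈ x * log x 0<x
xlogx-pos x (δ , 0<δ , N , δ≤x) ε 0<ε = N , λ n h →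
  let 0≤x = ℚ.≤-trans (ℚ.<⇒≤ 0<δ) (subst (ℚ._≤ seq x n) (ℚ.+-identityˡ δ) (δ≤x n h)) in
  subst (ℚ._≤ ε)
    (sym (trans (cong (λ q → ℚ.∣ q ℚ.* riemann n 1ℚ q ℚ.- seq x n ℚ.* riemann n 1ℚ (seq x n) ∣) (ℚ.p≥q⇒p⊔q≡p 0≤x))
      (cong ℚ.∣_∣ (ℚ.+-inverseʳ (seq x n ℚ.* riemann n 1ℚ (seq x n))))))
    (ℚ.<⇒≤ 0<ε)

xlogx-zero : xlogx 0ℝ ≈ 0ℝ
xlogx-zero ε 0<ε = 0 , λ n _ →
  subst (ℚ._≤ ε) (sym (cong (λ q → ℚ.∣ q ℚ.- 0ℚ ∣) (ℚ.*-zeroˡ (riemann n 1ℚ 0ℚ)))) (ℚ.<⇒≤ 0<ε)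

Tendsto : ((n : ℕ) .{{_ : ℕ.NonZero n}} → ℝ) → ℝ → Set
Tendsto s l = ∀ ε → 0ℚ ℚ.< ε →
  ∃[ N ] ∀ n .{{_ : ℕ.NonZero n}} → N ℕ.≤ n → ∣ s n - l ∣ ≤ fromℚ ε

IsLittleO-n : (ℕ → ℝ) → Set
IsLittleO-n f = ∀ ε → 0ℚ ℚ.< ε → Eventually λ n → ∣ f n ∣ ≤ fromℚ ε * fromℕ n

-- Rows and columns are numbered from 0: part i is λ_{i+1}.
record Partition : Set where
  field
    part       : ℕ → ℕ
    decreasing : ∀ i → part (suc i) ℕ.≤ part i
    bound      : ℕ
    vanishes   : ∀ i → bound ℕ.≤ i → part i ≡ 0

open Partition public

-- λ′_{j+1}
conjugatePart : Partition → ℕ → ℕ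
conjugatePart ν j = length (filter (λ i → j ℕ.<? part ν i) (upTo (bound ν)))

SquareFits : Partition → ℕ → Set
SquareFits ν d = ∀ {i} → i ℕ.< d → ∀ {j} → j ℕ.< d → j ℕ.< part ν i

squareFits? : ∀ ν → Decidable (SquareFits ν)
squareFits? ν d = ℕ.allUpTo? (λ i → ℕ.allUpTo? (λ j → j ℕ.<? part ν i) d) d

largest : ∀ {P : ℕ → Set} → Decidable P → ℕ → ℕ
largest P? zero    = 0
largest P? (suc n) = if does (P? (suc n)) then suc n else largest P? n

-- A d × d square that fits has d ≤ bound ν.
durfee : Partition → ℕ
durfee ν = largest (squareFits? ν) (bound ν)

-- frobeniusᵃ ν i and frobeniusᵇ ν i are a_{i+1} and b_{i+1}; the subtraction is
-- never truncated, since the diagonal cell (i , i) belongs to ν when i < d(ν).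
frobeniusᵃ frobeniusᵇ : Partition → ℕ → ℕ
frobeniusᵃ ν i = if does (i ℕ.<? durfee ν) then part ν i ℕ.∸ suc i else 0
frobeniusᵇ ν i = if does (i ℕ.<? durfee ν) then conjugatePart ν i ℕ.∸ suc i else 0

record SkewShape : Set where
  field
    outer inner : Partition
    inner⊆outer : ∀ i → part inner i ℕ.≤ part outer i

open SkewShape public

Cell : Set
Cell = ℕ × ℕ

row col : Cell → ℕ
row = proj₁
col = proj₂

_∈ₛ_ : Cell → SkewShape → Set
(i , j) ∈ₛ υ = part (inner υ) i ℕ.≤ j × j ℕ.< part (outer υ) i

Adjacent : SkewShape → Cell → Cell → Set
Adjacent υ c c′ = c ∈ₛ υ × c′ ∈ₛ υ × ℕ.∣ row c - row c′ ∣ ℕ.+ ℕ.∣ col c - col c′ ∣ ≡ 1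

Connected : SkewShape → Set
Connected υ = ∀ c c′ → c ∈ₛ υ → c′ ∈ₛ υ → Star (Adjacent υ) c c′

rowCells : SkewShape → ℕ → List Cell
rowCells υ i = applyUpTo (λ t → i , part (inner υ) i ℕ.+ t) (part (outer υ) i ℕ.∸ part (inner υ) i)

cells : SkewShape → List Cell
cells υ = List.concat (applyUpTo (rowCells υ) (bound (outer υ)))

size : SkewShape → ℕ
size υ = length (cells υ)

cell : ∀ υ → Fin (size υ) → Cell
cell υ = List.lookup (cells υ)

-- T gives the entry of the p-th cell; entries are numbered from 0.
Filling : SkewShape → Set
Filling υ = Vec (Fin (size υ)) (size υ)

IsStandard : ∀ υ → Filling υ → Set
IsStandard υ T = ∀ p q →
  (T ! p ≡ T ! q → p ≡ q) ×
  (row (cell υ p) ≡ row (cell υ q) → col (cell υ p) ℕ.< col (cell υ q) → T ! p Fin.< T ! q) ×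
  (col (cell υ p) ≡ col (cell υ q) → row (cell υ p) ℕ.< row (cell υ q) → T ! p Fin.< T ! q)
  where _!_ = Vec.lookup

isStandard? : ∀ υ → Decidable (IsStandard υ)
isStandard? υ T = Fin.all? λ p → Fin.all? λ q →
  ((Vec.lookup T p Fin.≟ Vec.lookup T q) →-dec (p Fin.≟ q)) ×-dec
  ((row (cell υ p) ℕ.≟ row (cell υ q)) →-dec ((col (cell υ p) ℕ.<? col (cell υ q)) →-dec (Vec.lookup T p Fin.<? Vec.lookup T q))) ×-dec
  ((col (cell υ p) ℕ.≟ col (cell υ q)) →-dec ((row (cell υ p) ℕ.<? row (cell υ q)) →-dec (Vec.lookup T p Fin.<? Vec.lookup T q)))

vectors : ∀ {A : Set} → List A → ∀ n → List (Vec A n)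
vectors xs zero    = [] ∷ []
vectors xs (suc n) = cartesianProductWith _∷_ xs (vectors xs n)

e : SkewShape → ℕ
e υ = length (filter (isStandard? υ) (vectors (allFin (size υ)) (size υ)))

∈-vectors : ∀ {A : Set} {xs : List A} → (∀ x → x ∈ xs) → ∀ {n} (v : Vec A n) → v ∈ vectors xs n
∈-vectors all []      = here refl
∈-vectors all (x ∷ v) = ∈-cartesianProductWith⁺ _∷_ (all x) (∈-vectors all v)

_⊏_ : Cell → Cell → Set
c ⊏ c′ = row c ℕ.< row c′ ⊎ (row c ≡ row c′ × col c ℕ.< col c′)

cells-sorted : ∀ υ → AllPairs _⊏_ (cells υ)
cells-sorted υ = AllPairs.concat⁺
  (All.applyUpTo⁺₂ (rowCells υ) (bound (outer υ)) λ i →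
    AllPairs.applyUpTo⁺₁ _ _ λ s<t _ → inj₂ (refl , ℕ.+-monoʳ-< (part (inner υ) i) s<t))
  (AllPairs.applyUpTo⁺₁ (rowCells υ) (bound (outer υ)) λ i<j _ →
    All.applyUpTo⁺₂ _ _ λ _ → All.applyUpTo⁺₂ _ _ λ _ → inj₁ i<j)

lookup-< : ∀ {A : Set} {_~_ : A → A → Set} {xs} → AllPairs _~_ xs →
           ∀ {p q} → p Fin.< q → List.lookup xs p ~ List.lookup xs q
lookup-< (x~xs ∷ _)  {Fin.zero}  {Fin.suc q} _           = All.lookup x~xs (∈-lookup q)
lookup-< (_ ∷ sorted) {Fin.suc p} {Fin.suc q} (ℕ.s≤s p<q) = lookup-< sorted p<q

readingOrder : ∀ υ → Filling υ
readingOrder υ = Vec.allFin (size υ)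

readingOrder-standard : ∀ υ → IsStandard υ (readingOrder υ)
readingOrder-standard υ p q
  rewrite Vec.lookup-allFin p | Vec.lookup-allFin q =
    (λ p≡q → p≡q) , rows , columns
  where
  rows : row (cell υ p) ≡ row (cell υ q) → col (cell υ p) ℕ.< col (cell υ q) → p Fin.< q
  rows r≡ c< with Fin.<-cmp p q
  ... | tri< p<q _ _    = p<q
  ... | tri≈ _ refl _   = contradiction c< (ℕ.<-irrefl refl)
  ... | tri> _ _ q<p with lookup-< (cells-sorted υ) q<p
  ...   | inj₁ r<       = contradiction r< (ℕ.<-irrefl (sym r≡))
  ...   | inj₂ (_ , c>) = contradiction c> (ℕ.<-asym c<)
  columns : col (cell υ p) ≡ col (cell υ q) → row (cell υ p) ℕ.< row (cell υ q) → p Fin.< q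
  columns _ r< with Fin.<-cmp p q
  ... | tri< p<q _ _    = p<q
  ... | tri≈ _ refl _   = contradiction r< (ℕ.<-irrefl refl)
  ... | tri> _ _ q<p with lookup-< (cells-sorted υ) q<p
  ...   | inj₁ r>       = contradiction r> (ℕ.<-asym r<)
  ...   | inj₂ (r≡ , _) = contradiction r< (ℕ.<-irrefl (sym r≡))

e-pos : ∀ υ → 1 ℕ.≤ e υ
e-pos υ = ∈-length (∈-filter⁺ (isStandard? υ) (∈-vectors ∈-allFin (readingOrder υ)) (readingOrder-standard υ))

-- Thoma–Vershik–Kerov limit
record _⟶⟨_,_⟩ {k} (ν : ℕ → Partition) (α β : Fin k → ℝ) : Set where
  field
    a-limit  : ∀ i → Tendsto (λ n → fromℚ ((+ frobeniusᵃ (ν n) (Fin.toℕ i)) ℚ./ n)) (α i)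
    b-limit  : ∀ i → Tendsto (λ n → fromℚ ((+ frobeniusᵇ (ν n) (Fin.toℕ i)) ℚ./ n)) (β i)
    durfee≤k : ∀ n → 1 ℕ.≤ n → durfee (ν n) ℕ.≤ k

-- Cut λ/μ into chains: its first k rows and, below row k, its first k columns.
-- There are no other cells, since the Durfee square of λ is at most k × k. Let ℓᵢ
-- be the lengths of the chains and N = Σ ℓᵢ the number of cells; up to a bounded
-- error, the ℓᵢ are differences of Frobenius coordinates.
--
-- Upper bound: a standard filling is determined by the word that records, for each
-- entry, the chain that contains it. A random word with letter weights ℓᵢ / N shows
-- that there are at most N^N / ∏ ℓᵢ^ℓᵢ such words.
--
-- Lower bound: fill the k × k square first, and then let every chain advance at
-- constant speed in B stages, the i-th row or column being delayed by i stages. Cells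
-- of one stage in different chains are then incomparable, so that the letters of a
-- stage may be arranged arbitrarily. All but O(k) of the stages contain qᵢ = ⌊ℓᵢ / B⌋
-- letters i, up to a bounded error in ℓᵢ, and their multinomial coefficient is within
-- a polynomial factor of Q^Q / ∏ qᵢ^qᵢ, where Q = Σ qᵢ.
--
-- Both bounds are exp (n c + o(n)) by the continuity of x log x; the terms in log n
-- cancel because N = Σ ℓᵢ.

module Submission where

-- `log` is the diagonal of ever finer Riemann sums, so all estimates compare rational sequences
-- entry by entry, up to errors that vanish along the sequence. The functional equation of log holds
-- only in this asymptotic sense. A limit αᵢ - πᵢ may be 0, and this cannot be decided; hence x log
-- x needs a modulus of continuity that is uniform down to 0, and it is applied to arguments that
-- vary with the stage.
--
-- The counting takes place in ℕ and logarithms are taken at the very end. Stirling's formula is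
-- replaced by a maximal term: (Σ qᵢ)^Q expands into few groups of terms, of which the one with
-- exponents qᵢ is the largest.
--
-- B is constant while n grows. Because of the delays all chains move simultaneously in only B - k
-- stages, and the k missing stages cost a factor of at most (2k)^(kQ). Since B Q = O(n), its
-- logarithm is O(n / B), so B is chosen in terms of ε. The polynomial factors, raised to the power
-- B, then cost O(B log n), which is absorbed by the choice of n.

-- Riemann sums for the logarithm and its functional equation

module Logarithm where

  open import Defs hiding (_≤_; _<_; _+_; _*_; _-_; -_; ∣_∣; _≈_)
  open Rationals
  import Algebra.Properties.CommutativeMonoid.Sum as Sum
  open import Data.Fin.Base as Fin using (Fin)
  open import Data.Integer.Base as ℤ using (+_)
  import Data.Integer.Properties as ℤ
  open import Data.Nat.Base as ℕ using (ℕ; zero; suc)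
  import Data.Nat.Properties as ℕ
  open import Data.Product.Base using (∃-syntax; _×_; _,_; proj₁; proj₂)
  open import Data.Rational.Base as ℚ using (ℚ; 0ℚ; 1ℚ; ½; _+_; _*_; _-_; -_; ∣_∣; _≤_; _<_; _⊔_; _⊓_)
  import Data.Rational.Properties as ℚ
  open import Data.Rational.Solver using (module +-*-Solver)
  import Data.Rational.Unnormalised.Base as ℚᵘ
  import Data.Rational.Unnormalised.Properties as ℚᵘ
  open import Data.Sum.Base using (_⊎_; inj₁; inj₂)
  open import Function.Base using (_∘_)
  open import Relation.Binary.PropositionalEquality
  open import Relation.Nullary using (Dec; yes; no)
  open ℚ.≤-Reasoning
  open +-*-Solver using (solve; _:=_; _:+_; _:*_; _:-_; :-_; con)
  private
    module Σℕ = Sum ℕ.+-0-commutativeMonoid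
    module Πℕ = Sum ℕ.*-1-commutativeMonoid
    module Σℚ = Sum ℚ.+-0-commutativeMonoid

  *ˡ : ∀ {p q r} → 0ℚ ≤ p → q ≤ r → p * q ≤ p * r
  *ˡ {p} 0≤p = ℚ.*-monoˡ-≤-nonNeg p {{ℚ.nonNegative 0≤p}}

  *ʳ : ∀ {p q r} → 0ℚ ≤ p → q ≤ r → q * p ≤ r * p
  *ʳ {p} 0≤p = ℚ.*-monoʳ-≤-nonNeg p {{ℚ.nonNegative 0≤p}}

  0≤1 : 0ℚ ≤ 1ℚ
  0≤1 = ℚ.<⇒≤ 0<1

  0≤½ : 0ℚ ≤ ½
  0≤½ = ℚ.<⇒≤ 0<½

  -≤⇒≤+ : ∀ {p q r} → p - q ≤ r → p ≤ q + r
  -≤⇒≤+ {p} {q} {r} h = subst (_≤ q + r) (solve 2 (λ p q → q :+ (p :- q) := p) refl p q) (ℚ.+-monoʳ-≤ q h)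

  ≤+⇒-≤ : ∀ {p q r} → p ≤ q + r → p - q ≤ r
  ≤+⇒-≤ {p} {q} {r} h = subst (p - q ≤_) (solve 2 (λ q r → (q :+ r) :- q := r) refl q r) (ℚ.+-monoˡ-≤ (- q) h)

  -- The dyadic Riemann sum of 1/(f g) over [0,1], where f and g are the affine
  -- functions with f(0) = a, f(1) = b and g(0) = a′, g(1) = b′.
  affineSum : ℕ → ℚ → ℚ → ℚ → ℚ → ℚ
  affineSum zero    a b a′ b′ = recip a * recip a′
  affineSum (suc k) a b a′ b′ = ½ * (affineSum k a mid a′ mid′ + affineSum k mid b mid′ b′)
    where mid  = ½ * (a + b)
          mid′ = ½ * (a′ + b′)

  -- The numerator of the difference of the integrands is constant on [0,1].
  riemann-difference : ∀ k {a b a′ b′} → 0ℚ < a → 0ℚ < b → 0ℚ < a′ → 0ℚ < b′ →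
    riemann k a′ b′ - riemann k a b ≡ (a * b′ - a′ * b) * affineSum k a b a′ b′
  riemann-difference zero {a} {b} {a′} {b′} 0<a 0<b 0<a′ 0<b′ = begin-equality
    (b′ - a′) * r′ - (b - a) * r
      ≡⟨ solve 6 (λ a b a′ b′ r r′ → (b′ :- a′) :* r′ :- (b :- a) :* r
           := b′ :* r′ :- a′ :* r′ :- b :* r :+ a :* r) refl a b a′ b′ r r′ ⟩
    b′ * r′ - a′ * r′ - b * r + a * r
      ≡⟨ cong₂ (λ u v → b′ * r′ - u - b * r + v) (recip-inverse 0<a′) (recip-inverse 0<a) ⟩
    b′ * r′ - 1ℚ - b * r + 1ℚ
      ≡⟨ solve 4 (λ b b′ r r′ → b′ :* r′ :- con 1ℚ :- b :* r :+ con 1ℚ := con 1ℚ :* (b′ :* r′) :- con 1ℚ :* (b :* r)) refl b b′ r r′ ⟩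
    1ℚ * (b′ * r′) - 1ℚ * (b * r)
      ≡⟨ cong₂ (λ u v → u * (b′ * r′) - v * (b * r)) (recip-inverse 0<a) (recip-inverse 0<a′) ⟨
    (a * r) * (b′ * r′) - (a′ * r′) * (b * r)
      ≡⟨ solve 6 (λ a b a′ b′ r r′ → (a :* r) :* (b′ :* r′) :- (a′ :* r′) :* (b :* r)
           := (a :* b′ :- a′ :* b) :* (r :* r′)) refl a b a′ b′ r r′ ⟩
    (a * b′ - a′ * b) * (r * r′) ∎
    where r  = recip a
          r′ = recip a′
  riemann-difference (suc k) {a} {b} {a′} {b′} 0<a 0<b 0<a′ 0<b′ = begin-equality
    (riemann k a′ m′ + riemann k m′ b′) - (riemann k a m + riemann k m b)
      ≡⟨ solve 4 (λ p q r s → (p :+ q) :- (r :+ s) := (p :- r) :+ (q :- s)) refl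
           (riemann k a′ m′) (riemann k m′ b′) (riemann k a m) (riemann k m b) ⟩
    (riemann k a′ m′ - riemann k a m) + (riemann k m′ b′ - riemann k m b)
      ≡⟨ cong₂ _+_ (riemann-difference k 0<a 0<m 0<a′ 0<m′) (riemann-difference k 0<m 0<b 0<m′ 0<b′) ⟩
    (a * m′ - a′ * m) * S + (m * b′ - m′ * b) * S′
      ≡⟨ solve 6 (λ a b a′ b′ S S′ →
           (a :* (con ½ :* (a′ :+ b′)) :- a′ :* (con ½ :* (a :+ b))) :* S
             :+ (con ½ :* (a :+ b) :* b′ :- con ½ :* (a′ :+ b′) :* b) :* S′
           := (a :* b′ :- a′ :* b) :* (con ½ :* (S :+ S′))) refl a b a′ b′ S S′ ⟩
    (a * b′ - a′ * b) * (½ * (S + S′)) ∎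
    where m   = ½ * (a + b)
          m′  = ½ * (a′ + b′)
          0<m  = mid>0 0<a 0<b
          0<m′ = mid>0 0<a′ 0<b′
          S   = affineSum k a m a′ m′
          S′  = affineSum k m b m′ b′

  module _ {a b : ℚ} (0<a : 0ℚ < a) (0<b : 0ℚ < b) where
    private
      m  = ½ * (a + b)
      ra = recip a
      rb = recip b
      rm = recip m
      0<m = mid>0 0<a 0<b

    -- Equivalently 1/(a m) + 1/(m b) = 2/(a b), the additivity of the integral of 1/f² for the
    -- affine function f from a to b.
    recip-mid : rm * (ra + rb) ≡ ra * rb + ra * rb
    recip-mid = begin-equality
      rm * (ra + rb)
        ≡⟨ solve 3 (λ ra rb rm → rm :* (ra :+ rb) := rm :* (con 1ℚ :* ra :+ con 1ℚ :* rb)) refl ra rb rm ⟩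
      rm * (1ℚ * ra + 1ℚ * rb)
        ≡⟨ cong₂ (λ u v → rm * (u * ra + v * rb)) (recip-inverse 0<b) (recip-inverse 0<a) ⟨
      rm * ((b * rb) * ra + (a * ra) * rb)
        ≡⟨ solve 5 (λ a b ra rb rm → rm :* ((b :* rb) :* ra :+ (a :* ra) :* rb)
             := ((con ½ :* (a :+ b)) :* rm) :* (ra :* rb :+ ra :* rb)) refl a b ra rb rm ⟩
      (m * rm) * (ra * rb + ra * rb)
        ≡⟨ cong (_* (ra * rb + ra * rb)) (recip-inverse 0<m) ⟩
      1ℚ * (ra * rb + ra * rb)
        ≡⟨ ℚ.*-identityˡ _ ⟩
      ra * rb + ra * rb ∎

    -- The inequality of the arithmetic and the geometric mean: m² exceeds a b by the square of (b -
    -- a)/2.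
    recip-mid² : rm * rm ≤ ra * rb
    recip-mid² = ≤-by ((½ * (b - a)) * (½ * (b - a)) * ((rm * rm) * (ra * rb)))
      (0≤* (square≥0 (½ * (b - a))) (0≤* (square≥0 rm) (0≤* (0≤recip 0<a) (0≤recip 0<b))))
      (begin-equality
        rm * rm + (½ * (b - a)) * (½ * (b - a)) * ((rm * rm) * (ra * rb))
          ≡⟨ solve 5 (λ a b ra rb rm →
               rm :* rm :+ (con ½ :* (b :- a)) :* (con ½ :* (b :- a)) :* ((rm :* rm) :* (ra :* rb))
               := rm :* rm :* (con 1ℚ :- (a :* ra) :* (b :* rb))
                  :+ (con ½ :* (a :+ b)) :* rm :* ((con ½ :* (a :+ b)) :* rm) :* (ra :* rb)) refl a b ra rb rm ⟩
        rm * rm * (1ℚ - (a * ra) * (b * rb)) + m * rm * (m * rm) * (ra * rb)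
          ≡⟨ cong₂ (λ u v → rm * rm * (1ℚ - u) + v * v * (ra * rb))
               (cong₂ _*_ (recip-inverse 0<a) (recip-inverse 0<b)) (recip-inverse 0<m) ⟩
        rm * rm * (1ℚ - 1ℚ * 1ℚ) + 1ℚ * 1ℚ * (ra * rb)
          ≡⟨ solve 2 (λ u v → u :* (con 1ℚ :- con 1ℚ :* con 1ℚ) :+ con 1ℚ :* con 1ℚ :* v := v) refl (rm * rm) (ra * rb) ⟩
        ra * rb ∎)

  mid-mono : ∀ {a b a′ b′} → a ≤ a′ → b ≤ b′ → ½ * (a + b) ≤ ½ * (a′ + b′)
  mid-mono a≤a′ b≤b′ = *ˡ 0≤½ (ℚ.+-mono-≤ a≤a′ b≤b′)

  -- The main terms 1/(a b) are additive under bisection, because 1/(a b) is the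
  -- integral; only the error terms have to be estimated.
  affineSum-upper : ∀ k {a b a′ b′} → 0ℚ < a → 0ℚ < b → a ≤ a′ → b ≤ b′ →
    affineSum k a b a′ b′ ≤ recip a * recip b + half^ k * (recip a * recip a - recip a * recip b)
  affineSum-upper zero {a} {b} {a′} 0<a 0<b a≤a′ b≤b′ = begin
    recip a * recip a′   ≤⟨ *ˡ (0≤recip 0<a) (recip-antitone 0<a a≤a′) ⟩
    recip a * recip a    ≡⟨ solve 2 (λ u v → u := v :+ con 1ℚ :* (u :- v)) refl (recip a * recip a) (recip a * recip b) ⟩
    recip a * recip b + 1ℚ * (recip a * recip a - recip a * recip b) ∎
  affineSum-upper (suc k) {a} {b} {a′} {b′} 0<a 0<b a≤a′ b≤b′ = begin
    ½ * (affineSum k a m a′ m′ + affineSum k m b m′ b′)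
      ≤⟨ *ˡ 0≤½ (ℚ.+-mono-≤ (affineSum-upper k 0<a 0<m a≤a′ m≤m′) (affineSum-upper k 0<m 0<b m≤m′ b≤b′)) ⟩
    ½ * ((ra * rm + h * (ra * ra - ra * rm)) + (rm * rb + h * (rm * rm - rm * rb)))
      ≡⟨ solve 4 (λ ra rb rm h → con ½ :* ((ra :* rm :+ h :* (ra :* ra :- ra :* rm)) :+ (rm :* rb :+ h :* (rm :* rm :- rm :* rb)))
           := con ½ :* (rm :* (ra :+ rb)) :+ con ½ :* h :* (ra :* ra :- rm :* (ra :+ rb) :+ rm :* rm)) refl ra rb rm h ⟩
    ½ * (rm * (ra + rb)) + ½ * h * (ra * ra - rm * (ra + rb) + rm * rm)
      ≡⟨ cong (λ u → ½ * u + ½ * h * (ra * ra - u + rm * rm)) (recip-mid 0<a 0<b) ⟩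
    ½ * (w + w) + ½ * h * (ra * ra - (w + w) + rm * rm)
      ≤⟨ ℚ.+-monoʳ-≤ (½ * (w + w)) (*ˡ (0≤half^ (suc k)) (ℚ.+-monoʳ-≤ (ra * ra - (w + w)) (recip-mid² 0<a 0<b))) ⟩
    ½ * (w + w) + ½ * h * (ra * ra - (w + w) + w)
      ≡⟨ solve 3 (λ u w h → con ½ :* (w :+ w) :+ con ½ :* h :* (u :- (w :+ w) :+ w) := w :+ con ½ :* h :* (u :- w)) refl (ra * ra) w h ⟩
    w + ½ * h * (ra * ra - w) ∎
    where m = ½ * (a + b)
          m′ = ½ * (a′ + b′)
          0<m = mid>0 0<a 0<b
          m≤m′ = mid-mono a≤a′ b≤b′
          h = half^ k
          ra = recip a
          rb = recip b
          rm = recip m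
          w = ra * rb

  affineSum-lower : ∀ k {a b a′ b′} → 0ℚ < a → 0ℚ < b → a ≤ a′ → b ≤ b′ →
    recip a′ * recip b′ + half^ k * (½ * (recip a′ * recip a′ - recip b′ * recip b′)) ≤ affineSum k a b a′ b′
  affineSum-lower zero {a} {b} {a′} {b′} 0<a 0<b a≤a′ b≤b′ = begin
    u * v + 1ℚ * (½ * (u * u - v * v))
      ≤⟨ ≤-by (½ * ((u - v) * (u - v))) (0≤* 0≤½ (square≥0 (u - v)))
           (solve 2 (λ u v → u :* v :+ con 1ℚ :* (con ½ :* (u :* u :- v :* v)) :+ con ½ :* ((u :- v) :* (u :- v)) := u :* u) refl u v) ⟩
    u * u
      ≤⟨ *ʳ (0≤recip 0<a′) (recip-antitone 0<a a≤a′) ⟩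
    recip a * u ∎
    where u = recip a′
          v = recip b′
          0<a′ = ℚ.<-≤-trans 0<a a≤a′
  affineSum-lower (suc k) {a} {b} {a′} {b′} 0<a 0<b a≤a′ b≤b′ = begin
    w + ½ * h * (½ * (ra * ra - rb * rb))
      ≡⟨ solve 4 (λ w h p q → w :+ con ½ :* h :* (con ½ :* (p :- q)) := con ½ :* (w :+ w) :+ con ½ :* h :* (con ½ :* (p :- q))) refl w h (ra * ra) (rb * rb) ⟩
    ½ * (w + w) + ½ * h * (½ * (ra * ra - rb * rb))
      ≡⟨ cong (λ u → ½ * u + ½ * h * (½ * (ra * ra - rb * rb))) (recip-mid 0<a′ 0<b′) ⟨
    ½ * (rm * (ra + rb)) + ½ * h * (½ * (ra * ra - rb * rb))
      ≡⟨ solve 4 (λ ra rb rm h →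
           con ½ :* (rm :* (ra :+ rb)) :+ con ½ :* h :* (con ½ :* (ra :* ra :- rb :* rb))
           := con ½ :* ((ra :* rm :+ h :* (con ½ :* (ra :* ra :- rm :* rm))) :+ (rm :* rb :+ h :* (con ½ :* (rm :* rm :- rb :* rb))))) refl ra rb rm h ⟩
    ½ * ((ra * rm + h * (½ * (ra * ra - rm * rm))) + (rm * rb + h * (½ * (rm * rm - rb * rb))))
      ≤⟨ *ˡ 0≤½ (ℚ.+-mono-≤ (affineSum-lower k 0<a 0<m a≤a′ m≤m′) (affineSum-lower k 0<m 0<b m≤m′ b≤b′)) ⟩
    ½ * (affineSum k a m a′ m′ + affineSum k m b m′ b′) ∎
    where m = ½ * (a + b)
          m′ = ½ * (a′ + b′)
          0<m = mid>0 0<a 0<b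
          0<a′ = ℚ.<-≤-trans 0<a a≤a′
          0<b′ = ℚ.<-≤-trans 0<b b≤b′
          m≤m′ = mid-mono a≤a′ b≤b′
          h = half^ k
          ra = recip a′
          rb = recip b′
          rm = recip m′
          w = ra * rb

  affineSum-nonneg : ∀ k {a b a′ b′} → 0ℚ < a → 0ℚ < b → 0ℚ < a′ → 0ℚ < b′ → 0ℚ ≤ affineSum k a b a′ b′
  affineSum-nonneg zero    0<a 0<b 0<a′ 0<b′ = 0≤* (0≤recip 0<a) (0≤recip 0<a′)
  affineSum-nonneg (suc k) 0<a 0<b 0<a′ 0<b′ =
    0≤* 0≤½ (0≤+ (affineSum-nonneg k 0<a (mid>0 0<a 0<b) 0<a′ (mid>0 0<a′ 0<b′))
                 (affineSum-nonneg k (mid>0 0<a 0<b) 0<b (mid>0 0<a′ 0<b′) 0<b′))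

  -- Stage `t` of the logarithm: the entries of `log x` are `ρ t (seq x t)`, so that a statement
  -- about `ρ` at every stage is one about the sequence of the real number.
  ρ : ℕ → ℚ → ℚ
  ρ t = riemann t 1ℚ

  ρ-difference : ∀ t {x y} → 0ℚ < x → 0ℚ < y → ρ t y - ρ t x ≡ (y - x) * affineSum t 1ℚ x 1ℚ y
  ρ-difference t {x} {y} 0<x 0<y = trans (riemann-difference t 0<1 0<x 0<1 0<y)
    (cong (_* affineSum t 1ℚ x 1ℚ y) (cong₂ _-_ (ℚ.*-identityˡ y) (ℚ.*-identityˡ x)))

  ρ-1 : ∀ t → ρ t 1ℚ ≡ 0ℚ
  ρ-1 zero = refl
  ρ-1 (suc t) = cong₂ _+_ (ρ-1 t) (ρ-1 t)

  ρ-mono : ∀ t {x y} → 0ℚ < x → x ≤ y → ρ t x ≤ ρ t y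
  ρ-mono t {x} {y} 0<x x≤y = ≤-by (ρ t y - ρ t x)
    (subst (0ℚ ≤_) (sym (ρ-difference t 0<x 0<y)) (0≤* (≤⇒0≤- x≤y) (affineSum-nonneg t 0<1 0<x 0<1 0<y)))
    (solve 2 (λ u v → v :+ (u :- v) := u) refl (ρ t y) (ρ t x))
    where 0<y = ℚ.<-≤-trans 0<x x≤y

  -- The classical bounds x - 1 and, in `ρ-lower`, 1 - 1/x carry no error term: bisection never
  -- moves the sum outside its coarsest upper and lower estimates.
  ρ-upper : ∀ t {x} → 0ℚ < x → ρ t x ≤ x - 1ℚ
  ρ-upper t {x} 0<x = ℚ.≤-trans (riemann-upper t 0<1 0<x) (ℚ.≤-reflexive (ℚ.*-identityʳ (x - 1ℚ)))

  ρ-lower : ∀ t {x} → 0ℚ < x → 1ℚ - recip x ≤ ρ t x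
  ρ-lower t {x} 0<x = ℚ.≤-trans (ℚ.≤-reflexive (trans
      (cong (_- recip x) (sym (recip-inverse 0<x)))
      (solve 2 (λ x r → x :* r :- r := (x :- con 1ℚ) :* r) refl x (recip x))))
    (riemann-lower t 0<1 0<x)

  -- The slope is the sum for 1/(f g), where f runs from 1 to x and g from 1 to y. As f ≤ g, it is
  -- bounded by the integral of 1/f², which is 1/x; in `ρ-slope-lower` the integral of 1/g² gives
  -- 1/y.
  ρ-slope-upper : ∀ t {x y} → 0ℚ < x → x ≤ y → ρ t y - ρ t x ≤ (y - x) * recip x + half^ t * (y - x)
  ρ-slope-upper t {x} {y} 0<x x≤y = begin
    ρ t y - ρ t x                      ≡⟨ ρ-difference t 0<x 0<y ⟩
    (y - x) * affineSum t 1ℚ x 1ℚ y    ≤⟨ *ˡ 0≤y-x (affineSum-upper t 0<1 0<x ℚ.≤-refl x≤y) ⟩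
    (y - x) * (1ℚ * r + h * (1ℚ * 1ℚ - 1ℚ * r))
      ≤⟨ ≤-by ((y - x) * (h * r)) (0≤* 0≤y-x (0≤* (0≤half^ t) (0≤recip 0<x)))
           (solve 3 (λ d h r → d :* (con 1ℚ :* r :+ h :* (con 1ℚ :* con 1ℚ :- con 1ℚ :* r)) :+ d :* (h :* r) := d :* r :+ h :* d) refl (y - x) h r) ⟩
    (y - x) * r + h * (y - x) ∎
    where 0<y = ℚ.<-≤-trans 0<x x≤y
          0≤y-x = ≤⇒0≤- x≤y
          r = recip x
          h = half^ t

  ρ-slope-lower : ∀ t {x y} → 0ℚ < x → x ≤ y →
    (y - x) * recip y ≤ (ρ t y - ρ t x) + half^ t * ((y - x) * (recip x * recip x))
  ρ-slope-lower t {x} {y} 0<x x≤y = begin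
    d * s
      ≤⟨ ≤-by (d * (h * ½) + h * (d * (r * r - ½ * (s * s))))
           (0≤+ (0≤* 0≤d (0≤* (0≤half^ t) 0≤½)) (0≤* (0≤half^ t) (0≤* 0≤d (≤⇒0≤- ss≤))))
           (solve 4 (λ d s h R → d :* s :+ (d :* (h :* con ½) :+ h :* (d :* (R :- con ½ :* (s :* s))))
             := d :* (con 1ℚ :* s :+ h :* (con ½ :* (con 1ℚ :* con 1ℚ :- s :* s))) :+ h :* (d :* R)) refl d s h (r * r)) ⟩
    d * (1ℚ * s + h * (½ * (1ℚ * 1ℚ - s * s))) + h * (d * (r * r))
      ≤⟨ ℚ.+-monoˡ-≤ (h * (d * (r * r))) (*ˡ 0≤d (affineSum-lower t 0<1 0<x ℚ.≤-refl x≤y)) ⟩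
    d * affineSum t 1ℚ x 1ℚ y + h * (d * (r * r))
      ≡⟨ cong (_+ h * (d * (r * r))) (ρ-difference t 0<x 0<y) ⟨
    (ρ t y - ρ t x) + h * (d * (r * r)) ∎
    where 0<y = ℚ.<-≤-trans 0<x x≤y
          0≤d = ≤⇒0≤- x≤y
          d = y - x
          r = recip x
          s = recip y
          h = half^ t
          ss≤ : ½ * (s * s) ≤ r * r
          ss≤ = begin
            ½ * (s * s)  ≤⟨ ≤-by (½ * (s * s)) (0≤* 0≤½ (square≥0 s)) (half+half (s * s)) ⟩
            s * s        ≤⟨ *-mono-≤ (0≤recip 0<y) (0≤recip 0<x) (recip-antitone 0<x x≤y) (recip-antitone 0<x x≤y) ⟩
            r * r        ∎

  a≤mid : ∀ {a b} → a ≤ b → a ≤ ½ * (a + b)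
  a≤mid {a} {b} a≤b = ≤-by (½ * (b - a)) (0≤* 0≤½ (≤⇒0≤- a≤b))
    (solve 2 (λ a b → a :+ con ½ :* (b :- a) := con ½ :* (a :+ b)) refl a b)

  mid≤b : ∀ {a b} → a ≤ b → ½ * (a + b) ≤ b
  mid≤b {a} {b} a≤b = ≤-by (½ * (b - a)) (0≤* 0≤½ (≤⇒0≤- a≤b))
    (solve 2 (λ a b → con ½ :* (a :+ b) :+ con ½ :* (b :- a) := b) refl a b)

  -- The slopes of ρ t between x and y lie between 1/y and 1/x, up to O(2⁻ᵗ), so its
  -- increments lie between the lower and the upper sums of ∫ dt/t over any partition.
  -- This makes log b − log a = log (b / a).
  ρ≤riemann : ∀ t k {a b} → 0ℚ < a → a ≤ b → ρ t b - ρ t a ≤ riemann k a b + half^ t * (b - a)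
  ρ≤riemann t zero    0<a a≤b = ρ-slope-upper t 0<a a≤b
  ρ≤riemann t (suc k) {a} {b} 0<a a≤b = begin
    ρ t b - ρ t a
      ≡⟨ solve 3 (λ x y z → x :- y := (z :- y) :+ (x :- z)) refl (ρ t b) (ρ t a) (ρ t m) ⟩
    (ρ t m - ρ t a) + (ρ t b - ρ t m)
      ≤⟨ ℚ.+-mono-≤ (ρ≤riemann t k 0<a (a≤mid a≤b)) (ρ≤riemann t k 0<m (mid≤b a≤b)) ⟩
    (riemann k a m + h * (m - a)) + (riemann k m b + h * (b - m))
      ≡⟨ solve 6 (λ p q h a b m → (p :+ h :* (m :- a)) :+ (q :+ h :* (b :- m)) := (p :+ q) :+ h :* (b :- a)) refl
           (riemann k a m) (riemann k m b) h a b m ⟩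
    (riemann k a m + riemann k m b) + h * (b - a) ∎
    where m = ½ * (a + b)
          0<m = ℚ.<-≤-trans 0<a (a≤mid a≤b)
          h = half^ t

  -- For a ≤ b the sum `riemann k a b` is an upper sum, while the slope estimate from below yields
  -- the lower sum; they differ by 2⁻ᵏ `gap a b`. The left end moves under bisection, so the slope
  -- error is stated with a fixed bound `δ` for it.
  riemann≤ρ : ∀ t k {δ a b} → 0ℚ < δ → δ ≤ a → a ≤ b →
    riemann k a b ≤ (ρ t b - ρ t a) + (half^ k * gap a b + half^ t * ((b - a) * (recip δ * recip δ)))
  riemann≤ρ t zero {δ} {a} {b} 0<δ δ≤a a≤b = begin
    (b - a) * recip a
      ≡⟨ solve 3 (λ d r s → d :* r := d :* s :+ con 1ℚ :* (d :* (r :- s))) refl (b - a) (recip a) (recip b) ⟩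
    (b - a) * recip b + 1ℚ * gap a b
      ≤⟨ ℚ.+-monoˡ-≤ (1ℚ * gap a b) (ρ-slope-lower t 0<a a≤b) ⟩
    (ρ t b - ρ t a) + h * ((b - a) * (recip a * recip a)) + 1ℚ * gap a b
      ≤⟨ ℚ.+-monoˡ-≤ (1ℚ * gap a b) (ℚ.+-monoʳ-≤ (ρ t b - ρ t a) (*ˡ (0≤half^ t) (*ˡ (≤⇒0≤- a≤b)
           (*-mono-≤ (0≤recip 0<a) (0≤recip 0<δ) (recip-antitone 0<δ δ≤a) (recip-antitone 0<δ δ≤a))))) ⟩
    (ρ t b - ρ t a) + h * ((b - a) * (recip δ * recip δ)) + 1ℚ * gap a b
      ≡⟨ solve 3 (λ x y z → x :+ y :+ z := x :+ (z :+ y)) refl (ρ t b - ρ t a) (h * ((b - a) * (recip δ * recip δ))) (1ℚ * gap a b) ⟩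
    (ρ t b - ρ t a) + (1ℚ * gap a b + h * ((b - a) * (recip δ * recip δ))) ∎
    where h = half^ t
          0<a = ℚ.<-≤-trans 0<δ δ≤a
  riemann≤ρ t (suc k) {δ} {a} {b} 0<δ δ≤a a≤b = begin
    riemann k a m + riemann k m b
      ≤⟨ ℚ.+-mono-≤ (riemann≤ρ t k 0<δ δ≤a (a≤mid a≤b)) (riemann≤ρ t k 0<δ (ℚ.≤-trans δ≤a (a≤mid a≤b)) (mid≤b a≤b)) ⟩
    ((ρ t m - ρ t a) + (g * ((m - a) * (ra - rm)) + h * ((m - a) * D))) + ((ρ t b - ρ t m) + (g * ((b - m) * (rm - rb)) + h * ((b - m) * D)))
      ≡⟨ cong₂ (λ u v → ((ρ t m - ρ t a) + (g * (u * (ra - rm)) + h * (u * D))) + ((ρ t b - ρ t m) + (g * (v * (rm - rb)) + h * (v * D))))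
           (left-half a b) (right-half a b) ⟩
    ((ρ t m - ρ t a) + (g * (½ * (b - a) * (ra - rm)) + h * (½ * (b - a) * D))) + ((ρ t b - ρ t m) + (g * (½ * (b - a) * (rm - rb)) + h * (½ * (b - a) * D)))
      ≡⟨ solve 10 (λ x y z g h d D ra rb rm →
            ((z :- y) :+ (g :* (con ½ :* d :* (ra :- rm)) :+ h :* (con ½ :* d :* D))) :+ ((x :- z) :+ (g :* (con ½ :* d :* (rm :- rb)) :+ h :* (con ½ :* d :* D)))
            := (x :- y) :+ (con ½ :* g :* (d :* (ra :- rb)) :+ h :* (d :* D))) refl
            (ρ t b) (ρ t a) (ρ t m) g h (b - a) D ra rb rm ⟩
    (ρ t b - ρ t a) + (½ * g * gap a b + h * ((b - a) * D)) ∎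
    where m = ½ * (a + b)
          g = half^ k
          h = half^ t
          ra = recip a
          rb = recip b
          rm = recip m
          D = recip δ * recip δ

  -- The substitution t = a s carries one dyadic subdivision to the other, so the sums agree
  -- exactly: the numerator in `riemann-difference` vanishes.
  riemann-scale : ∀ t {a b} → 0ℚ < a → 0ℚ < b → riemann t a b ≡ ρ t (b * recip a)
  riemann-scale t {a} {b} 0<a 0<b = begin-equality
    riemann t a b
      ≡⟨ solve 2 (λ x y → x := (x :- y) :+ y) refl (riemann t a b) (ρ t q) ⟩
    (riemann t a b - ρ t q) + ρ t q
      ≡⟨ cong (_+ ρ t q) (riemann-difference t 0<1 (0<* 0<b (0<recip 0<a)) 0<a 0<b) ⟩
    (1ℚ * b - a * (b * recip a)) * S + ρ t q
      ≡⟨ cong (λ u → u * S + ρ t q) (solve 3 (λ a b r → con 1ℚ :* b :- a :* (b :* r) := b :* (con 1ℚ :- a :* r)) refl a b (recip a)) ⟩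
    b * (1ℚ - a * recip a) * S + ρ t q
      ≡⟨ cong (λ u → b * (1ℚ - u) * S + ρ t q) (recip-inverse 0<a) ⟩
    b * (1ℚ - 1ℚ) * S + ρ t q
      ≡⟨ solve 3 (λ b S R → b :* (con 1ℚ :- con 1ℚ) :* S :+ R := R) refl b S (ρ t q) ⟩
    ρ t q ∎
    where q = b * recip a
          S = affineSum t 1ℚ q a b

  eventually : ∀ {P Q : ℕ → Set} → (∀ t → P t → Q t) → Eventually P → Eventually Q
  eventually f (N , p) = N , λ t h → f t (p t h)

  0<half^ : ∀ k → 0ℚ < half^ k
  0<half^ zero    = 0<1
  0<half^ (suc k) = 0<* 0<½ (0<half^ k)

  half^-decreasing : ∀ {M N} → M ℕ.≤ N → half^ N ≤ half^ M
  half^-decreasing {N = N} ℕ.z≤n = half^≤1 N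
  half^-decreasing (ℕ.s≤s M≤N)   = *ˡ 0≤½ (half^-decreasing M≤N)

  half^-vanishes : ∀ K → 0ℚ ≤ K → ∀ ε → 0ℚ < ε → Eventually λ t → half^ t * K ≤ ε
  half^-vanishes K 0≤K ε 0<ε = from-small (half^-small K ε 0<ε)
    where
    from-small : (∃[ N ] half^ N * K ≤ ε) → Eventually λ t → half^ t * K ≤ ε
    from-small (N , small) = N , λ t N≤t →
      ℚ.≤-trans (*ʳ 0≤K (half^-decreasing N≤t)) small

  -- Comparison of sequences up to a vanishing error

  infix 4 _≲_

  -- The order of the real numbers on bare sequences, without a Cauchy condition. As a record it
  -- determines both sequences, which can therefore be inferred from a proof.
  record _≲_ (u v : ℕ → ℚ) : Set where
    field
      eventually-≤ : ∀ ε → 0ℚ < ε → Eventually λ t → u t ≤ v t + ε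

  open _≲_ public

  ≤⇒≲ : ∀ {u v} → (∀ t → u t ≤ v t) → u ≲ v
  ≤⇒≲ {u} {v} u≤v .eventually-≤ ε 0<ε = 0 , λ t _ → ℚ.≤-trans (u≤v t) (≤-by ε (ℚ.<⇒≤ 0<ε) refl)

  ≲-refl : ∀ {u} → u ≲ u
  ≲-refl = ≤⇒≲ (λ _ → ℚ.≤-refl)

  ≲-trans : ∀ {u v w} → u ≲ v → v ≲ w → u ≲ w
  ≲-trans {u} {v} {w} u≲v v≲w .eventually-≤ ε 0<ε = eventually
    (λ t (p , q) → begin
      u t                    ≤⟨ p ⟩
      v t + ½ * ε            ≤⟨ ℚ.+-monoˡ-≤ (½ * ε) q ⟩
      w t + ½ * ε + ½ * ε    ≡⟨ trans (ℚ.+-assoc (w t) (½ * ε) (½ * ε)) (cong (_+_ (w t)) (half+half ε)) ⟩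
      w t + ε                ∎)
    (both (u≲v .eventually-≤ (½ * ε) 0<½ε) (v≲w .eventually-≤ (½ * ε) 0<½ε))
    where 0<½ε = 0<* 0<½ 0<ε

  +-mono-≲ : ∀ {u v u′ v′} → u ≲ v → u′ ≲ v′ → (λ t → u t + u′ t) ≲ (λ t → v t + v′ t)
  +-mono-≲ {u} {v} {u′} {v′} p q .eventually-≤ ε 0<ε = eventually
    (λ t (p , q) → begin
      u t + u′ t                          ≤⟨ ℚ.+-mono-≤ p q ⟩
      (v t + ½ * ε) + (v′ t + ½ * ε)      ≡⟨ solve 3 (λ x y ε → (x :+ con ½ :* ε) :+ (y :+ con ½ :* ε) := x :+ y :+ ε) refl (v t) (v′ t) ε ⟩
      v t + v′ t + ε                      ∎)
    (both (p .eventually-≤ (½ * ε) 0<½ε) (q .eventually-≤ (½ * ε) 0<½ε))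
    where 0<½ε = 0<* 0<½ 0<ε

  neg-antimono-≲ : ∀ {u v} → u ≲ v → (λ t → - v t) ≲ (λ t → - u t)
  neg-antimono-≲ {u} {v} p .eventually-≤ ε 0<ε = eventually
    (λ t p → ℚ.≤-trans (ℚ.≤-reflexive (solve 2 (λ v ε → :- v := :- (v :+ ε) :+ ε) refl (v t) ε))
                       (ℚ.+-monoˡ-≤ ε (ℚ.neg-antimono-≤ p)))
    (p .eventually-≤ ε 0<ε)

  *-mono-≲ : ∀ {c u v} → 0ℚ ≤ c → u ≲ v → (λ t → c * u t) ≲ (λ t → c * v t)
  *-mono-≲ {c} {u} {v} 0≤c p .eventually-≤ ε 0<ε = eventually
    (λ t p → begin
      c * u t                                ≤⟨ *ˡ 0≤c p ⟩
      c * (v t + ε * recip (c + 1ℚ))         ≤⟨ ≤-by (ε * recip (c + 1ℚ)) (ℚ.<⇒≤ (0<* 0<ε (0<recip 0<c+1)))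
                                                  (solve 4 (λ c v ε r → c :* (v :+ ε :* r) :+ ε :* r := c :* v :+ ε :* ((c :+ con 1ℚ) :* r)) refl c (v t) ε (recip (c + 1ℚ))) ⟩
      c * v t + ε * ((c + 1ℚ) * recip (c + 1ℚ))  ≡⟨ cong (λ r → c * v t + ε * r) (recip-inverse 0<c+1) ⟩
      c * v t + ε * 1ℚ                           ≡⟨ cong (_+_ (c * v t)) (ℚ.*-identityʳ ε) ⟩
      c * v t + ε                                ∎)
    -- Dividing by c + 1 rather than by c admits c = 0.
    (p .eventually-≤ (ε * recip (c + 1ℚ)) (0<* 0<ε (0<recip 0<c+1)))
    where
    0<c+1 : 0ℚ < c + 1ℚ
    0<c+1 = subst (0ℚ <_) (ℚ.+-comm 1ℚ c) (0<+ 0<1 0≤c)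

  eventually-half^⇒≲ : ∀ {u v} K → 0ℚ ≤ K → Eventually (λ t → u t ≤ v t + half^ t * K) → u ≲ v
  eventually-half^⇒≲ {u} {v} K 0≤K u≤v .eventually-≤ ε 0<ε = eventually
    (λ t (p , h) → ℚ.≤-trans p (ℚ.+-monoʳ-≤ (v t) h))
    (both u≤v (half^-vanishes K 0≤K ε 0<ε))

  half^⇒≲ : ∀ {u v} K → 0ℚ ≤ K → (∀ t → u t ≤ v t + half^ t * K) → u ≲ v
  half^⇒≲ {u} {v} K 0≤K u≤v = eventually-half^⇒≲ K 0≤K (0 , λ t _ → u≤v t)

  infix 4 _≅_

  _≅_ : (ℕ → ℚ) → (ℕ → ℚ) → Set
  u ≅ v = u ≲ v × v ≲ u

  ≅-reflexive : ∀ {u v} → (∀ t → u t ≡ v t) → u ≅ v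
  ≅-reflexive eq = ≤⇒≲ (λ t → ℚ.≤-reflexive (eq t)) , ≤⇒≲ (λ t → ℚ.≤-reflexive (sym (eq t)))

  ≅-sym : ∀ {u v} → u ≅ v → v ≅ u
  ≅-sym (p , q) = q , p

  ≅-trans : ∀ {u v w} → u ≅ v → v ≅ w → u ≅ w
  ≅-trans {u} {v} {w} (p , p′) (q , q′) = ≲-trans p q , ≲-trans q′ p′

  +-cong-≅ : ∀ {u v u′ v′} → u ≅ v → u′ ≅ v′ → (λ t → u t + u′ t) ≅ (λ t → v t + v′ t)
  +-cong-≅ {u} {v} {u′} {v′} (p , p′) (q , q′) =
    +-mono-≲ p q , +-mono-≲ p′ q′

  neg-cong-≅ : ∀ {u v} → u ≅ v → (λ t → - u t) ≅ (λ t → - v t)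
  neg-cong-≅ {u} {v} (p , q) = neg-antimono-≲ q , neg-antimono-≲ p

  *-cong-≅ : ∀ {c u v} → 0ℚ ≤ c → u ≅ v → (λ t → c * u t) ≅ (λ t → c * v t)
  *-cong-≅ {c} {u} {v} 0≤c (p , q) = *-mono-≲ 0≤c p , *-mono-≲ 0≤c q

  recip-cancel : ∀ {a} b → 0ℚ < a → (a * b) * recip a ≡ b
  recip-cancel {a} b 0<a = trans (solve 3 (λ a b r → (a :* b) :* r := (a :* r) :* b) refl a b (recip a))
    (trans (cong (_* b) (recip-inverse 0<a)) (ℚ.*-identityˡ b))

  0≤gap : ∀ {a b} → 0ℚ < a → a ≤ b → 0ℚ ≤ gap a b
  0≤gap 0<a a≤b = 0≤* (≤⇒0≤- a≤b) (≤⇒0≤- (recip-antitone 0<a a≤b))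

  -- After `riemann-scale` the left side is the sum from a to b. Refining it as far as the logarithm
  -- itself, k = t, makes the mesh error and the slope error vanish together.
  log-quotient-≥1 : ∀ {a b} → 0ℚ < a → a ≤ b → (λ t → ρ t (b * recip a)) ≅ (λ t → ρ t b - ρ t a)
  log-quotient-≥1 {a} {b} 0<a a≤b =
    half^⇒≲ (gap a b + (b - a) * (recip a * recip a))
      (0≤+ (0≤gap 0<a a≤b) (0≤* (≤⇒0≤- a≤b) (square≥0 (recip a))))
      (λ t → begin
        ρ t (b * recip a)  ≡⟨ riemann-scale t 0<a 0<b ⟨
        riemann t a b      ≤⟨ riemann≤ρ t t 0<a ℚ.≤-refl a≤b ⟩
        (ρ t b - ρ t a) + (half^ t * gap a b + half^ t * ((b - a) * (recip a * recip a)))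
          ≡⟨ cong (_+_ (ρ t b - ρ t a)) (ℚ.*-distribˡ-+ (half^ t) (gap a b) _) ⟨
        (ρ t b - ρ t a) + half^ t * (gap a b + (b - a) * (recip a * recip a)) ∎) ,
    half^⇒≲ (b - a) (≤⇒0≤- a≤b)
      (λ t → ℚ.≤-trans (ρ≤riemann t t 0<a a≤b) (ℚ.≤-reflexive (cong (_+ half^ t * (b - a)) (riemann-scale t 0<a 0<b))))
    where 0<b = ℚ.<-≤-trans 0<a a≤b

  log-product-≥1 : ∀ {a b} → 0ℚ < a → 1ℚ ≤ b → (λ t → ρ t (a * b)) ≅ (λ t → ρ t a + ρ t b)
  log-product-≥1 {a} {b} 0<a 1≤b = ≅-trans
    (≅-reflexive (λ t → solve 2 (λ x y → x := y :+ (x :- y)) refl (ρ t (a * b)) (ρ t a)))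
    (+-cong-≅ {λ t → ρ t a} {λ t → ρ t a} {λ t → ρ t (a * b) - ρ t a} {λ t → ρ t b} (≅-reflexive (λ _ → refl))
      (≅-trans
        (≅-sym (log-quotient-≥1 0<a a≤ab))
        (≅-reflexive (λ t → cong (ρ t) (recip-cancel b 0<a)))))
    where
    a≤ab : a ≤ a * b
    a≤ab = subst (_≤ a * b) (ℚ.*-identityʳ a) (*ˡ (ℚ.<⇒≤ 0<a) 1≤b)

  -- If b ≤ a, the inverse quotient a / b is at least 1. The product of the two quotients is 1,
  -- where `ρ` vanishes exactly, so the law for a / b gives the one for b / a.
  log-quotient : ∀ {a b} → 0ℚ < a → 0ℚ < b → (λ t → ρ t (b * recip a)) ≅ (λ t → ρ t b - ρ t a)
  log-quotient {a} {b} 0<a 0<b with ℚ.≤-total a b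
  ... | inj₁ a≤b = log-quotient-≥1 0<a a≤b
  ... | inj₂ b≤a = ≅-trans
    (≅-trans
      (≅-reflexive (λ t → solve 2 (λ x y → x := (x :+ y) :- y) refl (ρ t q) (ρ t q′)))
      (≅-trans
        (+-cong-≅
          (≅-sym (log-product-≥1 (0<* 0<b (0<recip 0<a)) 1≤q′))
          (≅-reflexive (λ _ → refl)))
        (≅-reflexive (λ t → trans (cong (_- ρ t q′) (trans (cong (ρ t) qq′≡1) (ρ-1 t))) (ℚ.+-identityˡ (- ρ t q′))))))
    (≅-trans
      (neg-cong-≅ (log-quotient-≥1 0<b b≤a))
      (≅-reflexive (λ t → solve 2 (λ x y → :- (x :- y) := y :- x) refl (ρ t a) (ρ t b))))
    where
    q  = b * recip a
    q′ = a * recip b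
    qq′≡1 : q * q′ ≡ 1ℚ
    qq′≡1 = trans (solve 4 (λ a b r s → (b :* r) :* (a :* s) := (a :* r) :* (b :* s)) refl a b (recip a) (recip b))
      (cong₂ _*_ (recip-inverse 0<a) (recip-inverse 0<b))
    1≤q′ : 1ℚ ≤ q′
    1≤q′ = subst (_≤ q′) (recip-inverse 0<b) (*ʳ (0≤recip 0<b) b≤a)

  -- Uniform continuity of x log x on bounded intervals

  ≢0⇒0< : ∀ {q} → 0ℚ ≤ q → q ≢ 0ℚ → 0ℚ < q
  ≢0⇒0< 0≤q q≢0 = ℚ.≰⇒> (λ q≤0 → q≢0 (ℚ.≤-antisym q≤0 0≤q))

  -- Stage `t` of x log x. The factor x makes it 0 at x = 0, whatever value `ρ t` takes there.
  η : ℕ → ℚ → ℚ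
  η t x = x * ρ t x

  -- y log y - x log x = (y - x) log y + x (log y - log x), and for x > 0 the two terms are at most
  -- (y - x)(y - 1) and, in the limit, y - x.
  η-upper : ∀ {x y} → 0ℚ ≤ x → x ≤ y → (λ t → η t y) ≲ (λ t → η t x + (y - x) * y)
  η-upper {x} {y} 0≤x x≤y = by-cases (x ℚ.≟ 0ℚ) (y ℚ.≟ 0ℚ)
    where
    by-cases : Dec (x ≡ 0ℚ) → Dec (y ≡ 0ℚ) → (λ t → η t y) ≲ (λ t → η t x + (y - x) * y)
    by-cases (yes refl) (yes refl) = ≤⇒≲ λ t → ℚ.≤-reflexive (trans (ℚ.*-zeroˡ (ρ t 0ℚ)) (sym (cong (_+ 0ℚ) (ℚ.*-zeroˡ (ρ t 0ℚ)))))
    by-cases (yes refl) (no y≢0) = ≤⇒≲ λ t → begin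
      y * ρ t y                  ≤⟨ *ˡ 0≤y (ρ-upper t 0<y) ⟩
      y * (y - 1ℚ)               ≤⟨ ≤-by y 0≤y (solve 2 (λ y r → y :* (y :- con 1ℚ) :+ y := con 0ℚ :* r :+ (y :- con 0ℚ) :* y) refl y (ρ t 0ℚ)) ⟩
      0ℚ * ρ t 0ℚ + (y - 0ℚ) * y ∎
      where 0≤y = x≤y
            0<y = ≢0⇒0< 0≤y y≢0
    by-cases (no x≢0) _ = half^⇒≲ (x * (y - x)) (0≤* 0≤x (≤⇒0≤- x≤y)) λ t → begin
      y * ρ t y
        ≡⟨ solve 4 (λ x y p q → y :* q := x :* p :+ ((y :- x) :* q :+ x :* (q :- p))) refl x y (ρ t x) (ρ t y) ⟩
      x * ρ t x + ((y - x) * ρ t y + x * (ρ t y - ρ t x))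
        ≤⟨ ℚ.+-monoʳ-≤ (x * ρ t x) (ℚ.+-mono-≤ (*ˡ (≤⇒0≤- x≤y) (ρ-upper t 0<y)) (*ˡ 0≤x (ρ-slope-upper t 0<x x≤y))) ⟩
      x * ρ t x + ((y - x) * (y - 1ℚ) + x * ((y - x) * recip x + half^ t * (y - x)))
        ≡⟨ solve 5 (λ x y p r h → x :* p :+ ((y :- x) :* (y :- con 1ℚ) :+ x :* ((y :- x) :* r :+ h :* (y :- x)))
             := x :* p :+ ((y :- x) :* y :+ (y :- x) :* (x :* r :- con 1ℚ)) :+ h :* (x :* (y :- x))) refl x y (ρ t x) (recip x) (half^ t) ⟩
      x * ρ t x + ((y - x) * y + (y - x) * (x * recip x - 1ℚ)) + half^ t * (x * (y - x))
        ≡⟨ cong (λ u → x * ρ t x + ((y - x) * y + (y - x) * (u - 1ℚ)) + half^ t * (x * (y - x))) (recip-inverse 0<x) ⟩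
      x * ρ t x + ((y - x) * y + (y - x) * (1ℚ - 1ℚ)) + half^ t * (x * (y - x))
        ≡⟨ cong (λ u → x * ρ t x + u + half^ t * (x * (y - x))) (solve 2 (λ u v → u :+ v :* (con 1ℚ :- con 1ℚ) := u) refl ((y - x) * y) (y - x)) ⟩
      x * ρ t x + (y - x) * y + half^ t * (x * (y - x)) ∎
      where 0<x = ≢0⇒0< 0≤x x≢0
            0<y = ℚ.<-≤-trans 0<x x≤y

  -- x log x ≤ x log y = y log y - (y - x) log y, but - log y is unbounded near 0. Writing it as log
  -- A - log (y A) bounds the last term by (y - x)(A + 1/(y A)), and y - x ≤ y leaves 1/A + A (y -
  -- x). The free parameter A spares a distinction between small and large y.
  η-lower : ∀ {A x y} → 1ℚ ≤ A → 0ℚ ≤ x → x ≤ y → (λ t → η t x) ≲ (λ t → η t y + (recip A + A * (y - x)))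
  η-lower {A} {x} {y} 1≤A 0≤x x≤y = by-cases (y ℚ.≟ 0ℚ)
    where
    d = y - x
    0≤d = ≤⇒0≤- x≤y
    0<A = ℚ.<-≤-trans 0<1 1≤A
    r = recip (y * A)
    by-cases : Dec (y ≡ 0ℚ) → (λ t → η t x) ≲ (λ t → η t y + (recip A + A * (y - x)))
    by-cases (yes y≡0) = ≤⇒≲ λ t → begin
      η t x                              ≡⟨ cong (η t) (ℚ.≤-antisym x≤y (subst (_≤ x) (sym y≡0) 0≤x)) ⟩
      η t y                              ≤⟨ ≤-by (recip A + A * d) (0≤+ (0≤recip 0<A) (0≤* (ℚ.<⇒≤ 0<A) 0≤d)) refl ⟩
      η t y + (recip A + A * d)          ∎
    by-cases (no y≢0) = positive (≢0⇒0< (ℚ.≤-trans 0≤x x≤y) y≢0)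
      where
      positive : 0ℚ < y → (λ t → η t x) ≲ (λ t → η t y + (recip A + A * (y - x)))
      positive 0<y = ≲-trans
        (≤⇒≲ λ t → begin
          x * ρ t x                      ≤⟨ xρ-mono t ⟩
          x * ρ t y                      ≡⟨ solve 3 (λ x y p → x :* p := y :* p :+ (y :- x) :* (:- p)) refl x y (ρ t y) ⟩
          y * ρ t y + d * (- ρ t y)      ∎)
        (+-mono-≲ (≲-refl {λ t → η t y})
          (≲-trans
            (*-mono-≲ 0≤d
              (≲-trans
                (≤⇒≲ λ t → ℚ.≤-reflexive (solve 2 (λ p q → :- p := q :+ :- (p :+ q)) refl (ρ t y) (ρ t A)))
                (+-mono-≲ (≲-refl {λ t → ρ t A})
                  (neg-antimono-≲ (proj₁ (log-product-≥1 0<y 1≤A))))))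
            (≤⇒≲ estimate)))
          where
          0<yA = 0<* 0<y 0<A
          xρ-mono : ∀ t → x * ρ t x ≤ x * ρ t y
          xρ-mono t = cases (x ℚ.≟ 0ℚ)
            where
            cases : Dec (x ≡ 0ℚ) → x * ρ t x ≤ x * ρ t y
            cases (yes x≡0) = ℚ.≤-reflexive (trans (cong (_* ρ t x) x≡0) (trans (ℚ.*-zeroˡ (ρ t x)) (sym (trans (cong (_* ρ t y) x≡0) (ℚ.*-zeroˡ (ρ t y))))))
            cases (no x≢0)  = *ˡ 0≤x (ρ-mono t (≢0⇒0< 0≤x x≢0) x≤y)
          dr≤1/A : d * r ≤ recip A
          dr≤1/A = begin
            d * r                    ≤⟨ *ʳ (0≤recip 0<yA) (≤-by {y - x} {y} x 0≤x (solve 2 (λ x y → y :- x :+ x := y) refl x y)) ⟩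
            y * r                    ≡⟨ ℚ.*-identityʳ (y * r) ⟨
            y * r * 1ℚ               ≡⟨ cong (y * r *_) (recip-inverse 0<A) ⟨
            y * r * (A * recip A)    ≡⟨ solve 4 (λ y r A s → y :* r :* (A :* s) := (y :* A) :* r :* s) refl y r A (recip A) ⟩
            y * A * r * recip A      ≡⟨ cong (_* recip A) (recip-inverse 0<yA) ⟩
            1ℚ * recip A             ≡⟨ ℚ.*-identityˡ (recip A) ⟩
            recip A                  ∎
          estimate : ∀ t → d * (ρ t A + - ρ t (y * A)) ≤ recip A + A * d
          estimate t = begin
            d * (ρ t A + - ρ t (y * A))
              ≤⟨ *ˡ 0≤d (ℚ.+-mono-≤ (ρ-upper t 0<A) (ℚ.neg-antimono-≤ (ρ-lower t 0<yA))) ⟩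
            d * ((A - 1ℚ) + - (1ℚ - r))
              ≤⟨ ≤-by (d + d) (0≤+ 0≤d 0≤d) (solve 3 (λ d A r → d :* ((A :- con 1ℚ) :+ :- (con 1ℚ :- r)) :+ (d :+ d) := d :* r :+ A :* d) refl d A r) ⟩
            d * r + A * d
              ≤⟨ ℚ.+-monoˡ-≤ (A * d) dr≤1/A ⟩
            recip A + A * d ∎

  ∣-∣≤⇒≤ : ∀ p q {r} → ∣ p - q ∣ ≤ r → p ≤ q + r
  ∣-∣≤⇒≤ p q h = -≤⇒≤+ (ℚ.≤-trans (≤∣∣ (p - q)) h)

  ∣-∣≤⇒≥ : ∀ p q {r} → ∣ p - q ∣ ≤ r → q ≤ p + r
  ∣-∣≤⇒≥ p q {r} h = ∣-∣≤⇒≤ q p (subst (_≤ r) (∣-∣-sym p q) h)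

  -- The Riemann sums for q log q converge at a rate uniform in q, which turns an
  -- asymptotic comparison at two fixed points into one at every stage.
  η-uniform : ∀ {C x y ω} → 0ℚ ≤ x → x ≤ C → 0ℚ ≤ y → y ≤ C → (λ t → η t x) ≲ (λ t → η t y + ω) →
    ∀ t → η t x ≤ η t y + ω + half^ t * ((C * C + 1ℚ) + (C * C + 1ℚ) + 1ℚ)
  η-uniform {C} {x} {y} {ω} 0≤x x≤C 0≤y y≤C x≲y t = begin
    η t x
      ≤⟨ ∣-∣≤⇒≤ (η t x) (η s x) (stages x 0≤x x≤C) ⟩
    η s x + K
      ≤⟨ ℚ.+-monoˡ-≤ K (proj₂ (x≲y .eventually-≤ (half^ t) (0<half^ t)) s (ℕ.m≤n⊔m t N)) ⟩
    η s y + ω + half^ t + K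
      ≤⟨ ℚ.+-monoˡ-≤ K (ℚ.+-monoˡ-≤ (half^ t) (ℚ.+-monoˡ-≤ ω (∣-∣≤⇒≥ (η t y) (η s y) (stages y 0≤y y≤C)))) ⟩
    η t y + K + ω + half^ t + K
      ≡⟨ solve 4 (λ q h k ω → q :+ h :* k :+ ω :+ h :+ h :* k := q :+ ω :+ h :* (k :+ k :+ con 1ℚ)) refl (η t y) (half^ t) (C * C + 1ℚ) ω ⟩
    η t y + ω + half^ t * ((C * C + 1ℚ) + (C * C + 1ℚ) + 1ℚ) ∎
    where
    N = proj₁ (x≲y .eventually-≤ (half^ t) (0<half^ t))
    s = t ℕ.⊔ N
    K = half^ t * (C * C + 1ℚ)
    stages : ∀ z → 0ℚ ≤ z → z ≤ C → ∣ η t z - η s z ∣ ≤ K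
    stages z 0≤z z≤C = ℚ.≤-trans (refine* t s (ℕ.m≤m⊔n t N) 0≤z)
      (*ˡ (0≤half^ t) (ℚ.+-monoˡ-≤ 1ℚ (*-mono-≤ 0≤z (ℚ.≤-trans 0≤z z≤C) z≤C z≤C)))

  η-modulus : ∀ C ε → 0ℚ < C → 0ℚ < ε → ∃[ δ ] (0ℚ < δ) × (δ ≤ 1ℚ) ×
    (∀ t {x y} → 0ℚ ≤ x → x ≤ C → 0ℚ ≤ y → y ≤ C → ∣ x - y ∣ ≤ δ →
      η t x ≤ η t y + ε + half^ t * ((C * C + 1ℚ) + (C * C + 1ℚ) + 1ℚ))
  η-modulus C ε 0<C 0<ε = δ , 0<δ , ℚ.p⊓q≤p 1ℚ (δ₁ ⊓ δ₂) , λ t {x} {y} 0≤x x≤C 0≤y y≤C x-y → η-uniform 0≤x x≤C 0≤y y≤C (close x y 0≤x x≤C 0≤y y≤C x-y) t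
    where
    -- This makes 1/A ≤ ε/2 in `η-lower`; `δ₁` leaves the other ε/2 to A (y - x). `δ₂` serves
    -- `η-upper`, where the error is at most δ C.
    A = 1ℚ + recip (½ * ε)
    0<½ε = 0<* 0<½ 0<ε
    1≤A : 1ℚ ≤ A
    1≤A = ≤-by (recip (½ * ε)) (0≤recip 0<½ε) refl
    0<A = ℚ.<-≤-trans 0<1 1≤A
    δ₁ = (½ * ε) * recip A
    δ₂ = ε * recip C
    δ = 1ℚ ⊓ (δ₁ ⊓ δ₂)
    0<δ₁ = 0<* 0<½ε (0<recip 0<A)
    0<δ₂ = 0<* 0<ε (0<recip 0<C)
    0<⊓ : ∀ {p q} → 0ℚ < p → 0ℚ < q → 0ℚ < p ⊓ q
    0<⊓ {p} {q} 0<p 0<q with ℚ.⊓-sel p q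
    ... | inj₁ eq = subst (0ℚ <_) (sym eq) 0<p
    ... | inj₂ eq = subst (0ℚ <_) (sym eq) 0<q
    0<δ = 0<⊓ 0<1 (0<⊓ 0<δ₁ 0<δ₂)
    δ≤δ₁ : δ ≤ δ₁
    δ≤δ₁ = ℚ.≤-trans (ℚ.p⊓q≤q 1ℚ (δ₁ ⊓ δ₂)) (ℚ.p⊓q≤p δ₁ δ₂)
    δ≤δ₂ : δ ≤ δ₂
    δ≤δ₂ = ℚ.≤-trans (ℚ.p⊓q≤q 1ℚ (δ₁ ⊓ δ₂)) (ℚ.p⊓q≤q δ₁ δ₂)
    1/A≤ : recip A ≤ ½ * ε
    1/A≤ = begin
      recip A                                ≡⟨ ℚ.*-identityʳ (recip A) ⟨
      recip A * 1ℚ                           ≡⟨ cong (recip A *_) (recip-inverse 0<½ε) ⟨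
      recip A * (½ * ε * recip (½ * ε))      ≤⟨ ≤-by (recip A * (½ * ε)) (0≤* (0≤recip 0<A) (ℚ.<⇒≤ 0<½ε))
                                                  (solve 3 (λ a e r → a :* (e :* r) :+ a :* e := ((con 1ℚ :+ r) :* a) :* e) refl (recip A) (½ * ε) (recip (½ * ε))) ⟩
      A * recip A * (½ * ε)                  ≡⟨ cong (_* (½ * ε)) (recip-inverse 0<A) ⟩
      1ℚ * (½ * ε)                           ≡⟨ ℚ.*-identityˡ (½ * ε) ⟩
      ½ * ε                                  ∎
    scaled : ∀ {B} e → 0ℚ < B → B * (e * recip B) ≡ e
    scaled {B} e 0<B = trans (solve 3 (λ B e r → B :* (e :* r) := (B :* r) :* e) refl B e (recip B))
      (trans (cong (_* e) (recip-inverse 0<B)) (ℚ.*-identityˡ e))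
    close : ∀ x y → 0ℚ ≤ x → x ≤ C → 0ℚ ≤ y → y ≤ C → ∣ x - y ∣ ≤ δ → (λ t → η t x) ≲ (λ t → η t y + ε)
    close x y 0≤x x≤C 0≤y y≤C x-y with ℚ.≤-total x y
    ... | inj₁ x≤y = ≲-trans
      (η-lower 1≤A 0≤x x≤y)
      (≤⇒≲ λ t → ℚ.+-monoʳ-≤ (η t y) (begin
        recip A + A * (y - x)                     ≤⟨ ℚ.+-mono-≤ 1/A≤ (*ˡ (ℚ.<⇒≤ 0<A) (ℚ.≤-trans (≤∣∣ (y - x)) (ℚ.≤-trans (ℚ.≤-reflexive (∣-∣-sym y x)) (ℚ.≤-trans x-y δ≤δ₁)))) ⟩
        ½ * ε + A * (½ * ε * recip A)             ≡⟨ cong (_+_ (½ * ε)) (scaled (½ * ε) 0<A) ⟩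
        ½ * ε + ½ * ε                             ≡⟨ half+half ε ⟩
        ε                                         ∎))
    ... | inj₂ y≤x = ≲-trans
      (η-upper 0≤y y≤x)
      (≤⇒≲ λ t → ℚ.+-monoʳ-≤ (η t y) (begin
        (x - y) * x             ≤⟨ *-mono-≤ (≤⇒0≤- y≤x) (ℚ.<⇒≤ 0<C) (ℚ.≤-trans (≤∣∣ (x - y)) (ℚ.≤-trans x-y δ≤δ₂)) x≤C ⟩
        ε * recip C * C         ≡⟨ trans (ℚ.*-comm _ C) (scaled ε 0<C) ⟩
        ε                       ∎))

  -- Logarithms of natural numbers

  ι : ℕ → ℚ
  ι n = (+ n) ℚ./ 1

  ι-+ : ∀ a b → ι (a ℕ.+ b) ≡ ι a + ι b
  ι-+ zero    b = sym (ℚ.+-identityˡ (ι b))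
  ι-+ (suc a) b = begin-equality
    ι (suc (a ℕ.+ b))     ≡⟨ fromℕ-suc (a ℕ.+ b) ⟩
    ι (a ℕ.+ b) + 1ℚ      ≡⟨ cong (_+ 1ℚ) (ι-+ a b) ⟩
    ι a + ι b + 1ℚ        ≡⟨ solve 2 (λ a b → a :+ b :+ con 1ℚ := (a :+ con 1ℚ) :+ b) refl (ι a) (ι b) ⟩
    ι a + 1ℚ + ι b        ≡⟨ cong (_+ ι b) (fromℕ-suc a) ⟨
    ι (suc a) + ι b       ∎

  ι-* : ∀ a b → ι (a ℕ.* b) ≡ ι a * ι b
  ι-* zero    b = sym (ℚ.*-zeroˡ (ι b))
  ι-* (suc a) b = begin-equality
    ι (b ℕ.+ a ℕ.* b)      ≡⟨ ι-+ b (a ℕ.* b) ⟩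
    ι b + ι (a ℕ.* b)      ≡⟨ cong (_+_ (ι b)) (ι-* a b) ⟩
    ι b + ι a * ι b        ≡⟨ solve 2 (λ a b → b :+ a :* b := (a :+ con 1ℚ) :* b) refl (ι a) (ι b) ⟩
    (ι a + 1ℚ) * ι b       ≡⟨ cong (_* ι b) (fromℕ-suc a) ⟨
    ι (suc a) * ι b        ∎

  0≤ι : ∀ n → 0ℚ ≤ ι n
  0≤ι n = ℚ.nonNegative⁻¹ (ι n) {{ℚ.normalize-nonNeg n 1}}

  ι-mono : ∀ {a b} → a ℕ.≤ b → ι a ≤ ι b
  ι-mono {a} {b} a≤b = ≤-by (ι (b ℕ.∸ a)) (0≤ι (b ℕ.∸ a))
    (trans (sym (ι-+ a (b ℕ.∸ a))) (cong ι (ℕ.m+[n∸m]≡n a≤b)))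

  1≤ι : ∀ {n} → 1 ℕ.≤ n → 1ℚ ≤ ι n
  1≤ι = ι-mono

  0<ι : ∀ {n} → 1 ℕ.≤ n → 0ℚ < ι n
  0<ι 1≤n = ℚ.<-≤-trans 0<1 (1≤ι 1≤n)

  ι-/ : ∀ a n .{{_ : ℕ.NonZero n}} → ((+ a) ℚ./ n) * ι n ≡ ι a
  ι-/ a n@(suc n-1) = ℚ.toℚᵘ-injective (ℚᵘ.≃-trans (ℚ.toℚᵘ-homo-* ((+ a) ℚ./ n) (ι n))
    (ℚᵘ.≃-trans (ℚᵘ.*-cong {x = ℚ.toℚᵘ ((+ a) ℚ./ n)} {y = ℚᵘ.mkℚᵘ (+ a) n-1} {u = ℚ.toℚᵘ (ι n)} {v = ℚᵘ.mkℚᵘ (+ n) 0}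
        (ℚ.toℚᵘ-fromℚᵘ (ℚᵘ.mkℚᵘ (+ a) n-1)) (ℚ.toℚᵘ-fromℚᵘ (ℚᵘ.mkℚᵘ (+ n) 0)))
      (ℚᵘ.≃-trans (ℚᵘ.*≡* (trans (ℤ.*-identityʳ _) (cong (+ a ℤ.*_) (cong +_ (sym (ℕ.*-identityʳ n))))))
        (ℚᵘ.≃-sym (ℚ.toℚᵘ-fromℚᵘ (ℚᵘ.mkℚᵘ (+ a) 0))))))

  ι-sum : ∀ {m} (f : Fin m → ℕ) → ι (Σℕ.sum f) ≡ Σℚ.sum (ι ∘ f)
  ι-sum {zero}  f = refl
  ι-sum {suc m} f = trans (ι-+ (f Fin.zero) _) (cong (_+_ (ι (f Fin.zero))) (ι-sum (f ∘ Fin.suc)))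

  -- By definition the sequence of the real number `log (fromℕ a)` for positive a. The value at a =
  -- 0 is meaningless and only occurs with the factor 0.
  Log : ℕ → ℕ → ℚ
  Log a t = ρ t (ι a)

  Log-mono : ∀ {a b} → 1 ℕ.≤ a → a ℕ.≤ b → ∀ t → Log a t ≤ Log b t
  Log-mono 1≤a a≤b t = ρ-mono t (0<ι 1≤a) (ι-mono a≤b)

  Log-* : ∀ {a b} → 1 ℕ.≤ a → 1 ℕ.≤ b → Log (a ℕ.* b) ≅ λ t → Log a t + Log b t
  Log-* {a} {b} 1≤a 1≤b = subst (λ q → (λ t → ρ t q) ≅ (λ t → Log a t + Log b t)) (sym (ι-* a b))
    (log-product-≥1 (0<ι 1≤a) (1≤ι 1≤b))

  1≤^ : ∀ {a} → 1 ℕ.≤ a → ∀ b → 1 ℕ.≤ a ℕ.^ b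
  1≤^ {suc a} _ b = ℕ.m^n>0 (suc a) b

  Log-^ : ∀ {a} b → 1 ℕ.≤ a → Log (a ℕ.^ b) ≅ λ t → ι b * Log a t
  Log-^ {a} zero    1≤a = ≅-reflexive λ t → trans (ρ-1 t) (sym (ℚ.*-zeroˡ (Log a t)))
  Log-^ {a} (suc b) 1≤a = ≅-trans
    (Log-* 1≤a (1≤^ 1≤a b))
    (≅-trans
      (+-cong-≅ {Log a} {Log a} {Log (a ℕ.^ b)} {λ t → ι b * Log a t} (≅-reflexive (λ _ → refl)) (Log-^ b 1≤a))
      (≅-reflexive λ t → trans (solve 2 (λ l b → l :+ b :* l := (b :+ con 1ℚ) :* l) refl (Log a t) (ι b))
        (cong (_* Log a t) (sym (fromℕ-suc b)))))

  1≤u^u : ∀ u → 1 ℕ.≤ u ℕ.^ u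
  1≤u^u zero    = ℕ.≤-refl
  1≤u^u (suc u) = ℕ.m^n>0 (suc u) (suc u)

  -- At u = 0 the value 0⁰ = 1 in ℕ corresponds to 0 log 0 = 0.
  Log-u^u : ∀ u → Log (u ℕ.^ u) ≅ λ t → ι u * Log u t
  Log-u^u zero    = ≅-reflexive λ t → trans (ρ-1 t) (sym (ℚ.*-zeroˡ (Log 0 t)))
  Log-u^u (suc u) = Log-^ (suc u) (ℕ.s≤s ℕ.z≤n)

  1≤∏ : ∀ {m} (f : Fin m → ℕ) → (∀ i → 1 ℕ.≤ f i) → 1 ℕ.≤ Πℕ.sum f
  1≤∏ {zero}  f 1≤f = ℕ.≤-refl
  1≤∏ {suc m} f 1≤f = ℕ.*-mono-≤ (1≤f Fin.zero) (1≤∏ (f ∘ Fin.suc) (1≤f ∘ Fin.suc))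

  sum-cong-≅ : ∀ {m} (u v : Fin m → ℕ → ℚ) → (∀ i → u i ≅ v i) → (λ t → Σℚ.sum λ i → u i t) ≅ (λ t → Σℚ.sum λ i → v i t)
  sum-cong-≅ {zero}  u v eq = ≅-reflexive λ _ → refl
  sum-cong-≅ {suc m} u v eq = +-cong-≅
    (eq Fin.zero) (sum-cong-≅ (u ∘ Fin.suc) (v ∘ Fin.suc) (eq ∘ Fin.suc))

  sum-mono-≲ : ∀ {m} (u v : Fin m → ℕ → ℚ) → (∀ i → u i ≲ v i) → (λ t → Σℚ.sum λ i → u i t) ≲ (λ t → Σℚ.sum λ i → v i t)
  sum-mono-≲ {zero}  u v le = ≲-refl
  sum-mono-≲ {suc m} u v le = +-mono-≲
    (le Fin.zero) (sum-mono-≲ (u ∘ Fin.suc) (v ∘ Fin.suc) (le ∘ Fin.suc))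

  Log-∏ : ∀ {m} (f : Fin m → ℕ) → (∀ i → 1 ℕ.≤ f i) → Log (Πℕ.sum f) ≅ λ t → Σℚ.sum λ i → Log (f i) t
  Log-∏ {zero}  f 1≤f = ≅-reflexive ρ-1
  Log-∏ {suc m} f 1≤f = ≅-trans
    (Log-* (1≤f Fin.zero) (1≤∏ (f ∘ Fin.suc) (1≤f ∘ Fin.suc)))
    (+-cong-≅ {Log (f Fin.zero)} {Log (f Fin.zero)} {Log (Πℕ.sum (f ∘ Fin.suc))} {λ t → Σℚ.sum λ i → Log (f (Fin.suc i)) t}
      (≅-reflexive (λ _ → refl)) (Log-∏ (f ∘ Fin.suc) (1≤f ∘ Fin.suc)))

  -- From log x = log (x / A) + log A and log y ≤ y − 1.
  Log-growth : ∀ {x A} → 1 ℕ.≤ x → 1 ℕ.≤ A → Log x ≲ λ _ → ι x * recip (ι A) + ι A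
  Log-growth {x} {A} 1≤x 1≤A = ≲-trans
    (≲-trans
      (≤⇒≲ λ t → ℚ.≤-reflexive (solve 2 (λ x y → x := y :+ (x :- y)) refl (Log x t) (Log A t)))
      (+-mono-≲ (≲-refl {Log A})
        (proj₂ (log-quotient (0<ι 1≤A) (0<ι 1≤x)))))
    (≤⇒≲ λ t → begin
      Log A t + ρ t (ι x * recip (ι A))
        ≤⟨ ℚ.+-mono-≤ (ρ-upper t (0<ι 1≤A)) (ρ-upper t (0<* (0<ι 1≤x) (0<recip (0<ι 1≤A)))) ⟩
      (ι A - 1ℚ) + (ι x * recip (ι A) - 1ℚ)
        ≤⟨ ≤-by (1ℚ + 1ℚ) (0≤+ 0≤1 0≤1) (solve 2 (λ A q → (A :- con 1ℚ) :+ (q :- con 1ℚ) :+ (con 1ℚ :+ con 1ℚ) := q :+ A) refl (ι A) (ι x * recip (ι A))) ⟩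
      ι x * recip (ι A) + ι A ∎)

  -- Entropy of integers and of their limits

  -- An entry of `xlogx`: `seq (xlogx z) t` is `η⁺ t (seq z t)` by definition.
  η⁺ : ℕ → ℚ → ℚ
  η⁺ t x = (x ⊔ 0ℚ) * ρ t (x ⊔ 0ℚ)

  ∣⊔0-∣≤ : ∀ x {y} → 0ℚ ≤ y → ∣ (x ⊔ 0ℚ) - y ∣ ≤ ∣ x - y ∣
  ∣⊔0-∣≤ x {y} 0≤y = by-cases (ℚ.≤-total x 0ℚ)
    where
    by-cases : x ≤ 0ℚ ⊎ 0ℚ ≤ x → ∣ (x ⊔ 0ℚ) - y ∣ ≤ ∣ x - y ∣
    by-cases (inj₂ 0≤x) = ℚ.≤-reflexive (cong (λ z → ∣ z - y ∣) (ℚ.p≥q⇒p⊔q≡p 0≤x))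
    by-cases (inj₁ x≤0) = begin
      ∣ (x ⊔ 0ℚ) - y ∣   ≡⟨ cong (λ z → ∣ z - y ∣) (ℚ.p≤q⇒p⊔q≡q x≤0) ⟩
      ∣ 0ℚ - y ∣         ≡⟨ ∣-∣-sym 0ℚ y ⟩
      ∣ y - 0ℚ ∣         ≡⟨ cong ∣_∣ (ℚ.+-identityʳ y) ⟩
      ∣ y ∣              ≡⟨ ℚ.0≤p⇒∣p∣≡p 0≤y ⟩
      y                  ≤⟨ ≤-by (- x) (ℚ.neg-antimono-≤ x≤0) refl ⟩
      y - x              ≤⟨ ≤∣∣ (y - x) ⟩
      ∣ y - x ∣          ≡⟨ ∣-∣-sym y x ⟩
      ∣ x - y ∣          ∎

  -- This is the quotient law for log (u / n). It brings integers of size O(n) into a bounded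
  -- interval, where the modulus of continuity applies.
  scaled-η : ∀ {n} u → 1 ℕ.≤ n → (λ t → ι n * η t (ι u * recip (ι n))) ≅ (λ t → ι u * (Log u t - Log n t))
  scaled-η {n} u 1≤n = ≅-trans
    (≅-reflexive λ t → trans (solve 4 (λ n u r p → n :* ((u :* r) :* p) := (n :* r) :* (u :* p)) refl (ι n) (ι u) (recip (ι n)) (ρ t (ι u * recip (ι n))))
      (trans (cong (_* (ι u * ρ t (ι u * recip (ι n)))) (recip-inverse (0<ι 1≤n))) (ℚ.*-identityˡ _)))
    (positive u)
    where
    positive : ∀ u → (λ t → ι u * ρ t (ι u * recip (ι n))) ≅ (λ t → ι u * (Log u t - Log n t))
    positive zero    = ≅-reflexive λ t → trans (ℚ.*-zeroˡ (ρ t (ι 0 * recip (ι n)))) (sym (ℚ.*-zeroˡ (Log 0 t - Log n t)))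
    positive (suc u) = *-cong-≅
      (0≤ι (suc u)) (log-quotient (0<ι 1≤n) (0<ι {suc u} (ℕ.s≤s ℕ.z≤n)))

  infix 4 _≈[_]_

  _≈[_]_ : (ℕ → ℚ) → ℚ → (ℕ → ℚ) → Set
  u ≈[ ε ] v = u ≲ (λ t → v t + ε) × v ≲ (λ t → u t + ε)

  η-bound : ℚ → ℚ
  η-bound C = (C * C + 1ℚ) + (C * C + 1ℚ) + 1ℚ

  IsModulus : ℚ → ℚ → ℚ → Set
  IsModulus C ε δ = ∀ t {x y} → 0ℚ ≤ x → x ≤ C → 0ℚ ≤ y → y ≤ C → ∣ x - y ∣ ≤ δ →
    η t x ≤ η t y + ε + half^ t * η-bound C

  module _ {C ε δ : ℚ} (0<C : 0ℚ < C) (δ≤1 : δ ≤ 1ℚ) (modulus : IsModulus (C + 1ℚ) ε δ)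
           {n u : ℕ} {x : ℕ → ℚ} (1≤n : 1 ℕ.≤ n) where
    private
      -- The fraction u / n may exceed the bound C of x by δ, which is at most 1.
      C′ = C + 1ℚ
      K = η-bound C′
      y r : ℚ
      r = recip (ι n)
      y = ι u * r
      A B E : ℕ → ℚ
      A t = ι n * η t y
      B t = ι n * η⁺ t (x t)
      E t = ι u * (Log u t - Log n t)

      0<n : 0ℚ < ι n
      0<n = 0<ι 1≤n

      0≤y : 0ℚ ≤ y
      0≤y = 0≤* (0≤ι u) (0≤recip 0<n)

      0≤K : 0ℚ ≤ K
      0≤K = 0≤+ (0≤+ (0≤+ (square≥0 C′) 0≤1) (0≤+ (square≥0 C′) 0≤1)) 0≤1

      y-x : ∀ t → y - x t ≡ (ι u - ι n * x t) * r
      y-x t = trans (cong (_-_ y) (sym (recip-cancel (x t) 0<n)))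
        (solve 4 (λ u r n x → u :* r :- (n :* x) :* r := (u :- n :* x) :* r) refl (ι u) r (ι n) (x t))

      ∣y-x∣≤δ : ∀ t → ∣ ι u - ι n * x t ∣ ≤ δ * ι n → ∣ y - x t ∣ ≤ δ
      ∣y-x∣≤δ t h = begin
        ∣ y - x t ∣                        ≡⟨ cong ∣_∣ (y-x t) ⟩
        ∣ (ι u - ι n * x t) * r ∣          ≡⟨ ℚ.∣p*q∣≡∣p∣*∣q∣ (ι u - ι n * x t) r ⟩
        ∣ ι u - ι n * x t ∣ * ∣ r ∣        ≡⟨ cong (∣ ι u - ι n * x t ∣ *_) (ℚ.0≤p⇒∣p∣≡p (0≤recip 0<n)) ⟩
        ∣ ι u - ι n * x t ∣ * r            ≤⟨ *ʳ (0≤recip 0<n) h ⟩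
        δ * ι n * r                        ≡⟨ cong (_* r) (ℚ.*-comm δ (ι n)) ⟩
        ι n * δ * r                        ≡⟨ recip-cancel δ 0<n ⟩
        δ                                  ∎

      Near : ℕ → Set
      Near t = (x t ⊔ 0ℚ ≤ C′) × (y ≤ C′) × (∣ (x t ⊔ 0ℚ) - y ∣ ≤ δ)

      C≤C′ : C ≤ C′
      C≤C′ = ≤-by 1ℚ 0≤1 refl

      near : ∀ t → ∣ x t ∣ ≤ C × ∣ ι u - ι n * x t ∣ ≤ δ * ι n → Near t
      near t (∣x∣≤C , h) = ℚ.⊔-lub (ℚ.≤-trans x≤C C≤C′) (ℚ.≤-trans (ℚ.<⇒≤ 0<C) C≤C′)
        , ℚ.≤-trans (∣-∣≤⇒≤ y (x t) (∣y-x∣≤δ t h)) (ℚ.+-mono-≤ x≤C δ≤1)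
        , ℚ.≤-trans (∣⊔0-∣≤ (x t) 0≤y) (subst (_≤ δ) (∣-∣-sym y (x t)) (∣y-x∣≤δ t h))
        where x≤C = ℚ.≤-trans (≤∣∣ (x t)) ∣x∣≤C

      distrib : ∀ p h → ι n * (p + ε + h * K) ≡ ι n * p + ε * ι n + h * (ι n * K)
      distrib p h = solve 5 (λ n p ε h K → n :* (p :+ ε :+ h :* K) := n :* p :+ ε :* n :+ h :* (n :* K)) refl (ι n) p ε h K

      A≤B : ∀ t → Near t → A t ≤ B t + ε * ι n + half^ t * (ι n * K)
      A≤B t (x≤ , y≤ , d) = ℚ.≤-trans
        (*ˡ (0≤ι n) (modulus t 0≤y y≤ (ℚ.p≤q⊔p (x t) 0ℚ) x≤ (subst (_≤ δ) (∣-∣-sym (x t ⊔ 0ℚ) y) d)))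
        (ℚ.≤-reflexive (distrib (η⁺ t (x t)) (half^ t)))

      B≤A : ∀ t → Near t → B t ≤ A t + ε * ι n + half^ t * (ι n * K)
      B≤A t (x≤ , y≤ , d) = ℚ.≤-trans
        (*ˡ (0≤ι n) (modulus t (ℚ.p≤q⊔p (x t) 0ℚ) x≤ 0≤y y≤ d))
        (ℚ.≤-reflexive (distrib (η t y) (half^ t)))

    modulus⇒approx : Eventually (λ t → ∣ x t ∣ ≤ C) → Eventually (λ t → ∣ ι u - ι n * x t ∣ ≤ δ * ι n) →
      (λ t → ι u * (Log u t - Log n t)) ≈[ ε * ι n ] (λ t → ι n * η⁺ t (x t))
    modulus⇒approx x≤C close =
      ≲-trans (proj₂ (scaled-η u 1≤n))
        (eventually-half^⇒≲ (ι n * K) (0≤* (0≤ι n) 0≤K) (eventually A≤B ev)) ,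
      ≲-trans
        (eventually-half^⇒≲ (ι n * K) (0≤* (0≤ι n) 0≤K) (eventually B≤A ev))
        (+-mono-≲ (proj₁ (scaled-η u 1≤n)) (≲-refl))
      where
      ev : Eventually Near
      ev = eventually near (both x≤C close)

  -- δ depends on C and ε alone and so serves all n. The argument x is a sequence, because the limit
  -- that u / n approximates is itself known only by stages.
  η-approx : ∀ C ε → 0ℚ < C → 0ℚ < ε → ∃[ δ ] (0ℚ < δ) × (∀ n u (x : ℕ → ℚ) → 1 ℕ.≤ n →
    Eventually (λ t → ∣ x t ∣ ≤ C) → Eventually (λ t → ∣ ι u - ι n * x t ∣ ≤ δ * ι n) →
    (λ t → ι u * (Log u t - Log n t)) ≈[ ε * ι n ] (λ t → ι n * η⁺ t (x t)))
  η-approx C ε 0<C 0<ε = from-modulus (η-modulus (C + 1ℚ) ε (0<+ 0<C 0≤1) 0<ε)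
    where
    from-modulus : (∃[ δ ] (0ℚ < δ) × (δ ≤ 1ℚ) × IsModulus (C + 1ℚ) ε δ) → ∃[ δ ] (0ℚ < δ) × (∀ n u (x : ℕ → ℚ) → 1 ℕ.≤ n →
      Eventually (λ t → ∣ x t ∣ ≤ C) → Eventually (λ t → ∣ ι u - ι n * x t ∣ ≤ δ * ι n) →
      (λ t → ι u * (Log u t - Log n t)) ≈[ ε * ι n ] (λ t → ι n * η⁺ t (x t)))
    from-modulus (δ , 0<δ , δ≤1 , modulus) = δ , 0<δ , λ n u x 1≤n →
      modulus⇒approx 0<C δ≤1 (λ t → modulus t) {n} {u} {x} 1≤n

  eventually-all : ∀ {m} {P : Fin m → ℕ → Set} → (∀ i → Eventually (P i)) → Eventually λ t → ∀ i → P i t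
  eventually-all {zero}  p = 0 , λ _ _ ()
  eventually-all {suc m} {P} p = eventually (λ { t (h , hs) Fin.zero → h ; t (h , hs) (Fin.suc i) → hs i })
    (both (p Fin.zero) (eventually-all (p ∘ Fin.suc)))

  ∣sum∣≤ : ∀ {m} (f : Fin m → ℚ) c → (∀ i → ∣ f i ∣ ≤ c) → ∣ Σℚ.sum f ∣ ≤ ι m * c
  ∣sum∣≤ {zero}  f c f≤c = ℚ.≤-reflexive (sym (ℚ.*-zeroˡ c))
  ∣sum∣≤ {suc m} f c f≤c = begin
    ∣ f Fin.zero + S ∣           ≤⟨ ℚ.∣p+q∣≤∣p∣+∣q∣ (f Fin.zero) S ⟩
    ∣ f Fin.zero ∣ + ∣ S ∣       ≤⟨ ℚ.+-mono-≤ (f≤c Fin.zero) (∣sum∣≤ (f ∘ Fin.suc) c (f≤c ∘ Fin.suc)) ⟩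
    c + ι m * c                  ≡⟨ solve 2 (λ c m → c :+ m :* c := (m :+ con 1ℚ) :* c) refl c (ι m) ⟩
    (ι m + 1ℚ) * c               ≡⟨ cong (_* c) (fromℕ-suc m) ⟨
    ι (suc m) * c                ∎
    where S = Σℚ.sum (f ∘ Fin.suc)

  sum-difference : ∀ {m} (f g : Fin m → ℚ) → Σℚ.sum f - Σℚ.sum g ≡ Σℚ.sum (λ i → f i - g i)
  sum-difference {zero}  f g = refl
  sum-difference {suc m} f g = trans
    (solve 4 (λ a b c d → (a :+ b) :- (c :+ d) := (a :- c) :+ (b :- d)) refl (f Fin.zero) (Σℚ.sum (f ∘ Fin.suc)) (g Fin.zero) (Σℚ.sum (g ∘ Fin.suc)))
    (cong (_+_ (f Fin.zero - g Fin.zero)) (sum-difference (f ∘ Fin.suc) (g ∘ Fin.suc)))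

  *-distribˡ-sum : ∀ {m} c (f : Fin m → ℚ) → c * Σℚ.sum f ≡ Σℚ.sum (λ i → c * f i)
  *-distribˡ-sum {zero}  c f = ℚ.*-zeroʳ c
  *-distribˡ-sum {suc m} c f = trans (ℚ.*-distribˡ-+ c (f Fin.zero) _) (cong (_+_ (c * f Fin.zero)) (*-distribˡ-sum c (f ∘ Fin.suc)))

  sum-const : ∀ {m} c → Σℚ.sum {m} (λ _ → c) ≡ ι m * c
  sum-const {zero}  c = sym (ℚ.*-zeroˡ c)
  sum-const {suc m} c = trans (cong (_+_ c) (sum-const {m} c))
    (trans (solve 2 (λ c m → c :+ m :* c := (m :+ con 1ℚ) :* c) refl c (ι m)) (cong (_* c) (sym (fromℕ-suc m))))

  module _ {m : ℕ} where

    -- The logarithm of U^U / ∏ uᵢ^uᵢ with U = Σ uᵢ, that is, U times the Shannon entropy of the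
    -- proportions uᵢ / U.
    entropy : (Fin m → ℕ) → ℕ → ℚ
    entropy u t = ι (Σℕ.sum u) * Log (Σℕ.sum u) t - Σℚ.sum (λ i → ι (u i) * Log (u i) t)

    entropy⁺ : (Fin m → ℕ → ℚ) → ℕ → ℚ
    entropy⁺ x t = η⁺ t (Σℚ.sum λ i → x i t) - Σℚ.sum (λ i → η⁺ t (x i t))

    private
      recentre : ∀ (u : Fin m → ℕ) t c → entropy u t ≡
        ι (Σℕ.sum u) * (Log (Σℕ.sum u) t - c) - Σℚ.sum (λ i → ι (u i) * (Log (u i) t - c))
      recentre u t c = begin-equality
        U * L - S
          ≡⟨ solve 4 (λ U L S c → U :* L :- S := U :* (L :- c) :- (S :- c :* U)) refl U L S c ⟩
        U * (L - c) - (S - c * U)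
          ≡⟨ cong (λ s → U * (L - c) - (S - s)) (trans (cong (c *_) (ι-sum u)) (*-distribˡ-sum c (ι ∘ u))) ⟩
        U * (L - c) - (S - Σℚ.sum (λ i → c * ι (u i)))
          ≡⟨ cong (_-_ (U * (L - c))) (sum-difference (λ i → ι (u i) * Log (u i) t) (λ i → c * ι (u i))) ⟩
        U * (L - c) - Σℚ.sum (λ i → ι (u i) * Log (u i) t - c * ι (u i))
          ≡⟨ cong (_-_ (U * (L - c))) (Σℚ.sum-cong-≗ λ i →
               solve 3 (λ u l c → u :* l :- c :* u := u :* (l :- c)) refl (ι (u i)) (Log (u i) t) c) ⟩
        U * (L - c) - Σℚ.sum (λ i → ι (u i) * (Log (u i) t - c)) ∎
        where U = ι (Σℕ.sum u)
              L = Log (Σℕ.sum u) t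
              S = Σℚ.sum (λ i → ι (u i) * Log (u i) t)

      total-close : ∀ {δ} n (u : Fin m → ℕ) (x : Fin m → ℚ) → (∀ i → ∣ ι (u i) - ι n * x i ∣ ≤ δ * recip (ι (suc m)) * ι n) → 0ℚ ≤ δ →
        ∣ ι (Σℕ.sum u) - ι n * Σℚ.sum x ∣ ≤ δ * ι n
      total-close {δ} n u x close 0≤δ = begin
        ∣ ι (Σℕ.sum u) - ι n * Σℚ.sum x ∣
          ≡⟨ cong ∣_∣ (trans (cong₂ _-_ (ι-sum u) (*-distribˡ-sum (ι n) x)) (sum-difference (ι ∘ u) (λ i → ι n * x i))) ⟩
        ∣ Σℚ.sum (λ i → ι (u i) - ι n * x i) ∣
          ≤⟨ ∣sum∣≤ (λ i → ι (u i) - ι n * x i) (δ * r * ι n) close ⟩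
        ι m * (δ * r * ι n)
          ≤⟨ ≤-by (δ * r * ι n) (0≤* (0≤* 0≤δ (0≤recip 0<sm)) (0≤ι n))
               (solve 4 (λ m δ r n → m :* (δ :* r :* n) :+ δ :* r :* n := ((m :+ con 1ℚ) :* r) :* (δ :* n)) refl (ι m) δ r (ι n)) ⟩
        (ι m + 1ℚ) * r * (δ * ι n)
          ≡⟨ cong (λ s → s * r * (δ * ι n)) (fromℕ-suc m) ⟨
        ι (suc m) * r * (δ * ι n)
          ≡⟨ cong (_* (δ * ι n)) (recip-inverse 0<sm) ⟩
        1ℚ * (δ * ι n)
          ≡⟨ ℚ.*-identityˡ (δ * ι n) ⟩
        δ * ι n ∎
        where r = recip (ι (suc m))
              0<sm : 0ℚ < ι (suc m)
              0<sm = 0<ι {suc m} (ℕ.s≤s ℕ.z≤n)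

    EntropyApprox : ℚ → ℚ → ℚ → Set
    EntropyApprox C ε δ = ∀ n (u : Fin m → ℕ) (x : Fin m → ℕ → ℚ) → 1 ℕ.≤ n →
      (∀ i → Eventually λ t → ∣ x i t ∣ ≤ C) → Eventually (λ t → ∣ Σℚ.sum (λ i → x i t) ∣ ≤ C) →
      (∀ i → Eventually λ t → ∣ ι (u i) - ι n * x i t ∣ ≤ δ * ι n) →
      entropy u ≈[ ε * ι n ] (λ t → ι n * entropy⁺ x t)

    entropy-approx : ∀ C ε → 0ℚ < C → 0ℚ < ε → ∃[ δ ] (0ℚ < δ) × EntropyApprox C ε δ
    entropy-approx C ε 0<C 0<ε = from-terms (η-approx C ε₁ 0<C 0<ε₁)
      where
      0<sm : 0ℚ < ι (suc m)
      0<sm = 0<ι {suc m} (ℕ.s≤s ℕ.z≤n)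
      -- The error ε is shared equally by the m parts and the total, m + 1 terms in all.
      r = recip (ι (suc m))
      ε₁ = ε * r
      0<r = 0<recip 0<sm
      0<ε₁ = 0<* 0<ε 0<r

      Terms : ℚ → Set
      Terms δ = ∀ n u (x : ℕ → ℚ) → 1 ℕ.≤ n →
        Eventually (λ t → ∣ x t ∣ ≤ C) → Eventually (λ t → ∣ ι u - ι n * x t ∣ ≤ δ * ι n) →
        (λ t → ι u * (Log u t - Log n t)) ≈[ ε₁ * ι n ] (λ t → ι n * η⁺ t (x t))

      errors : ∀ n → ε₁ * ι n + ι m * (ε₁ * ι n) ≡ ε * ι n
      errors n = begin-equality
        ε * r * ι n + ι m * (ε * r * ι n)
          ≡⟨ solve 4 (λ ε r n m → ε :* r :* n :+ m :* (ε :* r :* n) := ((m :+ con 1ℚ) :* r) :* (ε :* n)) refl ε r (ι n) (ι m) ⟩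
        (ι m + 1ℚ) * r * (ε * ι n)
          ≡⟨ cong (λ s → s * r * (ε * ι n)) (fromℕ-suc m) ⟨
        ι (suc m) * r * (ε * ι n)
          ≡⟨ cong (_* (ε * ι n)) (recip-inverse 0<sm) ⟩
        1ℚ * (ε * ι n)
          ≡⟨ ℚ.*-identityˡ (ε * ι n) ⟩
        ε * ι n ∎

      from-terms : (∃[ δ ] (0ℚ < δ) × Terms δ) → ∃[ δ ] (0ℚ < δ) × EntropyApprox C ε δ
      from-terms (δ , 0<δ , terms) = δ * r , 0<* 0<δ 0<r , approx
        where
        approx : EntropyApprox C ε (δ * r)
        approx n u x 1≤n x≤C X≤C close =
          ≲-trans
            (≤⇒≲ λ t → ℚ.≤-reflexive (recentre u t (Log n t)))
            (≲-trans
              (+-mono-≲ (proj₁ total)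
                (flip F E (proj₂ parts)))
              (≤⇒≲ λ t → ℚ.≤-reflexive (gather (F₀ t) (F t) (η⁺ t (X t)) (λ i → η⁺ t (x i t)) refl refl)))
          , ≲-trans
            (≤⇒≲ λ t → ℚ.≤-reflexive (trans (solve 3 (λ n p q → n :* (p :- q) := n :* p :- n :* q) refl (ι n) (η⁺ t (X t)) (Σℚ.sum λ i → η⁺ t (x i t)))
               (cong (_-_ (F₀ t)) (*-distribˡ-sum (ι n) λ i → η⁺ t (x i t)))))
            (≲-trans
              (+-mono-≲ (proj₂ total)
                (flip E F (proj₁ parts)))
              (≤⇒≲ λ t → ℚ.≤-reflexive (trans
                (solve 4 (λ a b e f → (a :+ e) :+ (:- b :+ f) := (a :- b) :+ (e :+ f)) refl (E₀ t) (E t) e₁ (ι m * e₁))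
                (cong₂ _+_ (sym (recentre u t (Log n t))) (errors n)))))
          where
          e₁ = ε₁ * ι n
          U = Σℕ.sum u
          X = λ t → Σℚ.sum (λ i → x i t)
          E₀ E F₀ F : ℕ → ℚ
          E₀ t = ι U * (Log U t - Log n t)
          E t = Σℚ.sum (λ i → ι (u i) * (Log (u i) t - Log n t))
          F₀ t = ι n * η⁺ t (X t)
          F t = Σℚ.sum (λ i → ι n * η⁺ t (x i t))

          weaken : ∀ i → Eventually λ t → ∣ ι (u i) - ι n * x i t ∣ ≤ δ * ι n
          weaken i = eventually (λ t h → ℚ.≤-trans h (*ʳ (0≤ι n) δr≤δ)) (close i)
            where
            δr≤δ : δ * r ≤ δ
            δr≤δ = ℚ.≤-trans (*ˡ (ℚ.<⇒≤ 0<δ) (recip-antitone 0<1 (1≤ι {suc m} (ℕ.s≤s ℕ.z≤n)))) (ℚ.≤-reflexive (ℚ.*-identityʳ δ))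

          total : E₀ ≈[ e₁ ] F₀
          total = terms n U X 1≤n X≤C (eventually (λ t h → total-close n u (λ i → x i t) h (ℚ.<⇒≤ 0<δ)) (eventually-all close))

          shift : ∀ (f g : Fin m → ℕ → ℚ) → (∀ i → f i ≲ λ t → g i t + e₁) →
            (λ t → Σℚ.sum λ i → f i t) ≲ (λ t → Σℚ.sum (λ i → g i t) + ι m * e₁)
          shift f g le = ≲-trans
            (sum-mono-≲ f (λ i t → g i t + e₁) le)
            (≤⇒≲ λ t → ℚ.≤-reflexive (trans (Σℚ.∑-distrib-+ (λ i → g i t) (λ _ → e₁)) (cong (_+_ (Σℚ.sum λ i → g i t)) (sum-const {m} e₁))))

          parts : E ≈[ ι m * e₁ ] F
          parts = shift (λ i t → ι (u i) * (Log (u i) t - Log n t)) (λ i t → ι n * η⁺ t (x i t)) (λ i → proj₁ (terms n (u i) (x i) 1≤n (x≤C i) (weaken i)))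
                , shift (λ i t → ι n * η⁺ t (x i t)) (λ i t → ι (u i) * (Log (u i) t - Log n t)) (λ i → proj₂ (terms n (u i) (x i) 1≤n (x≤C i) (weaken i)))

          flip : ∀ (v w : ℕ → ℚ) → v ≲ (λ t → w t + ι m * e₁) → (λ t → - w t) ≲ (λ t → - v t + ι m * e₁)
          flip v w le = ≲-trans
            (≤⇒≲ λ t → ℚ.≤-reflexive (solve 2 (λ w e → :- w := :- (w :+ e) :+ e) refl (w t) (ι m * e₁)))
            (+-mono-≲
              (neg-antimono-≲ le) (≲-refl))

          gather : ∀ a b p (q : Fin m → ℚ) → a ≡ ι n * p → b ≡ Σℚ.sum (λ i → ι n * q i) →
            (a + e₁) + (- b + ι m * e₁) ≡ ι n * (p - Σℚ.sum q) + ε * ι n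
          gather a b p q refl refl = begin-equality
            (ι n * p + e₁) + (- Σℚ.sum (λ i → ι n * q i) + ι m * e₁)
              ≡⟨ cong (λ s → (ι n * p + e₁) + (- s + ι m * e₁)) (*-distribˡ-sum (ι n) q) ⟨
            (ι n * p + e₁) + (- (ι n * Σℚ.sum q) + ι m * e₁)
              ≡⟨ solve 5 (λ n p e s f → (n :* p :+ e) :+ (:- (n :* s) :+ f) := n :* (p :- s) :+ (e :+ f)) refl (ι n) p e₁ (Σℚ.sum q) (ι m * e₁) ⟩
            ι n * (p - Σℚ.sum q) + (e₁ + ι m * e₁)
              ≡⟨ cong (_+_ (ι n * (p - Σℚ.sum q))) (errors n) ⟩
            ι n * (p - Σℚ.sum q) + ε * ι n ∎

  module _ {m : ℕ} (u : Fin m → ℕ) where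
    private
      U = Σℕ.sum u

      powers : ℕ
      powers = Πℕ.sum (λ i → u i ℕ.^ u i)

      uLogu : ℕ → ℚ
      uLogu t = Σℚ.sum (λ i → ι (u i) * Log (u i) t)

    1≤powers : 1 ℕ.≤ powers
    1≤powers = 1≤∏ (λ i → u i ℕ.^ u i) (λ i → 1≤u^u (u i))

    Log-powers : Log powers ≅ uLogu
    Log-powers = ≅-trans
      (Log-∏ (λ i → u i ℕ.^ u i) (λ i → 1≤u^u (u i)))
      (sum-cong-≅ (λ i → Log (u i ℕ.^ u i)) (λ i t → ι (u i) * Log (u i) t) (λ i → Log-u^u (u i)))

    entropy-upper : ∀ {e} → 1 ℕ.≤ e → e ℕ.* powers ℕ.≤ U ℕ.^ U → Log e ≲ entropy u
    entropy-upper {e} 1≤e below = ≲-trans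
      (≲-trans
        (≤⇒≲ λ t → ℚ.≤-reflexive (solve 2 (λ x y → x := (x :+ y) :+ :- y) refl (Log e t) (Log powers t)))
        (+-mono-≲
          (proj₂ (Log-* 1≤e 1≤powers)) (neg-antimono-≲ (proj₂ Log-powers))))
      (+-mono-≲
        (≲-trans
          (≤⇒≲ (Log-mono (ℕ.*-mono-≤ 1≤e 1≤powers) below)) (proj₁ (Log-u^u U)))
        (≲-refl))

    module _ {e B k : ℕ} (1≤e : 1 ℕ.≤ e) (1≤m : 1 ℕ.≤ m) where
      private
        X = suc U ℕ.^ m ℕ.* powers
        1≤sU : 1 ℕ.≤ suc U
        1≤sU = ℕ.s≤s ℕ.z≤n
        1≤X : 1 ℕ.≤ X
        1≤X = ℕ.*-mono-≤ (1≤^ 1≤sU m) 1≤powers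
        1≤m^U = 1≤^ 1≤m U

        LogX : Log X ≅ λ t → ι m * Log (suc U) t + uLogu t
        LogX = ≅-trans
          (Log-* (1≤^ 1≤sU m) 1≤powers)
          (+-cong-≅ (Log-^ m 1≤sU) Log-powers)

        Log-X^B : Log (X ℕ.^ B) ≅ λ t → ι B * (ι m * Log (suc U) t + uLogu t)
        Log-X^B = ≅-trans
          (Log-^ B 1≤X) (*-cong-≅ (0≤ι B) LogX)

        Log-tail : Log ((m ℕ.^ U) ℕ.^ k) ≅ λ t → ι k * (ι U * Log m t)
        Log-tail = ≅-trans
          (Log-^ k 1≤m^U) (*-cong-≅ (0≤ι k) (Log-^ U 1≤m))

        Y = e ℕ.* (m ℕ.^ U) ℕ.^ k
        1≤Y : 1 ℕ.≤ Y
        1≤Y = ℕ.*-mono-≤ 1≤e (1≤^ 1≤m^U k)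

        Log-Y : Log Y ≅ λ t → Log e t + ι k * (ι U * Log m t)
        Log-Y = ≅-trans
          (Log-* 1≤e (1≤^ 1≤m^U k))
          (+-cong-≅ {Log e} {Log e} {Log ((m ℕ.^ U) ℕ.^ k)} {λ t → ι k * (ι U * Log m t)} (≅-reflexive (λ _ → refl)) Log-tail)

        R : ℕ → ℚ
        R t = (Log e t + ι k * (ι U * Log m t)) + ι B * (ι m * Log (suc U) t + uLogu t)

        Log-YX : Log (Y ℕ.* X ℕ.^ B) ≲ R
        Log-YX = ≲-trans
          (proj₁ (Log-* 1≤Y (1≤^ 1≤X B)))
          (+-mono-≲
            (proj₁ Log-Y) (proj₁ Log-X^B))

        LogLHS : (λ t → ι B * (ι U * Log U t)) ≲ Log ((U ℕ.^ U) ℕ.^ B)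
        LogLHS = ≲-trans
          (*-mono-≲ (0≤ι B) (proj₂ (Log-u^u U)))
          (proj₂ (Log-^ B (1≤u^u U)))

      -- The two remainders are the logarithms of the factor lost in k stages and of the polynomial
      -- factor, which occurs in each of the B stages.
      entropy-lower : (U ℕ.^ U) ℕ.^ B ℕ.≤ e ℕ.* (m ℕ.^ U) ℕ.^ k ℕ.* X ℕ.^ B →
        (λ t → ι B * entropy u t) ≲ (λ t → Log e t + (ι k * (ι U * Log m t) + ι B * (ι m * Log (suc U) t)))
      entropy-lower below = ≲-trans
        (≲-trans
          (≤⇒≲ λ t → ℚ.≤-reflexive (solve 3 (λ b x y → b :* (x :- y) := b :* x :+ :- (b :* y)) refl (ι B) (ι U * Log U t) (uLogu t)))
          (+-mono-≲
            (≲-trans LogLHS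
              (≲-trans (≤⇒≲ (Log-mono (1≤^ (1≤u^u U) B) below)) Log-YX))
            (≲-refl)))
        (≤⇒≲ λ t → ℚ.≤-reflexive (solve 5 (λ a b c d e → (a :+ b) :+ d :* (c :+ e) :+ :- (d :* e) := a :+ (b :+ d :* c)) refl
          (Log e t) (ι k * (ι U * Log m t)) (ι m * Log (suc U) t) (ι B) (uLogu t)))

  Log-scale : ∀ {B} u → 1 ℕ.≤ B → (λ t → ι (B ℕ.* u) * Log (B ℕ.* u) t) ≅ (λ t → ι B * (ι u * Log u t) + ι B * (ι u * Log B t))
  Log-scale {B} zero 1≤B = ≅-reflexive λ t → trans (cong (λ z → ι z * Log z t) (ℕ.*-zeroʳ B))
    (solve 4 (λ a b c B → con 0ℚ :* a := B :* (con 0ℚ :* b) :+ B :* (con 0ℚ :* c)) refl (Log 0 t) (Log 0 t) (Log B t) (ι B))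
  Log-scale {B} (suc u) 1≤B = ≅-trans {λ t → ι (B ℕ.* suc u) * Log (B ℕ.* suc u) t} {λ t → ι (B ℕ.* suc u) * (Log B t + Log (suc u) t)}
    {λ t → ι B * (ι (suc u) * Log (suc u) t) + ι B * (ι (suc u) * Log B t)}
    (*-cong-≅ (0≤ι (B ℕ.* suc u)) (Log-* 1≤B (ℕ.s≤s ℕ.z≤n)))
    (≅-reflexive λ t → trans (cong (_* (Log B t + Log (suc u) t)) (ι-* B (suc u)))
      (solve 4 (λ B u x y → (B :* u) :* (x :+ y) := B :* (u :* y) :+ B :* (u :* x)) refl (ι B) (ι (suc u)) (Log B t) (Log (suc u) t)))

  Σ-scale : ∀ {m} B (q : Fin m → ℕ) → Σℕ.sum (λ i → B ℕ.* q i) ≡ B ℕ.* Σℕ.sum q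
  Σ-scale {zero}  B q = sym (ℕ.*-zeroʳ B)
  Σ-scale {suc m} B q = trans (cong (B ℕ.* q Fin.zero ℕ.+_) (Σ-scale B (q ∘ Fin.suc))) (sym (ℕ.*-distribˡ-+ B (q Fin.zero) _))

  -- Entropy is homogeneous of degree one, as the terms in log B cancel. This replaces the letters
  -- qᵢ of one stage by the numbers B qᵢ, which are close to the chain lengths.
  entropy-scale : ∀ {m B} (q : Fin m → ℕ) → 1 ℕ.≤ B → entropy (λ i → B ℕ.* q i) ≅ (λ t → ι B * entropy q t)
  entropy-scale {m} {B} q 1≤B = ≅-trans {entropy (λ i → B ℕ.* q i)}
    {λ t → (ι B * (ι Q * Log Q t) + ι B * (ι Q * Log B t)) + - Σℚ.sum (λ i → ι B * (ι (q i) * Log (q i) t) + ι B * (ι (q i) * Log B t))}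
    {λ t → ι B * entropy q t}
    (+-cong-≅ {λ t → ι BQ * Log BQ t} {λ t → ι B * (ι Q * Log Q t) + ι B * (ι Q * Log B t)}
      {λ t → - Σℚ.sum (λ i → ι (B ℕ.* q i) * Log (B ℕ.* q i) t)} {λ t → - Σℚ.sum (λ i → ι B * (ι (q i) * Log (q i) t) + ι B * (ι (q i) * Log B t))}
      (subst (λ z → (λ t → ι z * Log z t) ≅ (λ t → ι B * (ι Q * Log Q t) + ι B * (ι Q * Log B t))) (sym (Σ-scale B q)) (Log-scale Q 1≤B))
      (neg-cong-≅
        (sum-cong-≅ (λ i t → ι (B ℕ.* q i) * Log (B ℕ.* q i) t) (λ i t → ι B * (ι (q i) * Log (q i) t) + ι B * (ι (q i) * Log B t)) (λ i → Log-scale (q i) 1≤B))))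
    (≅-reflexive collect)
    where
    Q = Σℕ.sum q
    BQ = Σℕ.sum (λ i → B ℕ.* q i)
    collect : ∀ t → (ι B * (ι Q * Log Q t) + ι B * (ι Q * Log B t)) + - Σℚ.sum (λ i → ι B * (ι (q i) * Log (q i) t) + ι B * (ι (q i) * Log B t)) ≡ ι B * entropy q t
    collect t = begin-equality
      (ι B * (ι Q * Log Q t) + ι B * (ι Q * Log B t)) + - Σℚ.sum (λ i → ι B * (ι (q i) * Log (q i) t) + ι B * (ι (q i) * Log B t))
        ≡⟨ cong (λ s → (ι B * (ι Q * Log Q t) + ι B * (ι Q * Log B t)) + - s) sums ⟩
      (ι B * (ι Q * Log Q t) + ι B * (ι Q * Log B t)) + - (ι B * S + ι B * (ι Q * Log B t))
        ≡⟨ solve 4 (λ b x y s → (b :* x :+ b :* y) :+ :- (b :* s :+ b :* y) := b :* (x :- s)) refl (ι B) (ι Q * Log Q t) (ι Q * Log B t) S ⟩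
      ι B * entropy q t ∎
      where
      S = Σℚ.sum (λ i → ι (q i) * Log (q i) t)
      sums : Σℚ.sum (λ i → ι B * (ι (q i) * Log (q i) t) + ι B * (ι (q i) * Log B t)) ≡ ι B * S + ι B * (ι Q * Log B t)
      sums = begin-equality
        Σℚ.sum (λ i → ι B * (ι (q i) * Log (q i) t) + ι B * (ι (q i) * Log B t))
          ≡⟨ Σℚ.∑-distrib-+ (λ i → ι B * (ι (q i) * Log (q i) t)) (λ i → ι B * (ι (q i) * Log B t)) ⟩
        Σℚ.sum (λ i → ι B * (ι (q i) * Log (q i) t)) + Σℚ.sum (λ i → ι B * (ι (q i) * Log B t))
          ≡⟨ cong₂ _+_ (*-distribˡ-sum (ι B) (λ i → ι (q i) * Log (q i) t)) (*-distribˡ-sum (ι B) (λ i → ι (q i) * Log B t)) ⟨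
        ι B * S + ι B * Σℚ.sum (λ i → ι (q i) * Log B t)
          ≡⟨ cong (λ s → ι B * S + ι B * s) (begin-equality
               Σℚ.sum (λ i → ι (q i) * Log B t)   ≡⟨ Σℚ.sum-cong-≗ (λ i → ℚ.*-comm (ι (q i)) (Log B t)) ⟩
               Σℚ.sum (λ i → Log B t * ι (q i))   ≡⟨ *-distribˡ-sum (Log B t) (ι ∘ q) ⟨
               Log B t * Σℚ.sum (ι ∘ q)           ≡⟨ cong (Log B t *_) (ι-sum q) ⟨
               Log B t * ι Q                      ≡⟨ ℚ.*-comm (Log B t) (ι Q) ⟩
               ι Q * Log B t                      ∎) ⟩
        ι B * S + ι B * (ι Q * Log B t) ∎

-- Words with prescribed numbers of letters

module Words where

  import Algebra.Properties.CommutativeMonoid.Sum as Sum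
  import Algebra.Properties.CommutativeSemiring.Binomial as Binomial
  import Algebra.Properties.Semiring.Exp as Exp
  import Algebra.Properties.Semiring.Mult as Mult
  open import Data.Fin.Base as Fin using (Fin; toℕ)
  import Data.Fin.Properties as Fin
  open import Data.List.Base as List using (List; []; _∷_; _++_; length; map; concatMap; allFin; tabulate; filter; cartesianProductWith)
  import Data.List.Properties as List
  open import Data.List.Membership.Propositional using (_∈_)
  open import Data.List.Membership.Propositional.Properties
  open import Data.List.Relation.Unary.All as All using (All; []; _∷_)
  import Data.List.Relation.Unary.All.Properties as All
  open import Data.List.Relation.Unary.AllPairs as AllPairs using ([]; _∷_)
  import Data.List.Relation.Unary.AllPairs.Properties as AllPairs
  open import Data.List.Relation.Unary.Any as Any using (here; there)
  open import Data.List.Relation.Unary.Unique.Propositional using (Unique)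
  import Data.List.Relation.Unary.Unique.Propositional.Properties as Unique
  open import Data.Nat.Base as ℕ using (ℕ; zero; suc; _+_; _*_; _^_; _≤_; _<_; z≤n; s≤s; _!)
  open import Data.Nat.Combinatorics using (_C_; nCk≡n!/k![n-k]!; [n∸k]!k!∣n!)
  import Data.Nat.Divisibility as ℕ
  import Data.Nat.DivMod as ℕ
  import Data.Nat.Properties as ℕ
  open import Data.Nat.Solver using (module +-*-Solver)
  open import Data.Product.Base using (∃-syntax; _×_; _,_; proj₁; proj₂)
  open import Data.Sum.Base using (inj₁; inj₂)
  open import Data.Vec.Functional as Vector using (updateAt)
  import Data.Vec.Functional.Properties as Vector
  open import Function.Base using (_∘_; id)
  open import Relation.Binary.Definitions using (tri<; tri≈; tri>)
  open import Relation.Binary.PropositionalEquality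
  open import Relation.Nullary using (yes; no; contradiction; Dec)
  open ℕ.≤-Reasoning
  open +-*-Solver using (solve; _:=_; _:+_; _:*_)
  private
    module Σℕ = Sum ℕ.+-0-commutativeMonoid
    module Πℕ = Sum ℕ.*-1-commutativeMonoid
    module ℕ^ = Exp ℕ.+-*-semiring
    module ℕ× = Mult ℕ.+-*-semiring
    variable
      A B : Set
      m : ℕ

  -- The injection is a relation, so that images may come with evidence and need not be values of a
  -- function on the whole type. When the image y of the head is removed from ys, no other element
  -- loses its image: it would be equal to the head.
  length-≤ : (R : A → B → Set) {xs : List A} {ys : List B} → Unique xs →
    (∀ {x} → x ∈ xs → ∃[ y ] y ∈ ys × R x y) →
    (∀ {x x′ y} → x ∈ xs → x′ ∈ xs → R x y → R x′ y → x ≡ x′) → length xs ≤ length ys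
  length-≤ R {[]}     {ys} []       total injective = z≤n
  length-≤ {A = A} {B = B} R {x ∷ xs} {ys} (x∉xs ∷ uniq) total injective = split (total (here refl))
    where
    split : (∃[ y ] y ∈ ys × R x y) → suc (length xs) ≤ length ys
    split (y , y∈ys , Rxy) with ys₁ , ys₂ , refl ← ∈-∃++ y∈ys = begin
      suc (length xs)            ≤⟨ s≤s (length-≤ R uniq total′ λ x∈ x′∈ → injective (there x∈) (there x′∈)) ⟩
      suc (length (ys₁ ++ ys₂))  ≡⟨ List.length-++-sucʳ ys₁ y ys₂ ⟨
      length (ys₁ ++ y ∷ ys₂)    ∎
      where
      total′ : ∀ {x′} → x′ ∈ xs → ∃[ y′ ] y′ ∈ ys₁ ++ ys₂ × R x′ y′
      total′ {x′} x′∈ = relocate (total (there x′∈))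
        where
        relocate : (∃[ y′ ] y′ ∈ ys₁ ++ y ∷ ys₂ × R x′ y′) → ∃[ y′ ] y′ ∈ ys₁ ++ ys₂ × R x′ y′
        relocate (y′ , y′∈ , Rx′y′) with ∈-++⁻ ys₁ y′∈
        ... | inj₁ ∈ys₁         = y′ , ∈-++⁺ˡ ∈ys₁ , Rx′y′
        ... | inj₂ (there ∈ys₂) = y′ , ∈-++⁺ʳ ys₁ ∈ys₂ , Rx′y′
        ... | inj₂ (here refl)  = contradiction (injective (here refl) (there x′∈) Rxy Rx′y′) (All.lookup x∉xs x′∈)

  sum-mono : {f g : Fin m → ℕ} → (∀ i → f i ≤ g i) → Σℕ.sum f ≤ Σℕ.sum g
  sum-mono {zero}  le = z≤n
  sum-mono {suc m} le = ℕ.+-mono-≤ (le Fin.zero) (sum-mono (le ∘ Fin.suc))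

  *-distribˡ-Σ : ∀ c (f : Fin m → ℕ) → c * Σℕ.sum f ≡ Σℕ.sum (λ i → c * f i)
  *-distribˡ-Σ {zero}  c f = ℕ.*-zeroʳ c
  *-distribˡ-Σ {suc m} c f = trans (ℕ.*-distribˡ-+ c (f Fin.zero) _) (cong (c * f Fin.zero +_) (*-distribˡ-Σ c (f ∘ Fin.suc)))

  *-distribʳ-Σ : ∀ c (f : Fin m → ℕ) → Σℕ.sum f * c ≡ Σℕ.sum (λ i → f i * c)
  *-distribʳ-Σ c f = trans (ℕ.*-comm (Σℕ.sum f) c) (trans (*-distribˡ-Σ c f) (Σℕ.sum-cong-≗ λ i → ℕ.*-comm c (f i)))

  Σ≡0⇒≡0 : (c : Fin m → ℕ) → Σℕ.sum c ≡ 0 → ∀ κ → c κ ≡ 0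
  Σ≡0⇒≡0 c eq Fin.zero    = ℕ.m+n≡0⇒m≡0 (c Fin.zero) eq
  Σ≡0⇒≡0 c eq (Fin.suc κ) = Σ≡0⇒≡0 (c ∘ Fin.suc) (ℕ.m+n≡0⇒n≡0 (c Fin.zero) eq) κ

  Σ-update : (f g : Fin m → ℕ) (κ : Fin m) (y : ℕ) → f κ ≡ y + g κ → (∀ i → i ≢ κ → f i ≡ g i) → Σℕ.sum f ≡ y + Σℕ.sum g
  Σ-update f g Fin.zero y eq rest = trans (cong₂ _+_ eq (Σℕ.sum-cong-≗ λ i → rest (Fin.suc i) λ ())) (ℕ.+-assoc y _ _)
  Σ-update f g (Fin.suc κ) y eq rest = begin-equality
    f Fin.zero + Σℕ.sum (f ∘ Fin.suc)          ≡⟨ cong₂ _+_ (rest Fin.zero λ ()) (Σ-update (f ∘ Fin.suc) (g ∘ Fin.suc) κ y eq λ i i≢κ → rest (Fin.suc i) (i≢κ ∘ Fin.suc-injective)) ⟩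
    g Fin.zero + (y + Σℕ.sum (g ∘ Fin.suc))    ≡⟨ solve 3 (λ a b c → a :+ (b :+ c) := b :+ (a :+ c)) refl (g Fin.zero) y (Σℕ.sum (g ∘ Fin.suc)) ⟩
    y + (g Fin.zero + Σℕ.sum (g ∘ Fin.suc))    ∎

  Π-update : (f g : Fin m → ℕ) (κ : Fin m) (y : ℕ) → f κ ≡ y * g κ → (∀ i → i ≢ κ → f i ≡ g i) → Πℕ.sum f ≡ y * Πℕ.sum g
  Π-update f g Fin.zero y eq rest = trans (cong₂ _*_ eq (Πℕ.sum-cong-≗ λ i → rest (Fin.suc i) λ ())) (ℕ.*-assoc y _ _)
  Π-update f g (Fin.suc κ) y eq rest = begin-equality
    f Fin.zero * Πℕ.sum (f ∘ Fin.suc)          ≡⟨ cong₂ _*_ (rest Fin.zero λ ()) (Π-update (f ∘ Fin.suc) (g ∘ Fin.suc) κ y eq λ i i≢κ → rest (Fin.suc i) (i≢κ ∘ Fin.suc-injective)) ⟩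
    g Fin.zero * (y * Πℕ.sum (g ∘ Fin.suc))    ≡⟨ solve 3 (λ a b c → a :* (b :* c) := b :* (a :* c)) refl (g Fin.zero) y (Πℕ.sum (g ∘ Fin.suc)) ⟩
    y * (g Fin.zero * Πℕ.sum (g ∘ Fin.suc))    ∎

  length-concatMap-tabulate : ∀ {n} (f : A → List B) (g : Fin n → A) → length (concatMap f (tabulate g)) ≡ Σℕ.sum (length ∘ f ∘ g)
  length-concatMap-tabulate {n = zero}  f g = refl
  length-concatMap-tabulate {n = suc n} f g = trans (List.length-++ (f (g Fin.zero)))
    (cong (length (f (g Fin.zero)) +_) (length-concatMap-tabulate f (g ∘ Fin.suc)))

  δ : Fin m → Fin m → ℕ
  δ κ x = if-dec (κ Fin.≟ x)
    where
    if-dec : {P : Set} → Dec P → ℕ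
    if-dec (yes _) = 1
    if-dec (no _)  = 0

  δ-refl : (κ : Fin m) → δ κ κ ≡ 1
  δ-refl κ with κ Fin.≟ κ
  ... | yes _  = refl
  ... | no κ≢κ = contradiction refl κ≢κ

  δ-≢ : {κ x : Fin m} → κ ≢ x → δ κ x ≡ 0
  δ-≢ {κ = κ} {x} κ≢x with κ Fin.≟ x
  ... | yes κ≡x = contradiction κ≡x κ≢x
  ... | no _    = refl

  count : Fin m → List (Fin m) → ℕ
  count κ []      = 0
  count κ (x ∷ w) = δ κ x + count κ w

  count-++ : ∀ κ (u v : List (Fin m)) → count κ (u ++ v) ≡ count κ u + count κ v
  count-++ κ []      v = refl
  count-++ κ (x ∷ u) v = trans (cong (δ κ x +_) (count-++ κ u v)) (sym (ℕ.+-assoc (δ κ x) _ _))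

  length-count : (w : List (Fin m)) → length w ≡ Σℕ.sum (λ κ → count κ w)
  length-count {m} []      = sym (Σℕ.sum-replicate-zero m)
  length-count     (x ∷ w) = trans (cong suc (length-count w))
    (sym (Σ-update (λ κ → δ κ x + count κ w) (λ κ → count κ w) x 1 (cong (_+ count x w) (δ-refl x))
      λ κ κ≢x → cong (_+ count κ w) (δ-≢ κ≢x)))

  lower : (Fin m → ℕ) → Fin m → Fin m → ℕ
  lower c κ = updateAt c κ ℕ.pred

  -- The words of length n with c κ letters κ, provided that Σ c = n.
  arrangements : ℕ → (Fin m → ℕ) → List (List (Fin m))
  startingWith : ℕ → (Fin m → ℕ) → Fin m → ℕ → List (List (Fin m))

  arrangements zero        c = [] ∷ []
  arrangements {m} (suc n) c = concatMap (λ κ → startingWith n c κ (c κ)) (allFin m)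

  startingWith n c κ zero    = []
  startingWith n c κ (suc _) = map (κ ∷_) (arrangements n (lower c κ))

  multinomial : (Fin m → ℕ) → ℕ
  multinomial c = length (arrangements (Σℕ.sum c) c)

  module _ (c : Fin m → ℕ) (κ : Fin m) {a : ℕ} (cκ : c κ ≡ suc a) where

    lower-at : lower c κ κ ≡ a
    lower-at = trans (Vector.updateAt-updates κ c) (cong ℕ.pred cκ)

    lower-off : ∀ i → i ≢ κ → c i ≡ lower c κ i
    lower-off i i≢κ = sym (Vector.updateAt-minimal i κ c i≢κ)

    Σ-lower : ∀ {n} → Σℕ.sum c ≡ suc n → Σℕ.sum (lower c κ) ≡ n
    Σ-lower eq = ℕ.suc-injective (trans (sym (Σ-update c (lower c κ) κ 1 (trans cκ (cong suc (sym lower-at))) lower-off)) eq)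

  arrangements-suc : ∀ n (c : Fin m → ℕ) → length (arrangements (suc n) c) ≡ Σℕ.sum (λ κ → length (startingWith n c κ (c κ)))
  arrangements-suc n c = length-concatMap-tabulate (λ κ → startingWith n c κ (c κ)) id

  -- In the expansion of (Σ xᵢ)^n each word with content c contributes ∏ xᵢ^cᵢ. The induction sorts
  -- the words by their first letter. Weights x = c give the upper bound for tableaux, weights 1 a
  -- crude bound for the multinomial coefficient.
  arrangements-weighted : ∀ n (c x : Fin m → ℕ) → Σℕ.sum c ≡ n →
    length (arrangements n c) * Πℕ.sum (λ κ → x κ ^ c κ) ≤ Σℕ.sum x ^ n
  arrangements-weighted {m} zero c x Σc = ℕ.≤-reflexive (trans (ℕ.+-identityʳ _) (trans (Πℕ.sum-cong-≗ λ κ → cong (x κ ^_) (Σ≡0⇒≡0 c Σc κ)) (Πℕ.sum-replicate-zero m)))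
  arrangements-weighted {m} (suc n) c x Σc = begin
    length (arrangements (suc n) c) * P                        ≡⟨ cong (_* P) (arrangements-suc n c) ⟩
    Σℕ.sum (λ κ → length (startingWith n c κ (c κ))) * P       ≡⟨ *-distribʳ-Σ P (λ κ → length (startingWith n c κ (c κ))) ⟩
    Σℕ.sum (λ κ → length (startingWith n c κ (c κ)) * P)       ≤⟨ sum-mono (λ κ → term κ (c κ) refl) ⟩
    Σℕ.sum (λ κ → x κ * Σℕ.sum x ^ n)                          ≡⟨ *-distribʳ-Σ (Σℕ.sum x ^ n) x ⟨
    Σℕ.sum x * Σℕ.sum x ^ n                                    ∎
    where
    P = Πℕ.sum (λ κ → x κ ^ c κ)
    term : ∀ κ a → c κ ≡ a → length (startingWith n c κ a) * P ≤ x κ * Σℕ.sum x ^ n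
    term κ zero    _  = z≤n
    term κ (suc a) cκ = begin
      length (map (κ ∷_) ws) * P              ≡⟨ cong₂ _*_ (List.length-map (κ ∷_) ws) (Π-update (λ i → x i ^ c i) (λ i → x i ^ c′ i) κ (x κ)
                                                   (trans (cong (x κ ^_) cκ) (cong (λ b → x κ * x κ ^ b) (sym (lower-at c κ cκ))))
                                                   λ i i≢κ → cong (x i ^_) (lower-off c κ cκ i i≢κ)) ⟩
      length ws * (x κ * P′)                  ≡⟨ solve 3 (λ a b c → a :* (b :* c) := b :* (a :* c)) refl (length ws) (x κ) P′ ⟩
      x κ * (length ws * P′)                  ≤⟨ ℕ.*-monoʳ-≤ (x κ) (arrangements-weighted n c′ x (Σ-lower c κ cκ Σc)) ⟩
      x κ * Σℕ.sum x ^ n                      ∎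
      where c′ = lower c κ
            ws = arrangements n c′
            P′ = Πℕ.sum (λ i → x i ^ c′ i)

  -- Again by the first letter: (n + 1)! is the sum of the terms c κ · n!, and c κ times the
  -- factorial of c κ - 1 restores the factor c κ ! of the product.
  arrangements-factorial : ∀ n (c : Fin m → ℕ) → Σℕ.sum c ≡ n →
    n ! ≤ length (arrangements n c) * Πℕ.sum (λ κ → c κ !)
  arrangements-factorial zero c Σc = ℕ.≤-trans (1≤Π! c) (ℕ.≤-reflexive (sym (ℕ.+-identityʳ _)))
    where
    1≤Π! : ∀ {m} (c : Fin m → ℕ) → 1 ≤ Πℕ.sum (λ κ → c κ !)
    1≤Π! {zero}  c = ℕ.≤-refl
    1≤Π! {suc m} c = ℕ.*-mono-≤ (ℕ.1≤n! (c Fin.zero)) (1≤Π! (c ∘ Fin.suc))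
  arrangements-factorial (suc n) c Σc = begin
    suc n * n !                                                ≡⟨ cong (_* n !) Σc ⟨
    Σℕ.sum c * n !                                             ≡⟨ *-distribʳ-Σ (n !) c ⟩
    Σℕ.sum (λ κ → c κ * n !)                                   ≤⟨ sum-mono (λ κ → term κ (c κ) refl) ⟩
    Σℕ.sum (λ κ → length (startingWith n c κ (c κ)) * P)       ≡⟨ *-distribʳ-Σ P (λ κ → length (startingWith n c κ (c κ))) ⟨
    Σℕ.sum (λ κ → length (startingWith n c κ (c κ))) * P       ≡⟨ cong (_* P) (arrangements-suc n c) ⟨
    length (arrangements (suc n) c) * P                        ∎
    where
    P = Πℕ.sum (λ κ → c κ !)
    term : ∀ κ a → c κ ≡ a → a * n ! ≤ length (startingWith n c κ a) * P
    term κ zero    _  = z≤n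
    term κ (suc a) cκ = begin
      suc a * n !                     ≤⟨ ℕ.*-monoʳ-≤ (suc a) (arrangements-factorial n c′ (Σ-lower c κ cκ Σc)) ⟩
      suc a * (length ws * P′)        ≡⟨ solve 3 (λ a b c → a :* (b :* c) := b :* (a :* c)) refl (suc a) (length ws) P′ ⟩
      length ws * (suc a * P′)        ≡⟨ cong₂ _*_ (List.length-map (κ ∷_) ws) (Π-update (λ i → c i !) (λ i → c′ i !) κ (suc a)
                                           (trans (cong _! cκ) (cong (λ b → suc a * b !) (sym (lower-at c κ cκ))))
                                           λ i i≢κ → cong _! (lower-off c κ cκ i i≢κ)) ⟨
      length (map (κ ∷_) ws) * P      ∎
      where c′ = lower c κ
            ws = arrangements n c′
            P′ = Πℕ.sum (λ i → c′ i !)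

  ∈-arrangements⁺ : ∀ (c : Fin m → ℕ) w → (∀ κ → count κ w ≡ c κ) → w ∈ arrangements (length w) c
  ∈-arrangements⁺ c []      content = here refl
  ∈-arrangements⁺ {m} c (x ∷ w) content = ∈-concat⁺′ first (∈-map⁺ (λ κ → startingWith (length w) c κ (c κ)) (∈-allFin x))
    where
    cx : c x ≡ suc (count x w)
    cx = trans (sym (content x)) (cong (_+ count x w) (δ-refl x))
    rest : ∀ κ → count κ w ≡ lower c x κ
    rest κ with κ Fin.≟ x
    ... | yes refl = sym (lower-at c x cx)
    ... | no κ≢x   = trans (sym (cong (_+ count κ w) (δ-≢ κ≢x))) (trans (content κ) (lower-off c x cx κ κ≢x))
    first : x ∷ w ∈ startingWith (length w) c x (c x)
    first rewrite cx = ∈-map⁺ (x ∷_) (∈-arrangements⁺ (lower c x) w rest)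

  ∈-startingWith⁻ : ∀ n (c : Fin m → ℕ) κ a {w} → w ∈ startingWith n c κ a →
    ∃[ w′ ] (∃[ a′ ] a ≡ suc a′) × w ≡ κ ∷ w′ × w′ ∈ arrangements n (lower c κ)
  ∈-startingWith⁻ n c κ (suc a) w∈ with w′ , w′∈ , eq ← ∈-map⁻ (κ ∷_) w∈ = w′ , (a , refl) , eq , w′∈

  ∈-arrangements⁻ : ∀ n (c : Fin m → ℕ) → Σℕ.sum c ≡ n → ∀ {w} → w ∈ arrangements n c → length w ≡ n × (∀ κ → count κ w ≡ c κ)
  ∈-arrangements⁻ zero c Σc (here refl) = refl , λ κ → sym (Σ≡0⇒≡0 c Σc κ)
  ∈-arrangements⁻ {m} (suc n) c Σc {w} w∈ = from-first (Any.satisfied (∈-concatMap⁻ (λ κ → startingWith n c κ (c κ)) {xs = allFin m} w∈))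
    where
    from-first : (∃[ κ ] w ∈ startingWith n c κ (c κ)) → length w ≡ suc n × (∀ κ → count κ w ≡ c κ)
    from-first (x , w∈x) with w′ , (a , cx) , refl , w′∈ ← ∈-startingWith⁻ n c x (c x) w∈x
      with len , content ← ∈-arrangements⁻ n (lower c x) (Σ-lower c x cx Σc) w′∈ = cong suc len , content′
      where
      content′ : ∀ κ → δ κ x + count κ w′ ≡ c κ
      content′ κ with κ Fin.≟ x
      ... | yes refl = trans (cong suc (trans (content κ) (lower-at c x cx))) (sym cx)
      ... | no κ≢x   = trans (content κ) (sym (lower-off c x cx κ κ≢x))

  arrangements-unique : ∀ n (c : Fin m → ℕ) → Unique (arrangements n c)
  arrangements-unique zero        c = [] ∷ []
  arrangements-unique {m} (suc n) c = Unique.concat⁺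
    (All.map⁺ (All.tabulate⁺ λ κ → starting κ (c κ)))
    (AllPairs.map⁺ (AllPairs.tabulate⁺ λ {κ} {κ′} κ≢κ′ (w∈ , w∈′) → disjoint κ≢κ′ w∈ w∈′))
    where
    starting : ∀ κ a → Unique (startingWith n c κ a)
    starting κ zero    = []
    starting κ (suc _) = Unique.map⁺ List.∷-injectiveʳ (arrangements-unique n (lower c κ))
    disjoint : ∀ {κ κ′ w} → κ ≢ κ′ → w ∈ startingWith n c κ (c κ) → w ∈ startingWith n c κ′ (c κ′) → _
    disjoint {κ} {κ′} κ≢κ′ w∈ w∈′
      with _ , _ , refl , _ ← ∈-startingWith⁻ n c κ (c κ) w∈ | _ , _ , eq , _ ← ∈-startingWith⁻ n c κ′ (c κ′) w∈′ = κ≢κ′ (List.∷-injectiveˡ eq)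

  -- Multinomial coefficients up to a polynomial factor

  factorial-upper : ∀ c d → (c + d) ! ≤ c ! * (c + d) ^ d
  factorial-upper c zero    = ℕ.≤-reflexive (trans (cong _! (ℕ.+-identityʳ c)) (sym (ℕ.*-identityʳ (c !))))
  factorial-upper c (suc d) = begin
    (c + suc d) !                          ≡⟨ cong _! (ℕ.+-suc c d) ⟩
    suc (c + d) * (c + d) !                ≤⟨ ℕ.*-monoʳ-≤ (suc (c + d)) (factorial-upper c d) ⟩
    suc (c + d) * (c ! * (c + d) ^ d)      ≤⟨ ℕ.*-monoʳ-≤ (suc (c + d)) (ℕ.*-monoʳ-≤ (c !) (ℕ.^-monoˡ-≤ d (ℕ.n≤1+n (c + d)))) ⟩
    suc (c + d) * (c ! * suc (c + d) ^ d)  ≡⟨ solve 3 (λ a b c → a :* (b :* c) := b :* (a :* c)) refl (suc (c + d)) (c !) (suc (c + d) ^ d) ⟩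
    c ! * suc (c + d) ^ suc d              ≡⟨ cong (λ n → c ! * n ^ suc d) (ℕ.+-suc c d) ⟨
    c ! * (c + suc d) ^ suc d              ∎

  factorial-lower : ∀ q d → q ! * q ^ d ≤ (q + d) !
  factorial-lower q zero    = ℕ.≤-reflexive (trans (ℕ.*-identityʳ (q !)) (cong _! (sym (ℕ.+-identityʳ q))))
  factorial-lower q (suc d) = begin
    q ! * (q * q ^ d)              ≡⟨ solve 3 (λ a b c → a :* (b :* c) := b :* (a :* c)) refl (q !) q (q ^ d) ⟩
    q * (q ! * q ^ d)              ≤⟨ ℕ.*-mono-≤ (ℕ.≤-trans (ℕ.m≤m+n q d) (ℕ.n≤1+n (q + d))) (factorial-lower q d) ⟩
    suc (q + d) * (q + d) !        ≡⟨ cong _! (ℕ.+-suc q d) ⟨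
    (q + suc d) !                  ∎

  -- q ^ c / c ! is largest at c = q.
  power/factorial-max : ∀ q c → q ! * q ^ c ≤ c ! * q ^ q
  power/factorial-max q c with ℕ.≤-total c q
  ... | inj₁ c≤q with d , refl ← ℕ.m≤n⇒∃[o]m+o≡n c≤q = begin
    (c + d) ! * (c + d) ^ c                    ≤⟨ ℕ.*-monoˡ-≤ ((c + d) ^ c) (factorial-upper c d) ⟩
    c ! * (c + d) ^ d * (c + d) ^ c            ≡⟨ ℕ.*-assoc (c !) _ _ ⟩
    c ! * ((c + d) ^ d * (c + d) ^ c)          ≡⟨ cong (c ! *_) (trans (sym (ℕ.^-distribˡ-+-* (c + d) d c)) (cong ((c + d) ^_) (ℕ.+-comm d c))) ⟩
    c ! * (c + d) ^ (c + d)                    ∎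
  ... | inj₂ q≤c with d , refl ← ℕ.m≤n⇒∃[o]m+o≡n q≤c = begin
    q ! * q ^ (q + d)                ≡⟨ cong (q ! *_) (trans (cong (q ^_) (ℕ.+-comm q d)) (ℕ.^-distribˡ-+-* q d q)) ⟩
    q ! * (q ^ d * q ^ q)            ≡⟨ ℕ.*-assoc (q !) _ _ ⟨
    q ! * q ^ d * q ^ q              ≤⟨ ℕ.*-monoˡ-≤ (q ^ q) (factorial-lower q d) ⟩
    (q + d) ! * q ^ q                ∎

  C-factorial : ∀ {n k} → k ≤ n → (n C k) * (k ! * (n ℕ.∸ k) !) ≡ n !
  C-factorial {n} {k} k≤n = trans (cong (_* (k ! * (n ℕ.∸ k) !)) (nCk≡n!/k![n-k]! k≤n))
    (ℕ.m/n*n≡m (subst (ℕ._∣ n !) (ℕ.*-comm ((n ℕ.∸ k) !) (k !)) ([n∸k]!k!∣n! k≤n)))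
    where
    instance _ = k ℕ.!* (n ℕ.∸ k) !≢0

  -- The expansion of (a + b)^n, where n = a + b, has n + 1 terms C(n,k) a^k b^(n-k), and by
  -- `power/factorial-max` the term at k = a is the largest.
  binomial-max : ∀ a b → (a + b) ^ (a + b) * (a ! * b !) ≤ suc (a + b) * ((a + b) ! * (a ^ a * b ^ b))
  binomial-max a b = begin
    n ^ n * (a ! * b !)
      ≡⟨ cong (_* (a ! * b !)) (trans (sym (Exp-^ n n)) (Binomial.theorem ℕ.+-*-commutativeSemiring n a b)) ⟩
    Σℕ.sum g * (a ! * b !)
      ≡⟨ *-distribʳ-Σ (a ! * b !) g ⟩
    Σℕ.sum (λ k → g k * (a ! * b !))
      ≤⟨ sum-mono {suc n} (λ k → term (toℕ k) (ℕ.≤-pred (Fin.toℕ<n k))) ⟩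
    Σℕ.sum {suc n} (λ _ → n ! * (a ^ a * b ^ b))
      ≡⟨ trans (Σℕ.sum-replicate (suc n)) (Mult-× (suc n) (n ! * (a ^ a * b ^ b))) ⟩
    suc n * (n ! * (a ^ a * b ^ b)) ∎
    where
    n = a + b
    g : Fin (suc n) → ℕ
    g k = (n C toℕ k) ℕ×.× (a ℕ^.^ toℕ k * b ℕ^.^ (n ℕ.∸ toℕ k))
    Exp-^ : ∀ x k → x ℕ^.^ k ≡ x ^ k
    Exp-^ x zero    = refl
    Exp-^ x (suc k) = cong (x *_) (Exp-^ x k)
    Mult-× : ∀ k x → k ℕ×.× x ≡ k * x
    Mult-× zero    x = refl
    Mult-× (suc k) x = cong (x +_) (Mult-× k x)
    term : ∀ k → k ≤ n → (n C k) ℕ×.× (a ℕ^.^ k * b ℕ^.^ (n ℕ.∸ k)) * (a ! * b !) ≤ n ! * (a ^ a * b ^ b)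
    term k k≤n = begin
      (n C k) ℕ×.× (a ℕ^.^ k * b ℕ^.^ j) * (a ! * b !)
        ≡⟨ cong (_* (a ! * b !)) (trans (Mult-× (n C k) _) (cong₂ (λ u v → (n C k) * (u * v)) (Exp-^ a k) (Exp-^ b j))) ⟩
      (n C k) * (a ^ k * b ^ j) * (a ! * b !)
        ≡⟨ solve 5 (λ c p q r s → c :* (p :* q) :* (r :* s) := c :* ((r :* p) :* (s :* q))) refl (n C k) (a ^ k) (b ^ j) (a !) (b !) ⟩
      (n C k) * ((a ! * a ^ k) * (b ! * b ^ j))
        ≤⟨ ℕ.*-monoʳ-≤ (n C k) (ℕ.*-mono-≤ (power/factorial-max a k) (power/factorial-max b j)) ⟩
      (n C k) * ((k ! * a ^ a) * (j ! * b ^ b))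
        ≡⟨ solve 5 (λ c p q r s → c :* ((r :* p) :* (s :* q)) := c :* (r :* s) :* (p :* q)) refl (n C k) (a ^ a) (b ^ b) (k !) (j !) ⟩
      (n C k) * (k ! * j !) * (a ^ a * b ^ b)
        ≡⟨ cong (_* (a ^ a * b ^ b)) (C-factorial k≤n) ⟩
      n ! * (a ^ a * b ^ b) ∎
      where j = n ℕ.∸ k

  factorials-max : (q : Fin m → ℕ) → let Q = Σℕ.sum q in
    Q ^ Q * Πℕ.sum (λ κ → q κ !) ≤ suc Q ^ m * (Q ! * Πℕ.sum (λ κ → q κ ^ q κ))
  factorials-max {zero}  q = ℕ.≤-refl
  -- The letters after the first act as a single letter with Q′ occurrences in `binomial-max`; its
  -- factorial Q′ ! is supplied here and cancelled at the end.
  factorials-max {suc m} q = ℕ.*-cancelʳ-≤ _ _ (Q′ !) {{ℕ._!≢0 Q′}} (begin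
    Q ^ Q * (a ! * P) * Q′ !
      ≡⟨ solve 4 (λ x y z w → x :* (y :* z) :* w := (x :* (y :* w)) :* z) refl (Q ^ Q) (a !) P (Q′ !) ⟩
    Q ^ Q * (a ! * Q′ !) * P
      ≤⟨ ℕ.*-monoˡ-≤ P (binomial-max a Q′) ⟩
    suc Q * (Q ! * (a ^ a * Q′ ^ Q′)) * P
      ≡⟨ solve 5 (λ x y z w p → x :* (y :* (z :* w)) :* p := x :* (y :* z) :* (w :* p)) refl (suc Q) (Q !) (a ^ a) (Q′ ^ Q′) P ⟩
    suc Q * (Q ! * a ^ a) * (Q′ ^ Q′ * P)
      ≤⟨ ℕ.*-monoʳ-≤ (suc Q * (Q ! * a ^ a)) (factorials-max (q ∘ Fin.suc)) ⟩
    suc Q * (Q ! * a ^ a) * (suc Q′ ^ m * (Q′ ! * R))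
      ≤⟨ ℕ.*-monoʳ-≤ (suc Q * (Q ! * a ^ a)) (ℕ.*-monoˡ-≤ (Q′ ! * R) (ℕ.^-monoˡ-≤ m (s≤s (ℕ.m≤n+m Q′ a)))) ⟩
    suc Q * (Q ! * a ^ a) * (suc Q ^ m * (Q′ ! * R))
      ≡⟨ solve 6 (λ x y z w f r → x :* (y :* z) :* (w :* (f :* r)) := (x :* w) :* (y :* (z :* r)) :* f) refl (suc Q) (Q !) (a ^ a) (suc Q ^ m) (Q′ !) R ⟩
    suc Q * suc Q ^ m * (Q ! * (a ^ a * R)) * Q′ ! ∎)
    where
    a = q Fin.zero
    Q′ = Σℕ.sum (q ∘ Fin.suc)
    Q = a + Q′
    P = Πℕ.sum (λ κ → q (Fin.suc κ) !)
    R = Πℕ.sum (λ κ → q (Fin.suc κ) ^ q (Fin.suc κ))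

  Π!≢0 : (q : Fin m → ℕ) → ℕ.NonZero (Πℕ.sum (λ κ → q κ !))
  Π!≢0 {zero}  q = _
  Π!≢0 {suc m} q = ℕ.m*n≢0 (q Fin.zero !) (Πℕ.sum (λ κ → q (Fin.suc κ) !)) {{ℕ._!≢0 (q Fin.zero)}} {{Π!≢0 (q ∘ Fin.suc)}}

  -- A converse of `arrangements-weighted` with weights q, at the price of the factor (Q + 1)^m.
  multinomial-lower : (q : Fin m → ℕ) → let Q = Σℕ.sum q in
    Q ^ Q ≤ multinomial q * (suc Q ^ m * Πℕ.sum (λ κ → q κ ^ q κ))
  multinomial-lower {m} q = ℕ.*-cancelʳ-≤ _ _ P {{Π!≢0 q}} (begin
    Q ^ Q * P                                  ≤⟨ factorials-max q ⟩
    suc Q ^ m * (Q ! * R)                      ≤⟨ ℕ.*-monoʳ-≤ (suc Q ^ m) (ℕ.*-monoˡ-≤ R (arrangements-factorial Q q refl)) ⟩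
    suc Q ^ m * (multinomial q * P * R)        ≡⟨ solve 4 (λ s c p r → s :* (c :* p :* r) := c :* (s :* r) :* p) refl (suc Q ^ m) (multinomial q) P R ⟩
    multinomial q * (suc Q ^ m * R) * P        ∎)
    where
    Q = Σℕ.sum q
    P = Πℕ.sum (λ κ → q κ !)
    R = Πℕ.sum (λ κ → q κ ^ q κ)

  multinomial-upper : (q : Fin m → ℕ) → multinomial q ≤ m ^ Σℕ.sum q
  multinomial-upper {m} q = begin
    multinomial q                                   ≡⟨ ℕ.*-identityʳ _ ⟨
    multinomial q * 1                               ≡⟨ cong (multinomial q *_) (trans (Πℕ.sum-cong-≗ λ κ → ℕ.^-zeroˡ (q κ)) (Πℕ.sum-replicate-zero m)) ⟨
    multinomial q * Πℕ.sum (λ κ → 1 ^ q κ)          ≤⟨ arrangements-weighted (Σℕ.sum q) q (λ _ → 1) refl ⟩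
    Σℕ.sum {m} (λ _ → 1) ^ Σℕ.sum q                 ≡⟨ cong (_^ Σℕ.sum q) (Σ1 m) ⟩
    m ^ Σℕ.sum q                                    ∎
    where
    Σ1 : ∀ m → Σℕ.sum {m} (λ _ → 1) ≡ m
    Σ1 zero    = refl
    Σ1 (suc m) = cong suc (Σ1 m)

  arrangements-nonempty : (d : Fin m → ℕ) → ∃[ w ] w ∈ arrangements (Σℕ.sum d) d
  arrangements-nonempty d = inhabited (arrangements (Σℕ.sum d) d) (arrangements-factorial (Σℕ.sum d) d refl)
    where
    inhabited : ∀ ws → Σℕ.sum d ! ≤ length ws * Πℕ.sum (λ κ → d κ !) → ∃[ w ] w ∈ ws
    inhabited []       h = contradiction (ℕ.≤-trans (ℕ.1≤n! (Σℕ.sum d)) h) λ ()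
    inhabited (w ∷ ws) h = w , here refl

  -- Words and fillings of a set that is cut into chains

  data At {A : Set} : List A → ℕ → A → Set where
    here  : ∀ {x xs} → At (x ∷ xs) 0 x
    there : ∀ {x y xs v} → At xs v y → At (x ∷ xs) (suc v) y

  At-functional : ∀ {w : List A} {v x y} → At w v x → At w v y → x ≡ y
  At-functional here      here      = refl
  At-functional (there p) (there q) = At-functional p q

  At-ext : ∀ (w w′ : List A) → length w ≡ length w′ → (∀ v → v < length w → ∃[ x ] At w v x × At w′ v x) → w ≡ w′
  At-ext []      []        _   _    = refl
  At-ext (x ∷ w) (x′ ∷ w′) len same with same 0 (s≤s z≤n)
  ... | _ , here , here = cong (x ∷_) (At-ext w w′ (ℕ.suc-injective len) λ v v<w → tail (same (suc v) (s≤s v<w)))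
    where
    tail : ∀ {v} → (∃[ y ] At (x ∷ w) (suc v) y × At (x ∷ w′) (suc v) y) → ∃[ y ] At w v y × At w′ v y
    tail (y , there p , there q) = y , p , q

  At-tabulate : ∀ {n} (f : Fin n → A) v → At (tabulate f) (toℕ v) (f v)
  At-tabulate f Fin.zero    = here
  At-tabulate f (Fin.suc v) = there (At-tabulate (f ∘ Fin.suc) v)

  -- occurrence κ r w is the position in w of the letter κ that is preceded by r
  -- other letters κ; if there is none, it is the length of w.
  occurrence : Fin m → ℕ → List (Fin m) → ℕ
  occurrence κ r [] = 0
  occurrence κ r (x ∷ w) with κ Fin.≟ x
  occurrence κ zero    (x ∷ w) | yes _ = 0
  occurrence κ (suc r) (x ∷ w) | yes _ = suc (occurrence κ r w)
  occurrence κ r       (x ∷ w) | no _  = suc (occurrence κ r w)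

  occurrence-< : ∀ (κ : Fin m) r w → r < count κ w → occurrence κ r w < length w
  occurrence-< κ r (x ∷ w) r< with κ Fin.≟ x
  occurrence-< κ zero    (x ∷ w) r<       | yes _ = s≤s z≤n
  occurrence-< κ (suc r) (x ∷ w) (s≤s r<) | yes _ = s≤s (occurrence-< κ r w r<)
  occurrence-< κ r       (x ∷ w) r<       | no _  = s≤s (occurrence-< κ r w r<)

  occurrence-At : ∀ (κ : Fin m) r w → r < count κ w → At w (occurrence κ r w) κ
  occurrence-At κ r (x ∷ w) r< with κ Fin.≟ x
  occurrence-At κ zero    (x ∷ w) r<       | yes refl = here
  occurrence-At κ (suc r) (x ∷ w) (s≤s r<) | yes _ = there (occurrence-At κ r w r<)
  occurrence-At κ r       (x ∷ w) r<       | no _  = there (occurrence-At κ r w r<)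

  occurrence-mono : ∀ (κ : Fin m) {r r′} w → r < r′ → r < count κ w → occurrence κ r w < occurrence κ r′ w
  occurrence-mono κ (x ∷ w) r<r′ r< with κ Fin.≟ x
  occurrence-mono κ {zero}  {suc r′} (x ∷ w) _          _        | yes _ = s≤s z≤n
  occurrence-mono κ {suc r} {suc r′} (x ∷ w) (s≤s r<r′) (s≤s r<) | yes _ = s≤s (occurrence-mono κ w r<r′ r<)
  occurrence-mono κ (x ∷ w) r<r′ r< | no _ = s≤s (occurrence-mono κ w r<r′ r<)

  occurrence-++-< : ∀ (κ : Fin m) r u v → r < count κ u → occurrence κ r (u ++ v) < length u
  occurrence-++-< κ r (x ∷ u) v r< with κ Fin.≟ x
  occurrence-++-< κ zero    (x ∷ u) v r<       | yes _ = s≤s z≤n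
  occurrence-++-< κ (suc r) (x ∷ u) v (s≤s r<) | yes _ = s≤s (occurrence-++-< κ r u v r<)
  occurrence-++-< κ r       (x ∷ u) v r<       | no _  = s≤s (occurrence-++-< κ r u v r<)

  occurrence-++-≥ : ∀ (κ : Fin m) r u v → count κ u ≤ r → length u ≤ occurrence κ r (u ++ v)
  occurrence-++-≥ κ r []      v ≤r = z≤n
  occurrence-++-≥ κ r (x ∷ u) v ≤r with κ Fin.≟ x
  occurrence-++-≥ κ (suc r) (x ∷ u) v (s≤s ≤r) | yes _ = s≤s (occurrence-++-≥ κ r u v ≤r)
  occurrence-++-≥ κ r       (x ∷ u) v ≤r       | no _  = s≤s (occurrence-++-≥ κ r u v ≤r)

  count-tabulate : ∀ {N} (κ : Fin m) (f : Fin N → Fin m) → count κ (tabulate f) ≡ length (filter (λ p → κ Fin.≟ f p) (allFin N))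
  count-tabulate κ f = go κ f id
    where
    go : ∀ {n} {A : Set} (κ : Fin m) (f : A → Fin m) (g : Fin n → A) →
      count κ (tabulate (f ∘ g)) ≡ length (filter (λ p → κ Fin.≟ f p) (tabulate g))
    go {n = zero}  κ f g = refl
    go {n = suc n} κ f g with κ Fin.≟ f (g Fin.zero)
    ... | yes _ = cong suc (go κ f (g ∘ Fin.suc))
    ... | no _  = go κ f (g ∘ Fin.suc)

  -- A missed value could be punched out, and f would then inject `Fin (suc n)` into `Fin n`.
  injective⇒surjective : ∀ {n} (f : Fin n → Fin n) → (∀ {i j} → f i ≡ f j → i ≡ j) → ∀ v → ∃[ i ] f i ≡ v
  injective⇒surjective {suc n} f injective v with Fin.any? (λ i → f i Fin.≟ v)
  ... | yes hit = hit
  ... | no miss = contradiction (Fin.injective⇒≤ {f = λ i → Fin.punchOut (avoid i)} λ {i} {j} eq → injective (Fin.punchOut-injective (avoid i) (avoid j) eq)) (ℕ.<-irrefl refl)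
    where
    avoid : ∀ i → v ≢ f i
    avoid i eq = miss (i , sym eq)

  -- A partition of Fin N into chains: p is the element number rank p of the
  -- chain cls p, and the chain κ has l κ elements.
  record Chains {N m : ℕ} (cls : Fin N → Fin m) (rank : Fin N → ℕ) (l : Fin m → ℕ) : Set where
    field
      rank-<         : ∀ p → rank p < l (cls p)
      rank-injective : ∀ {p q} → cls p ≡ cls q → rank p ≡ rank q → p ≡ q
      rank-onto      : ∀ κ {r} → r < l κ → ∃[ p ] cls p ≡ κ × rank p ≡ r

    -- `rank` is a bijection from the chain κ onto the numbers below `l κ`; each of the two
    -- inequalities uses one direction.
    count-chain : ∀ κ → count κ (tabulate cls) ≡ l κ
    count-chain κ = trans (count-tabulate κ cls) (ℕ.≤-antisym
      (ℕ.≤-trans (length-≤ (λ p r → rank p ≡ r) (Unique.filter⁺ (λ p → κ Fin.≟ cls p) (Unique.allFin⁺ N))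
          (λ {p} p∈ → rank p , ∈-upTo⁺ (subst (λ κ → rank p < l κ) (sym (cls-of p∈)) (rank-< p)) , refl)
          (λ p∈ q∈ p≡ q≡ → rank-injective (trans (sym (cls-of p∈)) (cls-of q∈)) (trans p≡ (sym q≡))))
        (ℕ.≤-reflexive (List.length-upTo (l κ))))
      (ℕ.≤-trans (ℕ.≤-reflexive (sym (List.length-upTo (l κ))))
        (length-≤ (λ r p → rank p ≡ r) (Unique.upTo⁺ (l κ))
          (λ {r} r∈ → let p , cls≡ , rank≡ = rank-onto κ (∈-upTo⁻ r∈) in p , ∈-filter⁺ (λ p → κ Fin.≟ cls p) (∈-allFin p) (sym cls≡) , rank≡)
          (λ _ _ r≡ r′≡ → trans (sym r≡) r′≡))))
      where
      cls-of : ∀ {p} → p ∈ filter (λ p → κ Fin.≟ cls p) (allFin N) → κ ≡ cls p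
      cls-of p∈ = proj₂ (∈-filter⁻ (λ p → κ Fin.≟ cls p) {xs = allFin N} p∈)

    total : Σℕ.sum l ≡ N
    total = trans (Σℕ.sum-cong-≗ (λ κ → sym (count-chain κ))) (trans (sym (length-count (tabulate cls))) (List.length-tabulate cls))

  chains-∘ : ∀ {N m} {cls : Fin N → Fin m} {rank l} → Chains cls rank l → (g h : Fin N → Fin N) →
    (∀ p → g (h p) ≡ p) → (∀ p → h (g p) ≡ p) → Chains (cls ∘ g) (rank ∘ g) l
  chains-∘ {cls = cls} {rank} ch g h gh hg = record
    { rank-<         = λ p → rank-< (g p)
    ; rank-injective = λ {p} {q} c≡ r≡ → trans (sym (hg p)) (trans (cong h (rank-injective c≡ r≡)) (hg q))
    ; rank-onto      = λ κ r< → let p , c≡ , r≡ = rank-onto κ r< in h p , trans (cong cls (gh p)) c≡ , trans (cong rank (gh p)) r≡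
    }
    where open Chains ch

  Reads : ∀ {N m} → (Fin N → Fin m) → List (Fin m) → (Fin N → Fin N) → Set
  Reads {N} cls w f = length w ≡ N × (∀ p → At w (toℕ (f p)) (cls p))

  module _ {N m : ℕ} {cls : Fin N → Fin m} {rank : Fin N → ℕ} {l : Fin m → ℕ} (chains : Chains cls rank l) where
    open Chains chains

    Increasing : (Fin N → Fin N) → Set
    Increasing f = ∀ {p q} → cls p ≡ cls q → rank p < rank q → f p Fin.< f q

    word-of : ∀ f → (∀ {p q} → f p ≡ f q → p ≡ q) → ∃[ w ] w ∈ arrangements N l × Reads cls w f
    word-of f injective = w , subst (λ n → w ∈ arrangements n l) len (∈-arrangements⁺ l w (Chains.count-chain (chains-∘ chains g f gf fg)))
      , len , λ p → subst (At w (toℕ (f p))) (cong cls (gf p)) (At-tabulate (cls ∘ g) (f p))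
      where
      g : Fin N → Fin N
      g v = proj₁ (injective⇒surjective f injective v)
      fg : ∀ v → f (g v) ≡ v
      fg v = proj₂ (injective⇒surjective f injective v)
      gf : ∀ p → g (f p) ≡ p
      gf p = injective (fg (f p))
      w = tabulate (cls ∘ g)
      len : length w ≡ N
      len = List.length-tabulate (cls ∘ g)

    -- At the smallest value where f and f′ differ they take elements p ≠ p′ of
    -- the same chain, and the smaller of the two was due earlier.
    filling-unique : ∀ f f′ → (∀ {p q} → f p ≡ f q → p ≡ q) → (∀ {p q} → f′ p ≡ f′ q → p ≡ q) →
      Increasing f → Increasing f′ → ∀ w → Reads cls w f → Reads cls w f′ → ∀ p → f p ≡ f′ p
    filling-unique f f′ injective injective′ inc inc′ w (_ , at) (_ , at′) p = from-hit (injective⇒surjective f′ injective′ (f p))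
      where
      agree : ∀ n {p p′} → f p ≡ f′ p′ → toℕ (f p) < n → p ≡ p′
      agree (suc n) {p} {p′} eq (s≤s fp≤n) = compare (ℕ.<-cmp (rank p) (rank p′))
        where
        same : cls p ≡ cls p′
        same = At-functional (at p) (subst (λ v → At w (toℕ v) (cls p′)) (sym eq) (at′ p′))
        compare : _ → p ≡ p′
        compare (tri≈ _ r≡ _) = rank-injective same r≡
        compare (tri< r< _ _) = contradiction (subst (Fin._< f p) (trans (sym (proj₂ hit)) (cong f q≡p)) f′p<) (ℕ.<-irrefl refl)
          where
          f′p< : f′ p Fin.< f p
          f′p< = subst (f′ p Fin.<_) (sym eq) (inc′ same r<)
          hit = injective⇒surjective f injective (f′ p)
          q≡p : proj₁ hit ≡ p
          q≡p = agree n (proj₂ hit) (ℕ.<-≤-trans (subst (Fin._< f p) (sym (proj₂ hit)) f′p<) fp≤n)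
        compare (tri> _ _ r>) = contradiction (subst (Fin._< f p) (trans (sym (proj₂ hit)) (trans (cong f′ (sym p′≡q)) (sym eq))) fp′<) (ℕ.<-irrefl refl)
          where
          fp′< : f p′ Fin.< f p
          fp′< = inc (sym same) r>
          hit = injective⇒surjective f′ injective′ (f p′)
          p′≡q : p′ ≡ proj₁ hit
          p′≡q = agree n (sym (proj₂ hit)) (ℕ.<-≤-trans fp′< fp≤n)
      from-hit : (∃[ p′ ] f′ p′ ≡ f p) → f p ≡ f′ p
      from-hit (p′ , eq) = trans (sym eq) (cong f′ (sym (agree (suc (toℕ (f p))) (sym eq) ℕ.≤-refl)))

    module _ (w : List (Fin m)) (content : ∀ κ → count κ w ≡ l κ) where

      private
        rank-<-count : ∀ p → rank p < count (cls p) w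
        rank-<-count p = subst (rank p <_) (sym (content (cls p))) (rank-< p)

        length≡ : length w ≡ N
        length≡ = trans (length-count w) (trans (Σℕ.sum-cong-≗ content) total)

        position-< : ∀ p → occurrence (cls p) (rank p) w < N
        position-< p = subst (occurrence (cls p) (rank p) w <_) length≡ (occurrence-< (cls p) (rank p) w (rank-<-count p))

      filling-of : Fin N → Fin N
      filling-of p = Fin.fromℕ< (position-< p)

      private
        toℕ-filling : ∀ p → toℕ (filling-of p) ≡ occurrence (cls p) (rank p) w
        toℕ-filling p = Fin.toℕ-fromℕ< (position-< p)

        filling-< : ∀ {p q} → occurrence (cls p) (rank p) w < occurrence (cls q) (rank q) w → filling-of p Fin.< filling-of q
        filling-< {p} {q} = subst₂ _<_ (sym (toℕ-filling p)) (sym (toℕ-filling q))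

      filling-reads : Reads cls w filling-of
      filling-reads = length≡ , λ p → subst (λ v → At w v (cls p)) (sym (toℕ-filling p)) (occurrence-At (cls p) (rank p) w (rank-<-count p))

      filling-increasing : Increasing filling-of
      filling-increasing {p} {q} c≡ r< = filling-< (subst (λ κ → occurrence (cls p) (rank p) w < occurrence κ (rank q) w) c≡
        (occurrence-mono (cls p) w r< (rank-<-count p)))

      filling-injective : ∀ {p q} → filling-of p ≡ filling-of q → p ≡ q
      filling-injective {p} {q} eq = compare (ℕ.<-cmp (rank p) (rank q))
        where
        same : cls p ≡ cls q
        same = At-functional (proj₂ filling-reads p) (subst (λ v → At w (toℕ v) (cls q)) (sym eq) (proj₂ filling-reads q))
        compare : _ → p ≡ q
        compare (tri≈ _ r≡ _) = rank-injective same r≡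
        compare (tri< r< _ _) = contradiction (cong toℕ eq) (ℕ.<⇒≢ (filling-increasing same r<))
        compare (tri> _ _ r>) = contradiction (cong toℕ (sym eq)) (ℕ.<⇒≢ (filling-increasing (sym same) r>))

      -- This orders elements of different chains: a prefix of the word that already contains p and
      -- does not yet contain q suffices, whatever the order of the letters inside the prefix.
      filling-split : ∀ {p q} u v → w ≡ u ++ v → rank p < count (cls p) u → count (cls q) u ≤ rank q → filling-of p Fin.< filling-of q
      filling-split {p} {q} u v eq p<u u≤q = filling-< (subst (λ w → occurrence (cls p) (rank p) w < occurrence (cls q) (rank q) w) (sym eq)
        (ℕ.<-≤-trans (occurrence-++-< (cls p) (rank p) u v p<u) (occurrence-++-≥ (cls q) (rank q) u v u≤q)))

  reads-unique : ∀ {N m} {cls : Fin N → Fin m} {w w′} f → (∀ {p q} → f p ≡ f q → p ≡ q) → Reads cls w f → Reads cls w′ f → w ≡ w′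
  reads-unique {cls = cls} {w} {w′} f injective (len , at) (len′ , at′) = At-ext w w′ (trans len (sym len′)) λ v v< →
    let i = Fin.fromℕ< (subst (v <_) len v<)
        p , fp≡i = injective⇒surjective f injective i
        v≡ : toℕ (f p) ≡ v
        v≡ = trans (cong toℕ fp≡i) (Fin.toℕ-fromℕ< (subst (v <_) len v<))
    in cls p , subst (λ v → At w v (cls p)) v≡ (at p) , subst (λ v → At w′ v (cls p)) v≡ (at′ p)

  -- Words composed of blocks

  length-cartesianProductWith : ∀ {C : Set} (f : A → B → C) xs ys → length (cartesianProductWith f xs ys) ≡ length xs * length ys
  length-cartesianProductWith f []       ys = refl
  length-cartesianProductWith f (x ∷ xs) ys = trans (List.length-++ (map (f x) ys))
    (cong₂ _+_ (List.length-map (f x) ys) (length-cartesianProductWith f xs ys))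

  ++-cancel-length : ∀ (u u′ : List A) {v v′} → length u ≡ length u′ → u ++ v ≡ u′ ++ v′ → u ≡ u′ × v ≡ v′
  ++-cancel-length []      []        _   eq = refl , eq
  ++-cancel-length (x ∷ u) (x′ ∷ u′) len eq
    with u≡ , v≡ ← ++-cancel-length u u′ (ℕ.suc-injective len) (List.∷-injectiveʳ eq) = cong₂ _∷_ (List.∷-injectiveˡ eq) u≡ , v≡

  -- All left factors have the same length n, so a product determines where it is to be cut.
  products-unique : ∀ {n} {us vs : List (List A)} → Unique us → Unique vs → (∀ {u} → u ∈ us → length u ≡ n) →
    Unique (cartesianProductWith _++_ us vs)
  products-unique {us = []}     {vs} []              vs! len = []
  products-unique {us = u ∷ us} {vs} (u∉us ∷ us!) vs! len = Unique.++⁺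
    (Unique.map⁺ (List.++-cancelˡ u _ _) vs!)
    (products-unique us! vs! (len ∘ there))
    disjoint
    where
    disjoint : ∀ {w} → w ∈ map (u ++_) vs × w ∈ cartesianProductWith _++_ us vs → _
    disjoint (w∈ , w∈′) with v , _ , eq ← ∈-map⁻ (u ++_) w∈ | u′ , v′ , u′∈ , _ , eq′ ← ∈-cartesianProductWith⁻ _++_ us vs w∈′ =
      contradiction (proj₁ (++-cancel-length u u′ (trans (len (here refl)) (sym (len (there u′∈)))) (trans (sym eq) eq′))) (All.lookup u∉us u′∈)

  -- Words in which every letter κ has occurred C b κ times by the end of block b.
  -- In each block an arbitrary arrangement of q b follows a fixed word.
  module BlockWords {m : ℕ} (C q : ℕ → Fin m → ℕ) (C-zero : ∀ κ → C 0 κ ≡ 0)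
                    (C-step : ∀ b κ → C b κ + q b κ ≤ C (suc b) κ) where

    private
      filler : ℕ → Fin m → ℕ
      filler b κ = C (suc b) κ ℕ.∸ (C b κ + q b κ)

      fixed : ℕ → List (Fin m)
      fixed b = proj₁ (arrangements-nonempty (filler b))

      count-fixed : ∀ b κ → count κ (fixed b) ≡ filler b κ
      count-fixed b = proj₂ (∈-arrangements⁻ (Σℕ.sum (filler b)) (filler b) refl (proj₂ (arrangements-nonempty (filler b))))

    block : ℕ → List (List (Fin m))
    block b = map (fixed b ++_) (arrangements (Σℕ.sum (q b)) (q b))

    blockWords : ℕ → List (List (Fin m))
    blockWords zero    = [] ∷ []
    blockWords (suc b) = cartesianProductWith _++_ (blockWords b) (block b)

    count-blockWords : ∀ b {w} → w ∈ blockWords b → ∀ κ → count κ w ≡ C b κ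
    count-blockWords zero    (here refl) κ = sym (C-zero κ)
    count-blockWords (suc b) w∈ κ
      with u , v , u∈ , v∈ , refl ← ∈-cartesianProductWith⁻ _++_ (blockWords b) (block b) w∈
      with v′ , v′∈ , refl ← ∈-map⁻ (fixed b ++_) v∈ = begin-equality
      count κ (u ++ fixed b ++ v′)                   ≡⟨ trans (count-++ κ u _) (cong (count κ u +_) (count-++ κ (fixed b) v′)) ⟩
      count κ u + (count κ (fixed b) + count κ v′)   ≡⟨ cong₂ _+_ (count-blockWords b u∈ κ) (cong₂ _+_ (count-fixed b κ)
                                                         (proj₂ (∈-arrangements⁻ (Σℕ.sum (q b)) (q b) refl v′∈) κ)) ⟩
      C b κ + (filler b κ + q b κ)                   ≡⟨ solve 3 (λ c f q → c :+ (f :+ q) := (c :+ q) :+ f) refl (C b κ) (filler b κ) (q b κ) ⟩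
      (C b κ + q b κ) + filler b κ                   ≡⟨ ℕ.m+[n∸m]≡n (C-step b κ) ⟩
      C (suc b) κ                                    ∎

    blockWords-unique : ∀ b → Unique (blockWords b)
    blockWords-unique zero    = [] ∷ []
    blockWords-unique (suc b) = products-unique (blockWords-unique b)
      (Unique.map⁺ (List.++-cancelˡ (fixed b) _ _) (arrangements-unique (Σℕ.sum (q b)) (q b)))
      (λ {u} u∈ → trans (length-count u) (Σℕ.sum-cong-≗ (count-blockWords b u∈)))

    blockWords-split : ∀ L {w} → w ∈ blockWords L → ∀ b → b ≤ L → ∃[ u ] ∃[ v ] w ≡ u ++ v × (∀ κ → count κ u ≡ C b κ)
    blockWords-split L {w} w∈ b b≤L with ℕ.m≤n⇒m<n∨m≡n b≤L
    ... | inj₂ refl = w , [] , sym (List.++-identityʳ w) , count-blockWords L w∈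
    blockWords-split (suc L) w∈ b _ | inj₁ (s≤s b≤L)
      with u , v , u∈ , _ , refl ← ∈-cartesianProductWith⁻ _++_ (blockWords L) (block L) w∈
      with u₁ , u₂ , refl , count-u₁ ← blockWords-split L u∈ b b≤L = u₁ , u₂ ++ v , List.++-assoc u₁ u₂ v , count-u₁

    length-blockWords : ∀ b → length (blockWords (suc b)) ≡ length (blockWords b) * multinomial (q b)
    length-blockWords b = trans (length-cartesianProductWith _++_ (blockWords b) (block b))
      (cong (length (blockWords b) *_) (List.length-map (fixed b ++_) (arrangements (Σℕ.sum (q b)) (q b))))

    private
      1≤length : ∀ {xs : List A} {x} → x ∈ xs → 1 ≤ length xs
      1≤length (here _)  = s≤s z≤n
      1≤length (there _) = s≤s z≤n

      length-mono : ∀ b → length (blockWords b) ≤ length (blockWords (suc b))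
      length-mono b = begin
        length (blockWords b)                        ≡⟨ ℕ.*-identityʳ _ ⟨
        length (blockWords b) * 1                    ≤⟨ ℕ.*-monoʳ-≤ (length (blockWords b)) (1≤length (proj₂ (arrangements-nonempty (q b)))) ⟩
        length (blockWords b) * multinomial (q b)    ≡⟨ length-blockWords b ⟨
        length (blockWords (suc b))                  ∎

      length-mono-+ : ∀ b j → length (blockWords b) ≤ length (blockWords (j + b))
      length-mono-+ b zero    = ℕ.≤-refl
      length-mono-+ b (suc j) = ℕ.≤-trans (length-mono-+ b j) (length-mono (j + b))

    -- Each of the B blocks from number s on contributes a factor `multinomial q₀`, and every other
    -- block at least 1, since arrangements of any content exist.
    length-blockWords-≥ : ∀ s B q₀ → (∀ j → j < B → q (j + s) ≡ q₀) → ∀ j → multinomial q₀ ^ B ≤ length (blockWords (j + (B + s)))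
    length-blockWords-≥ s B q₀ active j = ℕ.≤-trans (phase B active) (length-mono-+ (B + s) j)
      where
      phase : ∀ B → (∀ j → j < B → q (j + s) ≡ q₀) → multinomial q₀ ^ B ≤ length (blockWords (B + s))
      phase zero    _      = ℕ.≤-trans (length-mono-+ 0 s) (ℕ.≤-reflexive (cong (length ∘ blockWords) (ℕ.+-identityʳ s)))
      phase (suc B) active = begin
        multinomial q₀ * multinomial q₀ ^ B                        ≡⟨ ℕ.*-comm (multinomial q₀) _ ⟩
        multinomial q₀ ^ B * multinomial q₀                        ≤⟨ ℕ.*-monoˡ-≤ (multinomial q₀) (phase B (λ j j<B → active j (ℕ.m<n⇒m<1+n j<B))) ⟩
        length (blockWords (B + s)) * multinomial q₀               ≡⟨ cong (λ q → length (blockWords (B + s)) * multinomial q) (active B ℕ.≤-refl) ⟨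
        length (blockWords (B + s)) * multinomial (q (B + s))      ≡⟨ length-blockWords (B + s) ⟨
        length (blockWords (suc B + s))                            ∎

-- Partitions, their conjugates and Frobenius coordinates

module Partitions where

  open import Defs hiding (_≤_; _<_; _+_; _*_; _-_; -_; ∣_∣; _≈_)
  open Words using (length-≤)
  open import Data.Bool.Base using (true; false; T)
  open import Data.Fin.Base as Fin using (Fin; toℕ)
  import Data.Fin.Properties as Fin
  open import Data.List.Base as List using (upTo)
  import Data.List.Properties as List
  open import Data.List.Membership.Propositional using (_∈_)
  open import Data.List.Membership.Propositional.Properties
  open import Data.List.Relation.Unary.All as All using (All)
  import Data.List.Relation.Unary.All.Properties as All
  open import Data.List.Relation.Unary.Any as Any using ()
  import Data.List.Relation.Unary.Any.Properties as Any
  import Data.List.Relation.Unary.Unique.Propositional.Properties as Unique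
  open import Data.Nat.Base as ℕ using (ℕ; zero; suc; _+_; _≤_; _<_; z≤n; s≤s)
  import Data.Nat.Properties as ℕ
  open import Data.Product.Base using (∃-syntax; _×_; _,_; proj₂)
  open import Data.Sum.Base using (inj₁; inj₂)
  open import Relation.Binary.Definitions using (tri<; tri≈; tri>)
  open import Relation.Binary.PropositionalEquality
  open import Relation.Nullary using (yes; no; ¬_; contradiction)
  open import Relation.Unary using (Decidable)

  part-antitone : ∀ ν {i j} → i ≤ j → part ν j ≤ part ν i
  part-antitone ν {i} i≤j with d , refl ← ℕ.m≤n⇒∃[o]m+o≡n i≤j = go d
    where
    go : ∀ d → part ν (i + d) ≤ part ν i
    go zero    = ℕ.≤-reflexive (cong (part ν) (ℕ.+-identityʳ i))
    go (suc d) = ℕ.≤-trans (ℕ.≤-reflexive (cong (part ν) (ℕ.+-suc i d))) (ℕ.≤-trans (decreasing ν (i + d)) (go d))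

  part>0⇒<bound : ∀ ν {i j} → j < part ν i → i < bound ν
  part>0⇒<bound ν {i} {j} j< with i ℕ.<? bound ν
  ... | yes i< = i<
  ... | no i≮  = contradiction (subst (j <_) (vanishes ν i (ℕ.≮⇒≥ i≮)) j<) λ ()

  -- Parts decrease, so the rows counted by `conjugatePart ν j` form an initial segment, and it
  -- contains row i exactly when (i , j) is a cell. The converse follows below.
  <part⇒<conjugatePart : ∀ ν {i j} → j < part ν i → i < conjugatePart ν j
  <part⇒<conjugatePart ν {i} {j} j< = ℕ.≤-trans (ℕ.≤-reflexive (sym (List.length-upTo (suc i))))
    (length-≤ _≡_ (Unique.upTo⁺ (suc i))
      (λ {x} x∈ → let x≤i = ℕ.≤-pred (∈-upTo⁻ x∈) ; j<x = ℕ.<-≤-trans j< (part-antitone ν x≤i) in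
        x , ∈-filter⁺ (λ i → j ℕ.<? part ν i) (∈-upTo⁺ (part>0⇒<bound ν j<x)) j<x , refl)
      (λ _ _ x≡ x′≡ → trans x≡ (sym x′≡)))

  <conjugatePart⇒<part : ∀ ν {i j} → i < conjugatePart ν j → j < part ν i
  <conjugatePart⇒<part ν {i} {j} i< with j ℕ.<? part ν i
  ... | yes j< = j<
  ... | no j≮ = contradiction i< (ℕ.≤⇒≯ (ℕ.≤-trans
    (length-≤ _≡_ (Unique.filter⁺ (λ i → j ℕ.<? part ν i) (Unique.upTo⁺ (bound ν)))
      (λ {x} x∈ → x , ∈-upTo⁺ (below (proj₂ (∈-filter⁻ (λ i → j ℕ.<? part ν i) {xs = upTo (bound ν)} x∈))) , refl)
      (λ _ _ x≡ x′≡ → trans x≡ (sym x′≡)))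
    (ℕ.≤-reflexive (List.length-upTo i))))
    where
    below : ∀ {x} → j < part ν x → x < i
    below j<x = ℕ.≰⇒> λ i≤x → j≮ (ℕ.<-≤-trans j<x (part-antitone ν i≤x))

  -- With `conjugatePart≤` this forms an antitone Galois connection, from which monotonicity in the
  -- column and in the partition follows without further counting.
  ≤conjugatePart : ∀ ν {i j} → conjugatePart ν j ≤ i → part ν i ≤ j
  ≤conjugatePart ν h = ℕ.≮⇒≥ λ j< → ℕ.≤⇒≯ h (<part⇒<conjugatePart ν j<)

  conjugatePart≤ : ∀ ν {i j} → part ν i ≤ j → conjugatePart ν j ≤ i
  conjugatePart≤ ν h = ℕ.≮⇒≥ λ i< → ℕ.≤⇒≯ h (<conjugatePart⇒<part ν i<)

  conjugatePart-antitone : ∀ ν {i j} → i ≤ j → conjugatePart ν j ≤ conjugatePart ν i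
  conjugatePart-antitone ν {i} {j} i≤j = conjugatePart≤ ν (ℕ.≤-trans (≤conjugatePart ν ℕ.≤-refl) i≤j)

  conjugatePart-⊆ : ∀ {ν ν′} → (∀ i → part ν i ≤ part ν′ i) → ∀ j → conjugatePart ν j ≤ conjugatePart ν′ j
  conjugatePart-⊆ {ν} {ν′} ν⊆ν′ j = conjugatePart≤ ν (ℕ.≤-trans (ν⊆ν′ (conjugatePart ν′ j)) (≤conjugatePart ν′ ℕ.≤-refl))

  largest-≥ : ∀ {P : ℕ → Set} (P? : Decidable P) n {d} → d ≤ n → P d → d ≤ largest P? n
  largest-≥ P? zero    d≤n Pd = d≤n
  largest-≥ P? (suc n) {d} d≤n Pd with P? (suc n) | ℕ.m≤n⇒m<n∨m≡n d≤n
  ... | yes _ | _                = d≤n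
  ... | no _  | inj₁ (s≤s d≤n′)  = largest-≥ P? n d≤n′ Pd
  ... | no ¬P | inj₂ refl        = contradiction Pd ¬P

  diagonal⇒<durfee : ∀ ν {i} → i < part ν i → i < durfee ν
  diagonal⇒<durfee ν {i} i< = largest-≥ (squareFits? ν) (bound ν) (part>0⇒<bound ν i<)
    λ { (s≤s x≤i) (s≤s y≤i) → ℕ.≤-<-trans y≤i (ℕ.<-≤-trans i< (part-antitone ν x≤i)) }

  -- Outside the Durfee square the coordinate is 0 by convention; there the diagonal cell (i , i) is
  -- missing, so the part is at most i.
  frobeniusᵃ-close : ∀ ν i → frobeniusᵃ ν i ≤ part ν i × part ν i ≤ frobeniusᵃ ν i + suc i
  frobeniusᵃ-close ν i with i ℕ.<ᵇ durfee ν in eq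
  ... | true  = ℕ.m∸n≤m (part ν i) (suc i) , ℕ.≤-trans (ℕ.m≤n+m∸n (part ν i) (suc i)) (ℕ.≤-reflexive (ℕ.+-comm (suc i) _))
  ... | false = z≤n , ℕ.≤-trans (ℕ.≮⇒≥ (λ i< → subst T eq (ℕ.<⇒<ᵇ (diagonal⇒<durfee ν i<)))) (ℕ.n≤1+n i)

  frobeniusᵇ-close : ∀ ν i → frobeniusᵇ ν i ≤ conjugatePart ν i × conjugatePart ν i ≤ frobeniusᵇ ν i + suc i
  frobeniusᵇ-close ν i with i ℕ.<ᵇ durfee ν in eq
  ... | true  = ℕ.m∸n≤m (conjugatePart ν i) (suc i) , ℕ.≤-trans (ℕ.m≤n+m∸n (conjugatePart ν i) (suc i)) (ℕ.≤-reflexive (ℕ.+-comm (suc i) _))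
  ... | false = z≤n , ℕ.≤-trans (ℕ.≮⇒≥ (λ i< → subst T eq (ℕ.<⇒<ᵇ (diagonal⇒<durfee ν (<conjugatePart⇒<part ν i<))))) (ℕ.n≤1+n i)

  cell-∈ : ∀ υ p → cell υ p ∈ₛ υ
  cell-∈ υ p = All.lookup all-cells (∈-lookup p)
    where
    all-cells : All (_∈ₛ υ) (cells υ)
    all-cells = All.concat⁺ (All.applyUpTo⁺₂ (rowCells υ) (bound (outer υ)) λ i →
      All.applyUpTo⁺₁ _ _ λ {t} t< → ℕ.m≤m+n (part (inner υ) i) t ,
        ℕ.<-≤-trans (ℕ.+-monoʳ-< (part (inner υ) i) t<) (ℕ.≤-reflexive (ℕ.m+[n∸m]≡n (inner⊆outer υ i))))

  cell-onto : ∀ υ {c} → c ∈ₛ υ → ∃[ p ] cell υ p ≡ c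
  cell-onto υ {i , j} (μ≤j , j<λ) = Any.index c∈ , sym (Any.lookup-index c∈)
    where
    μ = part (inner υ) i
    ∈-row : (i , j) ∈ rowCells υ i
    ∈-row = subst (λ j → (i , j) ∈ rowCells υ i) (ℕ.m+[n∸m]≡n μ≤j) (∈-applyUpTo⁺ (λ t → i , μ + t) (ℕ.∸-monoˡ-< j<λ μ≤j))
    c∈ : (i , j) ∈ cells υ
    c∈ = ∈-concat⁺′ ∈-row (∈-applyUpTo⁺ (rowCells υ) (part>0⇒<bound (outer υ) j<λ))

  ⊏-irrefl : ∀ {c} → ¬ (c ⊏ c)
  ⊏-irrefl (inj₁ r<)       = ℕ.<-irrefl refl r<
  ⊏-irrefl (inj₂ (_ , c<)) = ℕ.<-irrefl refl c<

  cell-injective : ∀ υ {p q} → cell υ p ≡ cell υ q → p ≡ q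
  cell-injective υ {p} {q} eq with ℕ.<-cmp (toℕ p) (toℕ q)
  ... | tri≈ _ p≡q _ = Fin.toℕ-injective p≡q
  ... | tri< p<q _ _ = contradiction (subst (_⊏ cell υ q) eq (lookup-< (cells-sorted υ) p<q)) ⊏-irrefl
  ... | tri> _ _ q<p = contradiction (subst (cell υ q ⊏_) eq (lookup-< (cells-sorted υ) q<p)) ⊏-irrefl

-- Skew shapes cut into chains

module SkewShapes where

  open import Defs hiding (_≤_; _<_; _+_; _*_; _-_; -_; ∣_∣; _≈_)
  open Words
  open Partitions
  import Algebra.Properties.CommutativeMonoid.Sum as Sum
  open import Data.Fin.Base as Fin using (Fin; toℕ; splitAt; join; fromℕ<)
  import Data.Fin.Properties as Fin
  open import Data.List.Base as List using (List; _++_; length; filter; allFin)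
  open import Data.List.Membership.Propositional using (_∈_)
  open import Data.List.Membership.Propositional.Properties
  import Data.List.Relation.Unary.All as All
  open import Data.List.Relation.Unary.AllPairs using ([]; _∷_)
  open import Data.List.Relation.Unary.Unique.Propositional using (Unique)
  import Data.List.Relation.Unary.Unique.Propositional.Properties as Unique
  open import Data.Nat.Base as ℕ using (ℕ; zero; suc; _+_; _*_; _∸_; _^_; _⊔_; _⊓_; _/_; _≤_; _<_; z≤n)
  import Data.Nat.DivMod as ℕ
  import Data.Nat.Properties as ℕ
  open import Data.Nat.Solver using (module +-*-Solver)
  open import Data.Product.Base using (∃-syntax; _×_; _,_; proj₁; proj₂)
  open import Data.Product.Properties using (,-injectiveˡ; ,-injectiveʳ)
  open import Data.Sum.Base using (_⊎_; inj₁; inj₂)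
  open import Data.Vec.Base as Vec using (Vec)
  import Data.Vec.Properties as Vec
  open import Relation.Binary.PropositionalEquality
  open import Relation.Nullary using (yes; no; contradiction)
  open ℕ.≤-Reasoning hiding (start)
  open +-*-Solver using (solve; _:=_; _:+_; _:*_)
  private
    module Σℕ = Sum ℕ.+-0-commutativeMonoid
    module Πℕ = Sum ℕ.*-1-commutativeMonoid

  -- A discrete intermediate value theorem. It will find the stage in which a chain passes the
  -- coordinate x.
  crossing : ∀ (f : ℕ → ℕ) x n → f 0 ≤ x → x < f n → ∃[ j ] j < n × f j ≤ x × x < f (suc j)
  crossing f x zero    f0≤x x<fn = contradiction x<fn (ℕ.≤⇒≯ f0≤x)
  crossing f x (suc n) f0≤x x<fn with ℕ.≤-<-connex (f n) x
  ... | inj₁ fn≤x = n , ℕ.≤-refl , fn≤x , x<fn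
  ... | inj₂ x<f with j , j<n , fj≤x , x<fj ← crossing f x n f0≤x x<f = j , ℕ.m<n⇒m<1+n j<n , fj≤x , x<fj

  -- A skew shape inside a fat hook is cut into chains: the row i < k, and the part
  -- of the column j < k below row k. On each chain x is the remaining coordinate.
  module SkewChains (k : ℕ) (υ : SkewShape) (d≤k : durfee (outer υ) ≤ k) where

    Chain : Set
    Chain = Fin k ⊎ Fin k

    index : Chain → ℕ
    index (inj₁ i) = toℕ i
    index (inj₂ j) = toℕ j

    index<k : ∀ κ → index κ < k
    index<k (inj₁ i) = Fin.toℕ<n i
    index<k (inj₂ j) = Fin.toℕ<n j

    -- Column chains are clamped at row k. A column of λ that does not reach below the first k rows
    -- becomes the empty chain, with both ends equal to k.
    start end : Chain → ℕ
    start (inj₁ i) = part (inner υ) (toℕ i)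
    start (inj₂ j) = conjugatePart (inner υ) (toℕ j) ⊔ k
    end   (inj₁ i) = part (outer υ) (toℕ i)
    end   (inj₂ j) = conjugatePart (outer υ) (toℕ j) ⊔ k

    at : Chain → ℕ → Cell
    at (inj₁ i) x = toℕ i , x
    at (inj₂ j) x = x , toℕ j

    start≤end : ∀ κ → start κ ≤ end κ
    start≤end (inj₁ i) = inner⊆outer υ (toℕ i)
    start≤end (inj₂ j) = ℕ.⊔-monoˡ-≤ k (conjugatePart-⊆ {inner υ} {outer υ} (inner⊆outer υ) (toℕ j))

    Located : Chain → ℕ → Set
    Located κ x = start κ ≤ x × x < end κ

    located-∈ : ∀ κ x → Located κ x → at κ x ∈ₛ υ
    located-∈ (inj₁ i) x loc = loc
    located-∈ (inj₂ j) x (s≤x , x<t) =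
      ≤conjugatePart (inner υ) (ℕ.≤-trans (ℕ.m≤m⊔n _ k) s≤x) ,
      <conjugatePart⇒<part (outer υ) (below (ℕ.⊔-sel (conjugatePart (outer υ) (toℕ j)) k))
      where
      below : conjugatePart (outer υ) (toℕ j) ⊔ k ≡ conjugatePart (outer υ) (toℕ j) ⊎ conjugatePart (outer υ) (toℕ j) ⊔ k ≡ k → x < conjugatePart (outer υ) (toℕ j)
      below (inj₁ eq) = subst (x <_) eq x<t
      below (inj₂ eq) = contradiction (subst (x <_) eq x<t) (ℕ.≤⇒≯ (ℕ.≤-trans (ℕ.m≤n⊔m _ k) s≤x))

    -- If both coordinates were at least k, the diagonal cell (k , k) would lie in λ, and the Durfee
    -- square would be larger than k × k.
    column<k : ∀ {i j} → k ≤ i → (i , j) ∈ₛ υ → j < k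
    column<k {i} {j} k≤i (_ , j<λ) = ℕ.≰⇒> λ k≤j → ℕ.≤⇒≯ d≤k
      (diagonal⇒<durfee (outer υ) (ℕ.≤-<-trans k≤j (ℕ.<-≤-trans j<λ (part-antitone (outer υ) k≤i))))

    locate : ∀ c → c ∈ₛ υ → ∃[ κ ] ∃[ x ] Located κ x × at κ x ≡ c
    locate (i , j) c∈ with i ℕ.<? k
    ... | yes i<k = inj₁ (fromℕ< i<k) , j , subst (λ i → part (inner υ) i ≤ j × j < part (outer υ) i) (sym (Fin.toℕ-fromℕ< i<k)) c∈
                  , cong (_, j) (Fin.toℕ-fromℕ< i<k)
    ... | no i≮k = inj₂ (fromℕ< j<k) , i
                 , (subst (λ j → conjugatePart (inner υ) j ⊔ k ≤ i) (sym (Fin.toℕ-fromℕ< j<k)) (ℕ.⊔-lub (conjugatePart≤ (inner υ) (proj₁ c∈)) k≤i)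
                 , subst (λ j → i < conjugatePart (outer υ) j ⊔ k) (sym (Fin.toℕ-fromℕ< j<k)) (ℕ.<-≤-trans (<part⇒<conjugatePart (outer υ) (proj₂ c∈)) (ℕ.m≤m⊔n _ k)))
                 , cong (i ,_) (Fin.toℕ-fromℕ< j<k)
      where
      k≤i = ℕ.≮⇒≥ i≮k
      j<k = column<k k≤i c∈

    column≥k : ∀ j {x} → Located (inj₂ j) x → k ≤ x
    column≥k j (s≤x , _) = ℕ.≤-trans (ℕ.m≤n⊔m _ k) s≤x

    at-injective : ∀ κ κ′ {x x′} → Located κ x → Located κ′ x′ → at κ x ≡ at κ′ x′ → κ ≡ κ′ × x ≡ x′
    at-injective (inj₁ i) (inj₁ i′) _ _ eq = cong inj₁ (Fin.toℕ-injective (,-injectiveˡ eq)) , ,-injectiveʳ eq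
    at-injective (inj₂ j) (inj₂ j′) _ _ eq = cong inj₂ (Fin.toℕ-injective (,-injectiveʳ eq)) , ,-injectiveˡ eq
    at-injective (inj₁ i) (inj₂ j′) _ loc′ eq = contradiction (Fin.toℕ<n i) (ℕ.≤⇒≯ (subst (k ≤_) (sym (,-injectiveˡ eq)) (column≥k j′ loc′)))
    at-injective (inj₂ j) (inj₁ i′) loc _ eq = contradiction (Fin.toℕ<n i′) (ℕ.≤⇒≯ (subst (k ≤_) (,-injectiveˡ eq) (column≥k j loc)))

    private
      N = size υ

    chain : Fin N → Chain
    chain p = proj₁ (locate (cell υ p) (cell-∈ υ p))

    coordinate : Fin N → ℕ
    coordinate p = proj₁ (proj₂ (locate (cell υ p) (cell-∈ υ p)))

    located : ∀ p → Located (chain p) (coordinate p)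
    located p = proj₁ (proj₂ (proj₂ (locate (cell υ p) (cell-∈ υ p))))

    at≡cell : ∀ p → at (chain p) (coordinate p) ≡ cell υ p
    at≡cell p = proj₂ (proj₂ (proj₂ (locate (cell υ p) (cell-∈ υ p))))

    cls : Fin N → Fin (k + k)
    cls p = join k k (chain p)

    split : Fin (k + k) → Chain
    split κ = splitAt k κ

    split-cls : ∀ p → split (cls p) ≡ chain p
    split-cls p = Fin.splitAt-join k k (chain p)

    chain-cong : ∀ {p q} → cls p ≡ cls q → chain p ≡ chain q
    chain-cong {p} {q} eq = trans (sym (split-cls p)) (trans (cong split eq) (split-cls q))

    rank : Fin N → ℕ
    rank p = coordinate p ∸ start (chain p)

    chainLength : Fin (k + k) → ℕ
    chainLength κ = end (split κ) ∸ start (split κ)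

    chains : Chains cls rank chainLength
    chains = record
      { rank-< = λ p → subst (λ κ → rank p < end κ ∸ start κ) (sym (split-cls p)) (ℕ.∸-monoˡ-< (proj₂ (located p)) (proj₁ (located p)))
      ; rank-injective = λ {p} {q} c≡ r≡ → cell-injective υ (trans (sym (at≡cell p))
          (trans (same-at (chain-cong c≡) (proj₁ (located p)) (proj₁ (located q)) r≡) (at≡cell q)))
      ; rank-onto = onto
      }
      where
      same-at : ∀ {κ κ′ x x′} → κ ≡ κ′ → start κ ≤ x → start κ′ ≤ x′ → x ∸ start κ ≡ x′ ∸ start κ′ → at κ x ≡ at κ′ x′
      same-at {κ} refl s≤x s≤x′ eq = cong (at κ) (ℕ.∸-cancelʳ-≡ s≤x s≤x′ eq)
      onto : ∀ κ {r} → r < chainLength κ → ∃[ p ] cls p ≡ κ × rank p ≡ r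
      onto κ {r} r< = p , trans (cong (join k k) (proj₁ same)) (Fin.join-splitAt k k κ) ,
        trans (cong₂ (λ κ x → x ∸ start κ) (proj₁ same) (proj₂ same)) (ℕ.m+n∸m≡n s r)
        where
        s = start (split κ)
        loc : Located (split κ) (s + r)
        loc = ℕ.m≤m+n s r , ℕ.<-≤-trans (ℕ.+-monoʳ-< s r<) (ℕ.≤-reflexive (ℕ.m+[n∸m]≡n (start≤end (split κ))))
        hit = cell-onto υ (located-∈ (split κ) (s + r) loc)
        p = proj₁ hit
        same = at-injective (chain p) (split κ) (located p) loc (trans (at≡cell p) (proj₂ hit))

    -- The order of two cells of the same row or column. A row chain and a column
    -- chain have only columns in common, and meet them inside and below the square.
    data Earlier : Chain → ℕ → Chain → ℕ → Set where
      same-chain : ∀ {κ x x′} → x < x′ → Earlier κ x κ x′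
      rows       : ∀ {i i′ x} → toℕ i < toℕ i′ → Earlier (inj₁ i) x (inj₁ i′) x
      columns    : ∀ {j j′ x} → toℕ j < toℕ j′ → Earlier (inj₂ j) x (inj₂ j′) x
      corner     : ∀ {i x j x′} → x < k → k ≤ x′ → Earlier (inj₁ i) x (inj₂ j) x′

    row-earlier : ∀ {κ κ′ x x′} → Located κ x → Located κ′ x′ →
      row (at κ x) ≡ row (at κ′ x′) → col (at κ x) < col (at κ′ x′) → Earlier κ x κ′ x′
    row-earlier {inj₁ i} {inj₁ i′} _ _ r≡ c< with refl ← Fin.toℕ-injective r≡ = same-chain c<
    row-earlier {inj₂ j} {inj₂ j′} _ _ refl c< = columns c<
    row-earlier {inj₁ i} {inj₂ j′} _ loc′ r≡ _ = contradiction (Fin.toℕ<n i) (ℕ.≤⇒≯ (subst (k ≤_) (sym r≡) (column≥k j′ loc′)))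
    row-earlier {inj₂ j} {inj₁ i′} loc _ r≡ _ = contradiction (Fin.toℕ<n i′) (ℕ.≤⇒≯ (subst (k ≤_) r≡ (column≥k j loc)))

    column-earlier : ∀ {κ κ′ x x′} → Located κ x → Located κ′ x′ →
      col (at κ x) ≡ col (at κ′ x′) → row (at κ x) < row (at κ′ x′) → Earlier κ x κ′ x′
    column-earlier {inj₁ i} {inj₁ i′} _ _ refl r< = rows r<
    column-earlier {inj₂ j} {inj₂ j′} _ _ c≡ r< with refl ← Fin.toℕ-injective c≡ = same-chain r<
    column-earlier {inj₁ i} {inj₂ j′} _ loc′ refl _ = corner (Fin.toℕ<n j′) (column≥k j′ loc′)
    column-earlier {inj₂ j} {inj₁ i′} loc _ _ r< = contradiction (ℕ.<-trans r< (Fin.toℕ<n i′)) (ℕ.≤⇒≯ (column≥k j loc))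

    -- For B stages the chain κ advances from start⁺ κ to end⁺ κ at constant speed,
    -- with a delay of index κ stages. The delays make the cells that are placed in
    -- one stage pairwise incomparable unless they lie in the same chain. The first k
    -- stages place the cells of the k × k square row by row.
    module Cutoffs (b₁ : ℕ) where

      B₁ B stages : ℕ
      B₁ = suc b₁
      B  = B₁ + k
      stages = k + (B₁ + (k + k))

      -- The columns below k of a row chain lie in the square and belong to the first k stages.
      -- Beyond it, rows and columns alike run through coordinates from k on.
      start⁺ end⁺ advance : Chain → ℕ
      start⁺ κ = start κ ⊔ k
      end⁺   κ = end κ ⊔ k
      advance   κ = (end⁺ κ ∸ start⁺ κ) / B

      start⁺≤end⁺ : ∀ κ → start⁺ κ ≤ end⁺ κ
      start⁺≤end⁺ κ = ℕ.⊔-monoˡ-≤ k (start≤end κ)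

      -- Linear interpolation from `start⁺` at time 0 to `end⁺` at time B. As a combination with
      -- nonnegative weights it is monotone in both ends, which compares longer with shorter chains.
      front : Chain → ℕ → ℕ
      front κ y = ((B ∸ y) * start⁺ κ + y * end⁺ κ) / B

      -- One unit of time adds `end⁺ κ ∸ start⁺ κ` to the numerator, and ⌊u⌋ + ⌊v⌋ ≤ ⌊u + v⌋.
      front-step : ∀ κ {y} → y < B → front κ y + advance κ ≤ front κ (suc y)
      front-step κ {y} y<B = begin
        front κ y + advance κ                               ≡⟨ ℕ.m*n/n≡m (front κ y + advance κ) B ⟨
        (front κ y + advance κ) * B / B                     ≤⟨ ℕ./-monoˡ-≤ B (begin
          (front κ y + advance κ) * B                         ≡⟨ ℕ.*-distribʳ-+ B (front κ y) (advance κ) ⟩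
          front κ y * B + advance κ * B                       ≤⟨ ℕ.+-mono-≤ (ℕ.m/n*n≤m ((B ∸ y) * s + y * t) B) (ℕ.m/n*n≤m (t ∸ s) B) ⟩
          (B ∸ y) * s + y * t + (t ∸ s)                    ≡⟨ cong (λ z → z * s + y * t + (t ∸ s)) (ℕ.+-∸-assoc 1 y<B) ⟩
          suc (B ∸ suc y) * s + y * t + (t ∸ s)            ≡⟨ solve 4 (λ z s u d → (s :+ z) :+ u :+ d := z :+ ((s :+ d) :+ u)) refl ((B ∸ suc y) * s) s (y * t) (t ∸ s) ⟩
          (B ∸ suc y) * s + ((s + (t ∸ s)) + y * t)        ≡⟨ cong (λ z → (B ∸ suc y) * s + (z + y * t)) (ℕ.m+[n∸m]≡n (start⁺≤end⁺ κ)) ⟩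
          (B ∸ suc y) * s + (t + y * t)                    ∎) ⟩
        front κ (suc y)                                  ∎
        where s = start⁺ κ
              t = end⁺ κ

      front-mono : ∀ κ {y y′} → y ≤ y′ → y′ ≤ B → front κ y ≤ front κ y′
      front-mono κ {y} y≤y′ y′≤B with d , refl ← ℕ.m≤n⇒∃[o]m+o≡n y≤y′ = go d y′≤B
        where
        go : ∀ d → y + d ≤ B → front κ y ≤ front κ (y + d)
        go zero    _ = ℕ.≤-reflexive (cong (front κ) (sym (ℕ.+-identityʳ y)))
        go (suc d) h = ℕ.≤-trans (go d (ℕ.≤-trans (ℕ.n≤1+n (y + d)) h′))
          (ℕ.≤-trans (ℕ.m≤m+n (front κ (y + d)) (advance κ)) (ℕ.≤-trans (front-step κ h′) (ℕ.≤-reflexive (cong (front κ) (sym (ℕ.+-suc y d))))))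
          where h′ = subst (_≤ B) (ℕ.+-suc y d) h

      front-0 : ∀ κ → front κ 0 ≡ start⁺ κ
      front-0 κ = trans (cong (_/ B) (trans (ℕ.+-identityʳ _) (ℕ.*-comm B (start⁺ κ)))) (ℕ.m*n/n≡m (start⁺ κ) B)

      front-B : ∀ κ → front κ B ≡ end⁺ κ
      front-B κ = trans (cong (λ z → (z * start⁺ κ + B * end⁺ κ) / B) (ℕ.n∸n≡0 B))
        (trans (cong (_/ B) (ℕ.*-comm B (end⁺ κ))) (ℕ.m*n/n≡m (end⁺ κ) B))

      front-antitone : ∀ {κ κ′} → start⁺ κ′ ≤ start⁺ κ → end⁺ κ′ ≤ end⁺ κ → ∀ y → front κ′ y ≤ front κ y
      front-antitone s≤ t≤ y = ℕ./-monoˡ-≤ B (ℕ.+-mono-≤ (ℕ.*-monoʳ-≤ (B ∸ y) s≤) (ℕ.*-monoʳ-≤ y t≤))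

      -- Within the first k stages, stage i releases the part of row i inside the square. For column
      -- chains the values 0 and k have no effect, since these chains start at k or later.
      early : ℕ → ℕ → ℕ
      early b i with i ℕ.<? b
      ... | yes _ = k
      ... | no _  = 0

      -- Truncated subtraction holds the chain at `start⁺` during its delay, and the minimum with B
      -- holds it at `end⁺` once it has arrived.
      late : Chain → ℕ → ℕ
      late κ j = front κ ((j ∸ index κ) ⊓ B)

      -- After b stages exactly the cells of κ with a coordinate below `cutoff b κ` are placed.
      cutoff : ℕ → Chain → ℕ
      cutoff b κ with b ℕ.<? k
      ... | yes _ = early b (index κ)
      ... | no _  = late κ (b ∸ k)

      early-< : ∀ {b i} → i < b → early b i ≡ k
      early-< {b} {i} i<b with i ℕ.<? b
      ... | yes _  = refl
      ... | no i≮b = contradiction i<b i≮b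

      early-≥ : ∀ {b i} → b ≤ i → early b i ≡ 0
      early-≥ {b} {i} b≤i with i ℕ.<? b
      ... | yes i<b = contradiction i<b (ℕ.≤⇒≯ b≤i)
      ... | no _    = refl

      early≤k : ∀ b i → early b i ≤ k
      early≤k b i with i ℕ.<? b
      ... | yes _ = ℕ.≤-refl
      ... | no _  = z≤n

      early-mono : ∀ b i → early b i ≤ early (suc b) i
      early-mono b i with i ℕ.<? b
      ... | yes i<b = ℕ.≤-reflexive (sym (early-< (ℕ.m<n⇒m<1+n i<b)))
      ... | no _    = z≤n

      cutoff-early : ∀ {b} κ → b < k → cutoff b κ ≡ early b (index κ)
      cutoff-early {b} κ b<k with b ℕ.<? k
      ... | yes _  = refl
      ... | no b≮k = contradiction b<k b≮k

      cutoff-late : ∀ j κ → cutoff (j + k) κ ≡ late κ j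
      cutoff-late j κ with (j + k) ℕ.<? k
      ... | yes j+k<k = contradiction j+k<k (ℕ.≤⇒≯ (ℕ.m≤n+m k j))
      ... | no _      = cong (late κ) (ℕ.m+n∸n≡m j k)

      late-mono : ∀ κ j → late κ j ≤ late κ (suc j)
      late-mono κ j = front-mono κ (ℕ.⊓-monoˡ-≤ B (ℕ.∸-monoˡ-≤ (index κ) (ℕ.n≤1+n j))) (ℕ.m⊓n≤n _ B)

      late≥ : ∀ κ j → start⁺ κ ≤ late κ j
      late≥ κ j = ℕ.≤-trans (ℕ.≤-reflexive (sym (front-0 κ))) (front-mono κ z≤n (ℕ.m⊓n≤n (j ∸ index κ) B))

      late≤ : ∀ κ j → late κ j ≤ end⁺ κ
      late≤ κ j = ℕ.≤-trans (front-mono κ (ℕ.m⊓n≤n (j ∸ index κ) B) ℕ.≤-refl) (ℕ.≤-reflexive (front-B κ))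

      late-0 : ∀ κ → late κ 0 ≡ start⁺ κ
      late-0 κ = trans (cong (λ z → front κ (z ⊓ B)) (ℕ.0∸n≡0 (index κ))) (front-0 κ)

      late-end : ∀ κ j → B + index κ ≤ j → late κ j ≡ end⁺ κ
      late-end κ j h = trans (cong (front κ) (ℕ.m≥n⇒m⊓n≡n (ℕ.≤-trans (ℕ.≤-reflexive (sym (ℕ.m+n∸n≡m B (index κ)))) (ℕ.∸-monoˡ-≤ (index κ) h)))) (front-B κ)

      late-at : ∀ b κ → k ≤ b → cutoff b κ ≡ late κ (b ∸ k)
      late-at b κ k≤b = trans (cong (λ b → cutoff b κ) (sym (ℕ.m∸n+n≡m k≤b))) (cutoff-late (b ∸ k) κ)

      cutoff-mono : ∀ b κ → cutoff b κ ≤ cutoff (suc b) κ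
      cutoff-mono b κ with ℕ.≤-<-connex k b
      ... | inj₁ k≤b = begin
        cutoff b κ               ≡⟨ late-at b κ k≤b ⟩
        late κ (b ∸ k)           ≤⟨ late-mono κ (b ∸ k) ⟩
        late κ (suc (b ∸ k))     ≡⟨ cong (late κ) (ℕ.+-∸-assoc 1 k≤b) ⟨
        late κ (suc b ∸ k)       ≡⟨ late-at (suc b) κ (ℕ.m≤n⇒m≤1+n k≤b) ⟨
        cutoff (suc b) κ         ∎
      ... | inj₂ b<k with ℕ.m≤n⇒m<n∨m≡n b<k
      ...   | inj₁ 1+b<k = begin
        cutoff b κ               ≡⟨ cutoff-early κ b<k ⟩
        early b (index κ)        ≤⟨ early-mono b (index κ) ⟩
        early (suc b) (index κ)  ≡⟨ cutoff-early κ 1+b<k ⟨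
        cutoff (suc b) κ         ∎
      ...   | inj₂ 1+b≡k = begin
        cutoff b κ               ≡⟨ cutoff-early κ b<k ⟩
        early b (index κ)        ≤⟨ early≤k b (index κ) ⟩
        k                        ≤⟨ ℕ.m≤n⊔m (start κ) k ⟩
        start⁺ κ                 ≤⟨ late≥ κ (suc b ∸ k) ⟩
        late κ (suc b ∸ k)       ≡⟨ late-at (suc b) κ (ℕ.≤-reflexive (sym 1+b≡k)) ⟨
        cutoff (suc b) κ         ∎

      stages≡ : stages ≡ (B + k) + k
      stages≡ = solve 2 (λ k b → k :+ (b :+ (k :+ k)) := ((b :+ k) :+ k) :+ k) refl k B₁

      private
        Separated : Chain → ℕ → Chain → ℕ → Set
        Separated κ x κ′ x′ = ∃[ b ] b ≤ stages × x < cutoff b κ × cutoff b κ′ ≤ x′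

        k≤stages : k ≤ stages
        k≤stages = ℕ.m≤m+n k _

        -- Let κ′ pass x between j and j + 1. Both ends of κ are at least as far as those of κ′, and
        -- κ is at least one stage ahead, so κ is already past x at j while κ′ is not.
        separate-late : ∀ {κ κ′ x} → index κ < index κ′ → start⁺ κ′ ≤ start⁺ κ → end⁺ κ′ ≤ end⁺ κ → Located κ′ x → k ≤ x → Separated κ x κ′ x
        separate-late {κ} {κ′} {x} i<i′ s≤ t≤ (s≤x , x<t) k≤x
          with j , j< , lo , hi ← crossing (late κ′) x (B + index κ′)
                 (subst (_≤ x) (sym (late-0 κ′)) (ℕ.⊔-lub s≤x k≤x))
                 (subst (x <_) (sym (late-end κ′ _ ℕ.≤-refl)) (ℕ.<-≤-trans x<t (ℕ.m≤m⊔n (end κ′) k)))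
          = j + k
          , ℕ.≤-trans (ℕ.+-monoˡ-≤ k (ℕ.≤-trans (ℕ.<⇒≤ j<) (ℕ.+-monoʳ-≤ B (ℕ.<⇒≤ (index<k κ′))))) (ℕ.≤-reflexive (sym stages≡))
          , ℕ.<-≤-trans hi (begin
              late κ′ (suc j)                       ≤⟨ front-antitone {κ} {κ′} s≤ t≤ ((suc j ∸ index κ′) ⊓ B) ⟩
              -- The delays differ by at least 1, hence j + 1 - `index κ′` ≤ j - `index κ`.
              front κ ((suc j ∸ index κ′) ⊓ B)      ≤⟨ front-mono κ (ℕ.⊓-monoˡ-≤ B (ℕ.∸-monoʳ-≤ (suc j) i<i′)) (ℕ.m⊓n≤n _ B) ⟩
              late κ j                              ≡⟨ cutoff-late j κ ⟨
              cutoff (j + k) κ                      ∎)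
          , subst (_≤ x) (sym (cutoff-late j κ′)) lo

        separate : ∀ {κ κ′ x x′} → Located κ x → Located κ′ x′ → Earlier κ x κ′ x′ → (κ ≡ κ′ × x < x′) ⊎ Separated κ x κ′ x′
        separate _ _ (same-chain x<x′) = inj₁ (refl , x<x′)
        separate _ loc′ (columns {j} {j′} j<j′) = inj₂ (separate-late {inj₂ j} {inj₂ j′} j<j′
          (ℕ.⊔-monoˡ-≤ k (ℕ.⊔-monoˡ-≤ k (conjugatePart-antitone (inner υ) (ℕ.<⇒≤ j<j′))))
          (ℕ.⊔-monoˡ-≤ k (ℕ.⊔-monoˡ-≤ k (conjugatePart-antitone (outer υ) (ℕ.<⇒≤ j<j′)))) loc′ (column≥k j′ loc′))
        -- After k stages the rows are complete inside the square, and no column chain has begun.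
        separate (s≤x , _) (s′≤x′ , _) (corner {i} {x} {j} {x′} x<k k≤x′) = inj₂ (k , k≤stages
          , ℕ.<-≤-trans x<k (ℕ.≤-trans (ℕ.m≤n⊔m (start (inj₁ i)) k) (ℕ.≤-reflexive (sym (at-k (inj₁ i)))))
          , ℕ.≤-trans (ℕ.≤-reflexive (at-k (inj₂ j))) (ℕ.⊔-lub s′≤x′ k≤x′))
          where
          at-k : ∀ κ → cutoff k κ ≡ start⁺ κ
          at-k κ = trans (cutoff-late 0 κ) (late-0 κ)
        separate loc loc′ (rows {i} {i′} {x} i<i′) with ℕ.≤-<-connex k x
        ... | inj₁ k≤x = inj₂ (separate-late {inj₁ i} {inj₁ i′} i<i′
          (ℕ.⊔-monoˡ-≤ k (part-antitone (inner υ) (ℕ.<⇒≤ i<i′)))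
          (ℕ.⊔-monoˡ-≤ k (part-antitone (outer υ) (ℕ.<⇒≤ i<i′))) loc′ k≤x)
        -- Inside the square the boundary after stage i separates the rows: row i has been released
        -- up to column k, and row i′ has not begun.
        ... | inj₂ x<k = inj₂ (suc (toℕ i) , ℕ.≤-trans (ℕ.<⇒≤ 1+i<k) k≤stages
          , subst (x <_) (sym (trans (cutoff-early (inj₁ i) 1+i<k) (early-< {suc (toℕ i)} {toℕ i} ℕ.≤-refl))) x<k
          , ℕ.≤-trans (ℕ.≤-reflexive (trans (cutoff-early (inj₁ i′) 1+i<k) (early-≥ i<i′))) z≤n)
          where
          1+i<k : suc (toℕ i) < k
          1+i<k = ℕ.≤-<-trans i<i′ (Fin.toℕ<n i′)

      -- The clamp to the chain is essential: early cutoffs may lie before its start, and early or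
      -- late ones beyond its end.
      placed : ℕ → Chain → ℕ
      placed b κ = (end κ ⊓ (start κ ⊔ cutoff b κ)) ∸ start κ

      placed-> : ∀ {b κ x} → Located κ x → x < cutoff b κ → x ∸ start κ < placed b κ
      placed-> {b} {κ} (s≤x , x<t) x<c = ℕ.∸-monoˡ-< (ℕ.⊓-glb x<t (ℕ.<-≤-trans x<c (ℕ.m≤n⊔m (start κ) (cutoff b κ)))) s≤x

      placed-≤ : ∀ {b κ x} → Located κ x → cutoff b κ ≤ x → placed b κ ≤ x ∸ start κ
      placed-≤ {b} {κ} (s≤x , _) c≤x = ℕ.∸-monoˡ-≤ (start κ) (ℕ.≤-trans (ℕ.m⊓n≤n (end κ) _) (ℕ.⊔-lub s≤x c≤x))

      separated : ∀ {p q} → Earlier (chain p) (coordinate p) (chain q) (coordinate q) →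
        (chain p ≡ chain q × coordinate p < coordinate q) ⊎ (∃[ b ] b ≤ stages × rank p < placed b (chain p) × placed b (chain q) ≤ rank q)
      separated {p} {q} earlier with separate (located p) (located q) earlier
      ... | inj₁ same = inj₁ same
      ... | inj₂ (b , b≤ , x<c , c≤x) = inj₂ (b , b≤ , placed-> (located p) x<c , placed-≤ (located q) c≤x)

      placed-0 : ∀ κ → placed 0 κ ≡ 0
      placed-0 κ = ℕ.m≤n⇒m∸n≡0 (ℕ.≤-trans (ℕ.m⊓n≤n (end κ) _) (ℕ.≤-reflexive
        (trans (cong (start κ ⊔_) (trans (cutoff-early κ (ℕ.≤-<-trans z≤n (index<k κ))) (early-≥ {0} {index κ} z≤n))) (ℕ.⊔-identityʳ (start κ)))))

      placed-stages : ∀ κ → placed stages κ ≡ end κ ∸ start κ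
      placed-stages κ = cong (_∸ start κ) (ℕ.m≤n⇒m⊓n≡m (ℕ.≤-trans (ℕ.m≤m⊔n (end κ) k)
        (ℕ.≤-trans (ℕ.≤-reflexive (sym (trans (trans (cong (λ b → cutoff b κ) stages≡) (cutoff-late (B + k) κ)) (late-end κ (B + k) (ℕ.+-monoʳ-≤ B (ℕ.<⇒≤ (index<k κ)))))))
          (ℕ.m≤n⊔m (start κ) _))))

      placed-mono : ∀ b κ → placed b κ ≤ placed (suc b) κ
      placed-mono b κ = ℕ.∸-monoˡ-≤ (start κ) (ℕ.⊓-monoʳ-≤ (end κ) (ℕ.⊔-monoʳ-≤ (start κ) (cutoff-mono b κ)))

      -- After 2k stages even the most delayed chain is moving, and for j < B₁ none has finished:
      -- the time j + k - `index κ` lies between 1 and B - 1.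
      placed-step : ∀ j κ → j < B₁ → placed (j + (k + k)) κ + advance κ ≤ placed (suc j + (k + k)) κ
      placed-step j κ j<B₁ with ℕ.≤-<-connex k (end κ)
      ... | inj₂ t<k = ℕ.≤-trans (ℕ.≤-reflexive (trans (cong (placed (j + (k + k)) κ +_) step≡0) (ℕ.+-identityʳ _))) (placed-mono (j + (k + k)) κ)
        where
        step≡0 : advance κ ≡ 0
        step≡0 = trans (cong (λ z → (z ∸ start⁺ κ) / B) (ℕ.m≤n⇒m⊔n≡n (ℕ.<⇒≤ t<k)))
          (trans (cong (_/ B) (ℕ.m≤n⇒m∸n≡0 (ℕ.m≤n⊔m (start κ) k))) (ℕ.0/n≡0 B))
      ... | inj₁ k≤t = begin
        placed (j + (k + k)) κ + advance κ             ≡⟨ cong (_+ advance κ) (placed≡ j) ⟩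
        (front κ (y j) ∸ start κ) + advance κ          ≡⟨ ℕ.+-∸-comm (advance κ) (start≤front z) ⟨
        (front κ (y j) + advance κ) ∸ start κ          ≡⟨ cong (λ y → (front κ y + advance κ) ∸ start κ) y≡ ⟩
        (front κ z + advance κ) ∸ start κ              ≤⟨ ℕ.∸-monoˡ-≤ (start κ) (front-step κ z<B) ⟩
        front κ (suc z) ∸ start κ                   ≡⟨ cong (λ y → front κ y ∸ start κ) y-suc ⟨
        front κ (y (suc j)) ∸ start κ               ≡⟨ placed≡ (suc j) ⟨
        placed (suc j + (k + k)) κ                  ∎
        where
        y : ℕ → ℕ
        y j = ((j + k) ∸ index κ) ⊓ B
        z = (j + k) ∸ index κ
        z<B : z < B
        z<B = ℕ.≤-<-trans (ℕ.m∸n≤m (j + k) (index κ)) (ℕ.+-monoˡ-< k j<B₁)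
        y≡ : y j ≡ z
        y≡ = ℕ.m≤n⇒m⊓n≡m (ℕ.<⇒≤ z<B)
        y-suc : y (suc j) ≡ suc z
        y-suc = trans (cong (_⊓ B) (ℕ.+-∸-assoc 1 (ℕ.≤-trans (ℕ.<⇒≤ (index<k κ)) (ℕ.m≤n+m k j)))) (ℕ.m≤n⇒m⊓n≡m z<B)
        start≤front : ∀ y → start κ ≤ front κ (y ⊓ B)
        start≤front y = ℕ.≤-trans (ℕ.≤-trans (ℕ.m≤m⊔n (start κ) k) (ℕ.≤-reflexive (sym (front-0 κ)))) (front-mono κ z≤n (ℕ.m⊓n≤n y B))
        placed≡ : ∀ j → placed (j + (k + k)) κ ≡ front κ (y j) ∸ start κ
        placed≡ j = cong (_∸ start κ) (begin-equality
          end κ ⊓ (start κ ⊔ cutoff (j + (k + k)) κ)   ≡⟨ cong (λ c → end κ ⊓ (start κ ⊔ c)) (trans (cong (λ b → cutoff b κ) (sym (ℕ.+-assoc j k k))) (cutoff-late (j + k) κ)) ⟩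
          end κ ⊓ (start κ ⊔ late κ (j + k))           ≡⟨ cong (end κ ⊓_) (ℕ.m≤n⇒m⊔n≡n (ℕ.≤-trans (ℕ.m≤m⊔n (start κ) k) (late≥ κ (j + k)))) ⟩
          end κ ⊓ late κ (j + k)                       ≡⟨ ℕ.m≥n⇒m⊓n≡n (ℕ.≤-trans (late≤ κ (j + k)) (ℕ.≤-reflexive (ℕ.m≥n⇒m⊔n≡m k≤t))) ⟩
          late κ (j + k)                               ∎)

  -- Bounds for the number of standard fillings

  vectors-unique : ∀ {A : Set} {xs : List A} → Unique xs → ∀ n → Unique (vectors xs n)
  vectors-unique xs! zero    = All.[] ∷ []
  vectors-unique xs! (suc n) = Unique.cartesianProductWith⁺ Vec._∷_ Vec.∷-injective xs! (vectors-unique xs! n)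

  ^-distribʳ-* : ∀ a b n → (a * b) ^ n ≡ a ^ n * b ^ n
  ^-distribʳ-* a b zero    = refl
  ^-distribʳ-* a b (suc n) = trans (cong (a * b *_) (^-distribʳ-* a b n))
    (solve 4 (λ a b c d → (a :* b) :* (c :* d) := (a :* c) :* (b :* d)) refl a b (a ^ n) (b ^ n))

  lookup-ext : ∀ {A : Set} {n} (v w : Vec A n) → (∀ i → Vec.lookup v i ≡ Vec.lookup w i) → v ≡ w
  lookup-ext v w eq = trans (sym (Vec.tabulate∘lookup v)) (trans (Vec.tabulate-cong eq) (Vec.tabulate∘lookup w))

  module Count (k : ℕ) (υ : SkewShape) (d≤k : durfee (outer υ) ≤ k) where
    open SkewChains k υ d≤k

    private
      N = size υ
      standard = filter (isStandard? υ) (vectors (allFin N) N)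

    module _ {T : Filling υ} (std : IsStandard υ T) where

      standard-injective : ∀ {p q} → Vec.lookup T p ≡ Vec.lookup T q → p ≡ q
      standard-injective {p} {q} = proj₁ (std p q)

      standard-increasing : Increasing chains (Vec.lookup T)
      standard-increasing {p} {q} c≡ r< = along (chain p) refl
        where
        κ≡ : chain p ≡ chain q
        κ≡ = chain-cong c≡
        x<x′ : coordinate p < coordinate q
        x<x′ = ℕ.≰⇒> λ x′≤x → ℕ.≤⇒≯ (subst (λ κ → coordinate q ∸ start κ ≤ rank p) κ≡ (ℕ.∸-monoˡ-≤ (start (chain p)) x′≤x)) r<
        cell-q : at (chain p) (coordinate q) ≡ cell υ q
        cell-q = trans (cong (λ κ → at κ (coordinate q)) κ≡) (at≡cell q)
        along : ∀ κ → κ ≡ chain p → Vec.lookup T p Fin.< Vec.lookup T q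
        along (inj₁ i) eq = proj₁ (proj₂ (std p q))
          (trans (sym (cong row p≡)) (cong row q≡)) (subst₂ _<_ (cong col p≡) (cong col q≡) x<x′)
          where
          p≡ = trans (cong (λ κ → at κ (coordinate p)) eq) (at≡cell p)
          q≡ = trans (cong (λ κ → at κ (coordinate q)) eq) cell-q
        along (inj₂ j) eq = proj₂ (proj₂ (std p q))
          (trans (sym (cong col p≡)) (cong col q≡)) (subst₂ _<_ (cong row p≡) (cong row q≡) x<x′)
          where
          p≡ = trans (cong (λ κ → at κ (coordinate p)) eq) (at≡cell p)
          q≡ = trans (cong (λ κ → at κ (coordinate q)) eq) cell-q

    private
      standard⁻ : ∀ {T} → T ∈ standard → IsStandard υ T
      standard⁻ T∈ = proj₂ (∈-filter⁻ (isStandard? υ) {xs = vectors (allFin N) N} T∈)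

    e≤arrangements : e υ ≤ length (arrangements N chainLength)
    e≤arrangements = length-≤ (λ T w → Reads cls w (Vec.lookup T))
      (Unique.filter⁺ (isStandard? υ) (vectors-unique (Unique.allFin⁺ N) N))
      (λ {T} T∈ → word-of chains (Vec.lookup T) (standard-injective {T} (standard⁻ T∈)))
      (λ {T} {T′} {w} T∈ T′∈ reads reads′ → lookup-ext T T′ (filling-unique chains (Vec.lookup T) (Vec.lookup T′)
        (standard-injective {T} (standard⁻ T∈)) (standard-injective {T′} (standard⁻ T′∈))
        (standard-increasing {T} (standard⁻ T∈)) (standard-increasing {T′} (standard⁻ T′∈)) w reads reads′))

    size≡ : Σℕ.sum chainLength ≡ N
    size≡ = Chains.total chains

    e-upper : e υ * Πℕ.sum (λ κ → chainLength κ ^ chainLength κ) ≤ Σℕ.sum chainLength ^ Σℕ.sum chainLength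
    e-upper = begin
      e υ * P                                         ≤⟨ ℕ.*-monoˡ-≤ P e≤arrangements ⟩
      length (arrangements N chainLength) * P         ≤⟨ arrangements-weighted N chainLength chainLength size≡ ⟩
      Σℕ.sum chainLength ^ N                          ≡⟨ cong (Σℕ.sum chainLength ^_) size≡ ⟨
      Σℕ.sum chainLength ^ Σℕ.sum chainLength         ∎
      where P = Πℕ.sum (λ κ → chainLength κ ^ chainLength κ)

    module Lower (b₁ : ℕ) where
      open Cutoffs b₁

      chainStep : Fin (k + k) → ℕ
      chainStep κ = advance (split κ)

      private
        C : ℕ → Fin (k + k) → ℕ
        C b κ = placed b (split κ)

        -- Free arrangements are used only in the B₁ stages in which every chain advances. Elsewhere
        -- the content 0 leaves the fixed word as the only choice.
        q : ℕ → Fin (k + k) → ℕ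
        q b with (k + k) ℕ.≤? b | (b ∸ (k + k)) ℕ.<? B₁
        ... | yes _ | yes _ = chainStep
        ... | _     | _     = λ _ → 0

        C-step : ∀ b κ → C b κ + q b κ ≤ C (suc b) κ
        C-step b κ with (k + k) ℕ.≤? b | (b ∸ (k + k)) ℕ.<? B₁
        ... | yes 2k≤b | yes j<B₁ = subst (λ b → C b κ + chainStep κ ≤ C (suc b) κ) (ℕ.m∸n+n≡m 2k≤b) (placed-step (b ∸ (k + k)) (split κ) j<B₁)
        ... | yes _    | no _     = ℕ.≤-trans (ℕ.≤-reflexive (ℕ.+-identityʳ _)) (placed-mono b (split κ))
        ... | no _     | _        = ℕ.≤-trans (ℕ.≤-reflexive (ℕ.+-identityʳ _)) (placed-mono b (split κ))

        q-active : ∀ j → j < B₁ → q (j + (k + k)) ≡ chainStep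
        q-active j j<B₁ with (k + k) ℕ.≤? (j + (k + k)) | (j + (k + k) ∸ (k + k)) ℕ.<? B₁
        ... | yes _    | yes _  = refl
        ... | yes _    | no j≮  = contradiction (subst (_< B₁) (sym (ℕ.m+n∸n≡m j (k + k))) j<B₁) j≮
        ... | no 2k≰   | _      = contradiction (ℕ.m≤n+m (k + k) j) 2k≰

      open BlockWords C q (λ κ → placed-0 (split κ)) C-step

      module _ {w : List (Fin (k + k))} (w∈ : w ∈ blockWords stages) where
        private
          content : ∀ κ → count κ w ≡ chainLength κ
          content κ = trans (count-blockWords stages w∈ κ) (placed-stages (split κ))

          f : Fin N → Fin N
          f = filling-of chains w content

          earlier⇒< : ∀ {p q} → Earlier (chain p) (coordinate p) (chain q) (coordinate q) → f p Fin.< f q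
          earlier⇒< {p} {q} earlier = order (separated {p} {q} earlier)
            where
            order : (chain p ≡ chain q × coordinate p < coordinate q) ⊎ (∃[ b ] b ≤ stages × rank p < placed b (chain p) × placed b (chain q) ≤ rank q) → f p Fin.< f q
            order (inj₁ (κ≡ , x<x′)) = filling-increasing chains w content (cong (Fin.join k k) κ≡)
              (subst (λ κ → coordinate p ∸ start (chain p) < coordinate q ∸ start κ) κ≡
                (ℕ.∸-monoˡ-< x<x′ (proj₁ (located p))))
            order (inj₂ (b , b≤ , p< , q≥)) = split-at (blockWords-split stages w∈ b b≤)
              where
              split-at : (∃[ u ] ∃[ v ] w ≡ u ++ v × (∀ κ → count κ u ≡ placed b (split κ))) → f p Fin.< f q
              split-at (u , v , w≡ , count-u) = filling-split chains w content u v w≡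
                (subst (rank p <_) (sym (trans (count-u (cls p)) (cong (placed b) (split-cls p)))) p<)
                (subst (_≤ rank q) (sym (trans (count-u (cls q)) (cong (placed b) (split-cls q)))) q≥)

          T : Filling υ
          T = Vec.tabulate f

          T! : ∀ p → Vec.lookup T p ≡ f p
          T! = Vec.lookup∘tabulate f

          T< : ∀ {p q} → f p Fin.< f q → Vec.lookup T p Fin.< Vec.lookup T q
          T< {p} {q} = subst₂ Fin._<_ (sym (T! p)) (sym (T! q))

          T-standard : IsStandard υ T
          T-standard p q =
            (λ eq → filling-injective chains w content (trans (sym (T! p)) (trans eq (T! q)))) ,
            (λ r≡ c< → T< (earlier⇒< (row-earlier (located p) (located q)
              (subst₂ (λ c c′ → row c ≡ row c′) (sym (at≡cell p)) (sym (at≡cell q)) r≡)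
              (subst₂ (λ c c′ → col c < col c′) (sym (at≡cell p)) (sym (at≡cell q)) c<)))) ,
            (λ c≡ r< → T< (earlier⇒< (column-earlier (located p) (located q)
              (subst₂ (λ c c′ → col c ≡ col c′) (sym (at≡cell p)) (sym (at≡cell q)) c≡)
              (subst₂ (λ c c′ → row c < row c′) (sym (at≡cell p)) (sym (at≡cell q)) r<))))

        standard-filling : ∃[ T ] T ∈ standard × Reads cls w (Vec.lookup T)
        standard-filling = T , ∈-filter⁺ (isStandard? υ) (∈-vectors ∈-allFin T) T-standard ,
          proj₁ reads , λ p → subst (λ v → At w (toℕ v) (cls p)) (sym (T! p)) (proj₂ reads p)
          where reads = filling-reads chains w content

      multinomial^≤e : multinomial chainStep ^ B₁ ≤ e υ
      -- The number of stages has the required shape k + (B₁ + (k + k)): 2k stages precede the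
      -- active ones, and k follow them.
      multinomial^≤e = ℕ.≤-trans (length-blockWords-≥ (k + k) B₁ chainStep q-active k)
        (length-≤ (λ w T → T ∈ standard × Reads cls w (Vec.lookup T)) (blockWords-unique stages)
          (λ w∈ → let T , T∈ , reads = standard-filling w∈ in T , T∈ , T∈ , reads)
          (λ {w} {w′} {T} _ _ (T∈ , reads) (_ , reads′) → reads-unique {cls = cls} (Vec.lookup T) (standard-injective {T} (standard⁻ T∈)) reads reads′))

      -- The multiples of the steps that approximate the chain lengths are those by B, not by B₁.
      -- The exponent is raised accordingly, and each of the k additional multinomial coefficients
      -- is at most (2k)^Q.
      e-lower : (Σℕ.sum chainStep ^ Σℕ.sum chainStep) ^ B ≤
        e υ * ((k + k) ^ Σℕ.sum chainStep) ^ k * (suc (Σℕ.sum chainStep) ^ (k + k) * Πℕ.sum (λ κ → chainStep κ ^ chainStep κ)) ^ B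
      e-lower = begin
        (Q ^ Q) ^ B                          ≤⟨ ℕ.^-monoˡ-≤ B (multinomial-lower chainStep) ⟩
        (M * X) ^ B                          ≡⟨ ^-distribʳ-* M X B ⟩
        M ^ B * X ^ B                        ≡⟨ cong (_* X ^ B) (ℕ.^-distribˡ-+-* M B₁ k) ⟩
        M ^ B₁ * M ^ k * X ^ B               ≤⟨ ℕ.*-monoˡ-≤ (X ^ B) (ℕ.*-mono-≤ multinomial^≤e (ℕ.^-monoˡ-≤ k (multinomial-upper chainStep))) ⟩
        e υ * ((k + k) ^ Q) ^ k * X ^ B      ∎
        where
        Q = Σℕ.sum chainStep
        M = multinomial chainStep
        X = suc Q ^ (k + k) * Πℕ.sum (λ κ → chainStep κ ^ chainStep κ)

  -- Chain lengths compared with Frobenius coordinates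

  frobenius : ∀ {k} → Partition → Fin k ⊎ Fin k → ℕ
  frobenius ν (inj₁ i) = frobeniusᵃ ν (toℕ i)
  frobenius ν (inj₂ j) = frobeniusᵇ ν (toℕ j)

  module ChainLimits (k : ℕ) (υ : SkewShape) (d≤k : durfee (outer υ) ≤ k) where
    open SkewChains k υ d≤k public

    private
      Within : ℕ → ℕ → Set
      Within f x = f ≤ x × x ≤ f + k

      clamp : ∀ {f x} → Within f x → Within f (x ⊔ k)
      clamp {f} {x} (f≤x , x≤f+k) = ℕ.≤-trans f≤x (ℕ.m≤m⊔n x k) , ℕ.⊔-lub x≤f+k (ℕ.m≤n+m k f)

      index-slack : ∀ {f x} (i : Fin k) → f ≤ x × x ≤ f + suc (toℕ i) → Within f x
      index-slack {f} i (f≤x , x≤) = f≤x , ℕ.≤-trans x≤ (ℕ.+-monoʳ-≤ f (Fin.toℕ<n i))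

      end-within : ∀ κ → Within (frobenius (outer υ) κ) (end κ)
      end-within (inj₁ i) = index-slack i (frobeniusᵃ-close (outer υ) (toℕ i))
      end-within (inj₂ j) = clamp (index-slack j (frobeniusᵇ-close (outer υ) (toℕ j)))

      start-within : ∀ κ → Within (frobenius (inner υ) κ) (start κ)
      start-within (inj₁ i) = index-slack i (frobeniusᵃ-close (inner υ) (toℕ i))
      start-within (inj₂ j) = clamp (index-slack j (frobeniusᵇ-close (inner υ) (toℕ j)))

      -- This bounds the distance of u from a - p by k + d, written without truncated subtraction.
      -- The slack d is 0 for chain lengths and B for B times a step, where it covers the remainder
      -- of the division by B.
      difference-within : ∀ {a p s t} d u → s ≤ t → Within a t → Within p s → u ≤ t ∸ s → t ∸ s ≤ u + d →
        a ≤ u + p + (k + d) × u + p ≤ a + (k + d)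
      difference-within {a} {p} {s} {t} d u s≤t (a≤t , t≤a+k) (p≤s , s≤p+k) u≤ ≤u+d =
        (begin
          a                              ≤⟨ a≤t ⟩
          t                              ≡⟨ ℕ.m∸n+n≡m s≤t ⟨
          (t ∸ s) + s                ≤⟨ ℕ.+-mono-≤ ≤u+d s≤p+k ⟩
          (u + d) + (p + k)        ≡⟨ solve 4 (λ u d p k → (u :+ d) :+ (p :+ k) := u :+ p :+ (k :+ d)) refl u d p k ⟩
          u + p + (k + d)          ∎) ,
        (begin
          u + p                        ≤⟨ ℕ.+-mono-≤ u≤ p≤s ⟩
          (t ∸ s) + s                ≡⟨ ℕ.m∸n+n≡m s≤t ⟩
          t                              ≤⟨ t≤a+k ⟩
          a + k                        ≤⟨ ℕ.+-monoʳ-≤ a (ℕ.m≤m+n k d) ⟩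
          a + (k + d)                ∎)

    chainLength-within : ∀ κ → let a = frobenius (outer υ) (split κ) ; p = frobenius (inner υ) (split κ) ; u = chainLength κ in
      a ≤ u + p + (k + 0) × u + p ≤ a + (k + 0)
    chainLength-within κ = difference-within 0 (chainLength κ) (start≤end (split κ)) (end-within (split κ)) (start-within (split κ))
      ℕ.≤-refl (ℕ.≤-reflexive (sym (ℕ.+-identityʳ (chainLength κ))))

    module _ (b₁ : ℕ) where
      open Cutoffs b₁

      step-within : ∀ κ → let a = frobenius (outer υ) (split κ) ; p = frobenius (inner υ) (split κ) ; u = B * advance (split κ) in
        a ≤ u + p + (k + B) × u + p ≤ a + (k + B)
      step-within κ′ = difference-within B (B * advance κ) (start⁺≤end⁺ κ) (clamp (end-within κ)) (clamp (start-within κ))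
        (ℕ.≤-trans (ℕ.≤-reflexive (ℕ.*-comm B (advance κ))) (ℕ.m/n*n≤m r B))
        (ℕ.≤-trans (ℕ.≤-reflexive (ℕ.m≡m%n+[m/n]*n r B))
          (ℕ.≤-trans (ℕ.+-mono-≤ (ℕ.<⇒≤ (ℕ.m%n<n r B)) (ℕ.≤-reflexive (ℕ.*-comm (advance κ) B))) (ℕ.≤-reflexive (ℕ.+-comm B (B * advance κ)))))
        where
        κ = split κ′
        r = end⁺ κ ∸ start⁺ κ

-- Passage to the limit

module Limits where

  import Defs as R
  open import Defs hiding (_≤_; _<_; _+_; _*_; _-_; -_; ∣_∣; _≈_)
  open Rationals
  open Logarithm
  open SkewShapes
  import Algebra.Properties.CommutativeMonoid.Sum as Sum
  open import Data.Fin.Base as Fin using (Fin; splitAt; _↑ˡ_; _↑ʳ_)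
  import Data.Fin.Properties as Fin
  open import Data.Integer.Base using (+_)
  open import Data.Nat.Base as ℕ using (ℕ; zero; suc)
  import Data.Nat.Properties as ℕ
  open import Data.Product.Base using (∃-syntax; _×_; _,_; proj₁; proj₂)
  open import Data.Rational.Base as ℚ using (ℚ; 0ℚ; 1ℚ; ½; _+_; _*_; _-_; -_; ∣_∣; _≤_; _<_)
  import Data.Rational.Properties as ℚ
  open import Data.Rational.Solver using (module +-*-Solver)
  open import Data.Sum.Base using (_⊎_; inj₁; inj₂)
  open import Function.Base using (_∘_)
  open import Relation.Binary.PropositionalEquality
  open ℚ.≤-Reasoning hiding (start)
  open +-*-Solver using (solve; _:=_; _:+_; _:*_; _:-_; :-_; con)
  private
    module Σℕ = Sum ℕ.+-0-commutativeMonoid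
    module Σℚ = Sum ℚ.+-0-commutativeMonoid

  archimedean-* : ∀ x h → 0ℚ < h → ∃[ N ] ∀ n → N ℕ.≤ n → x ≤ h * ι n
  archimedean-* x h 0<h = from (archimedean (x * recip h))
    where
    from : (∃[ N ] x * recip h ≤ ι N) → ∃[ N ] ∀ n → N ℕ.≤ n → x ≤ h * ι n
    from (N , x/h≤N) = N , λ n N≤n → begin
      x                    ≡⟨ trans (ℚ.*-comm x 1ℚ) (ℚ.*-identityˡ x) ⟨
      x * 1ℚ               ≡⟨ cong (x *_) (recip-inverse 0<h) ⟨
      x * (h * recip h)    ≡⟨ solve 3 (λ x h r → x :* (h :* r) := h :* (x :* r)) refl x h (recip h) ⟩
      h * (x * recip h)    ≤⟨ *ˡ (ℚ.<⇒≤ 0<h) (ℚ.≤-trans x/h≤N (ι-mono N≤n)) ⟩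
      h * ι n              ∎

  sum≤ : ∀ {m} (f : Fin m → ℚ) c → (∀ i → f i ≤ c) → Σℚ.sum f ≤ ι m * c
  sum≤ {zero}  f c f≤c = ℚ.≤-reflexive (sym (ℚ.*-zeroˡ c))
  sum≤ {suc m} f c f≤c = begin
    f Fin.zero + Σℚ.sum (f ∘ Fin.suc)   ≤⟨ ℚ.+-mono-≤ (f≤c Fin.zero) (sum≤ (f ∘ Fin.suc) c (f≤c ∘ Fin.suc)) ⟩
    c + ι m * c                         ≡⟨ solve 2 (λ c m → c :+ m :* c := (m :+ con 1ℚ) :* c) refl c (ι m) ⟩
    (ι m + 1ℚ) * c                      ≡⟨ cong (_* c) (fromℕ-suc m) ⟨
    ι (suc m) * c                       ∎

  sum-↑ : ∀ a {b} (f : Fin (a ℕ.+ b) → ℚ) → Σℚ.sum f ≡ Σℚ.sum (λ i → f (i ↑ˡ b)) + Σℚ.sum (λ j → f (a ↑ʳ j))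
  sum-↑ zero    f = sym (ℚ.+-identityˡ (Σℚ.sum f))
  sum-↑ (suc a) f = trans (cong (_+_ (f Fin.zero)) (sum-↑ a (f ∘ Fin.suc))) (sym (ℚ.+-assoc (f Fin.zero) _ _))

  seq-∑ : ∀ {m} (f : Fin m → ℝ) t → seq (∑ f) t ≡ Σℚ.sum (λ i → seq (f i) t)
  seq-∑ {zero}  f t = refl
  seq-∑ {suc m} f t = cong (_+_ (seq (f Fin.zero) t)) (seq-∑ (f ∘ Fin.suc) t)

  bounded-all : ∀ {m} (x : Fin m → ℝ) → ∃[ C ] (0ℚ < C) × (∀ i → Eventually λ t → ∣ seq (x i) t ∣ ≤ C)
  bounded-all {zero}  x = 1ℚ , 0<1 , λ ()
  bounded-all {suc m} x = combine (bounded (cauchy (x Fin.zero))) (bounded-all (x ∘ Fin.suc))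
    where
    combine : Bounded (seq (x Fin.zero)) → (∃[ C ] (0ℚ < C) × (∀ i → Eventually λ t → ∣ seq (x (Fin.suc i)) t ∣ ≤ C)) →
      ∃[ C ] (0ℚ < C) × (∀ i → Eventually λ t → ∣ seq (x i) t ∣ ≤ C)
    combine (B , 0<B , x₀≤B) (C , 0<C , x≤C) = B + C , 0<+ 0<B (ℚ.<⇒≤ 0<C) , λ
      { Fin.zero    → eventually (λ t h → ℚ.≤-trans h (≤-by C (ℚ.<⇒≤ 0<C) refl)) x₀≤B
      ; (Fin.suc i) → eventually (λ t h → ℚ.≤-trans h (≤-by B (ℚ.<⇒≤ 0<B) (ℚ.+-comm C B))) (x≤C i) }

  module _ (a p : ℕ → ℕ) {x y : ℝ}
           (a→x : Tendsto (λ n → fromℚ ((+ a n) ℚ./ n)) x) (p→y : Tendsto (λ n → fromℚ ((+ p n) ℚ./ n)) y) where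

    private
      quotient-close : ∀ (a : ℕ → ℕ) (x : ℝ) n h .{{_ : ℕ.NonZero n}} → 0ℚ < h →
        R.∣ fromℚ ((+ a n) ℚ./ n) R.- x ∣ R.≤ fromℚ h →
        Eventually λ t → ∣ ι (a n) - ι n * seq x t ∣ ≤ (h + h) * ι n
      quotient-close a x n h 0<h le = eventually (λ t q → begin
        ∣ ι (a n) - ι n * seq x t ∣                    ≡⟨ cong (λ z → ∣ z - ι n * seq x t ∣) (ι-/ (a n) n) ⟨
        ∣ ((+ a n) ℚ./ n) * ι n - ι n * seq x t ∣      ≡⟨ cong ∣_∣ (solve 3 (λ q n x → q :* n :- n :* x := (q :- x) :* n) refl ((+ a n) ℚ./ n) (ι n) (seq x t)) ⟩
        ∣ (((+ a n) ℚ./ n) - seq x t) * ι n ∣          ≡⟨ ℚ.∣p*q∣≡∣p∣*∣q∣ (((+ a n) ℚ./ n) - seq x t) (ι n) ⟩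
        ∣ ((+ a n) ℚ./ n) - seq x t ∣ * ∣ ι n ∣        ≡⟨ cong (∣ ((+ a n) ℚ./ n) - seq x t ∣ *_) (ℚ.0≤p⇒∣p∣≡p (0≤ι n)) ⟩
        ∣ ((+ a n) ℚ./ n) - seq x t ∣ * ι n            ≤⟨ *ʳ (0≤ι n) q ⟩
        (h + h) * ι n                                  ∎) (le h 0<h)

    difference-close : ∀ c δ → 0ℚ < δ → ∃[ N ] ∀ n → 1 ℕ.≤ n → N ℕ.≤ n → ∀ u →
      a n ℕ.≤ u ℕ.+ p n ℕ.+ c → u ℕ.+ p n ℕ.≤ a n ℕ.+ c →
      Eventually λ t → ∣ ι u - ι n * (seq x t - seq y t) ∣ ≤ δ * ι n
    difference-close c δ 0<δ = combine (a→x h 0<h) (p→y h 0<h) (archimedean-* (ι c) (½ * δ) 0<½δ)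
      where
      -- Each of the two limits is approximated within 2h = δ/4, one h being the slack in the order
      -- of real numbers; the remaining δ/2 absorbs the constant c.
      h = ½ * (½ * (½ * δ))
      0<½δ = 0<* 0<½ 0<δ
      0<h = 0<* 0<½ (0<* 0<½ 0<½δ)
      combine : (∃[ N ] ∀ n .{{_ : ℕ.NonZero n}} → N ℕ.≤ n → R.∣ fromℚ ((+ a n) ℚ./ n) R.- x ∣ R.≤ fromℚ h) →
                (∃[ N ] ∀ n .{{_ : ℕ.NonZero n}} → N ℕ.≤ n → R.∣ fromℚ ((+ p n) ℚ./ n) R.- y ∣ R.≤ fromℚ h) →
                (∃[ N ] ∀ n → N ℕ.≤ n → ι c ≤ ½ * δ * ι n) →
                ∃[ N ] ∀ n → 1 ℕ.≤ n → N ℕ.≤ n → ∀ u → a n ℕ.≤ u ℕ.+ p n ℕ.+ c → u ℕ.+ p n ℕ.≤ a n ℕ.+ c →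
                Eventually λ t → ∣ ι u - ι n * (seq x t - seq y t) ∣ ≤ δ * ι n
      combine (N₁ , A) (N₂ , P) (N₃ , small) = N₁ ℕ.+ (N₂ ℕ.+ N₃) , λ n 1≤n N≤n u a≤ u≤ →
        let N₁≤n = ℕ.≤-trans (ℕ.m≤m+n N₁ _) N≤n
            N₂≤n = ℕ.≤-trans (ℕ.≤-trans (ℕ.m≤m+n N₂ N₃) (ℕ.m≤n+m _ N₁)) N≤n
            N₃≤n = ℕ.≤-trans (ℕ.≤-trans (ℕ.m≤n+m N₃ N₂) (ℕ.m≤n+m _ N₁)) N≤n
        in eventually (λ t (qa , qp) → estimate n u t a≤ u≤ (small n N₃≤n) qa qp)
             (both (quotient-close a x n h {{ℕ.>-nonZero 1≤n}} 0<h (A n {{ℕ.>-nonZero 1≤n}} N₁≤n))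
                   (quotient-close p y n h {{ℕ.>-nonZero 1≤n}} 0<h (P n {{ℕ.>-nonZero 1≤n}} N₂≤n)))
        where
        sum-δ : ∀ n → (h + h) * ι n + (h + h) * ι n + ½ * δ * ι n ≡ δ * ι n
        sum-δ n = solve 2 (λ δ n → let h = con ½ :* (con ½ :* (con ½ :* δ)) in
          (h :+ h) :* n :+ (h :+ h) :* n :+ con ½ :* δ :* n := δ :* n) refl δ (ι n)
        estimate : ∀ n u t → a n ℕ.≤ u ℕ.+ p n ℕ.+ c → u ℕ.+ p n ℕ.≤ a n ℕ.+ c → ι c ≤ ½ * δ * ι n →
          ∣ ι (a n) - ι n * seq x t ∣ ≤ (h + h) * ι n → ∣ ι (p n) - ι n * seq y t ∣ ≤ (h + h) * ι n →
          ∣ ι u - ι n * (seq x t - seq y t) ∣ ≤ δ * ι n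
        estimate n u t a≤ u≤ small qa qp = ∣∣≤
          (begin
            ι u - ν * (X - Y)                   ≤⟨ ≤-by (ι (a n) + ι c - (ι u + ι (p n))) (≤⇒0≤- u≤′)
                                                     (solve 7 (λ u p a c n x y → u :- n :* (x :- y) :+ (a :+ c :- (u :+ p)) := (a :- n :* x) :+ :- (p :- n :* y) :+ c) refl (ι u) (ι (p n)) (ι (a n)) (ι c) ν X Y) ⟩
            (ι (a n) - ν * X) + - (ι (p n) - ν * Y) + ι c
              ≤⟨ ℚ.+-mono-≤ (ℚ.+-mono-≤ (ℚ.≤-trans (≤∣∣ (ι (a n) - ν * X)) qa) (ℚ.≤-trans (-≤∣∣ (ι (p n) - ν * Y)) qp)) small ⟩
            (h + h) * ν + (h + h) * ν + ½ * δ * ν   ≡⟨ sum-δ n ⟩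
            δ * ν                                   ∎)
          (begin
            - (ι u - ν * (X - Y))               ≤⟨ ≤-by (ι u + ι (p n) + ι c - ι (a n)) (≤⇒0≤- a≤′)
                                                     (solve 7 (λ u p a c n x y → :- (u :- n :* (x :- y)) :+ (u :+ p :+ c :- a) := :- (a :- n :* x) :+ (p :- n :* y) :+ c) refl (ι u) (ι (p n)) (ι (a n)) (ι c) ν X Y) ⟩
            - (ι (a n) - ν * X) + (ι (p n) - ν * Y) + ι c
              ≤⟨ ℚ.+-mono-≤ (ℚ.+-mono-≤ (ℚ.≤-trans (-≤∣∣ (ι (a n) - ν * X)) qa) (ℚ.≤-trans (≤∣∣ (ι (p n) - ν * Y)) qp)) small ⟩
            (h + h) * ν + (h + h) * ν + ½ * δ * ν   ≡⟨ sum-δ n ⟩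
            δ * ν                                   ∎)
          where
          ν = ι n
          X = seq x t
          Y = seq y t
          u≤′ : ι u + ι (p n) ≤ ι (a n) + ι c
          u≤′ = subst₂ _≤_ (ι-+ u (p n)) (ι-+ (a n) c) (ι-mono u≤)
          a≤′ : ι (a n) ≤ ι u + ι (p n) + ι c
          a≤′ = subst (ι (a n) ≤_) (trans (ι-+ (u ℕ.+ p n) c) (cong (_+ ι c) (ι-+ u (p n)))) (ι-mono a≤)

  limit : ∀ {k} → (Fin k → ℝ) → (Fin k → ℝ) → Fin k ⊎ Fin k → ℝ
  limit α β (inj₁ i) = α i
  limit α β (inj₂ j) = β j

  frobenius-limit : ∀ {k} {ν : ℕ → Partition} {α β : Fin k → ℝ} → ν ⟶⟨ α , β ⟩ → ∀ κ →
    Tendsto (λ n → fromℚ ((+ frobenius (ν n) κ) ℚ./ n)) (limit α β κ)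
  frobenius-limit lim (inj₁ i) = _⟶⟨_,_⟩.a-limit lim i
  frobenius-limit lim (inj₂ j) = _⟶⟨_,_⟩.b-limit lim j

  module Asymptotics {k : ℕ} (1≤k : 1 ℕ.≤ k) (α β π τ : Fin k → ℝ) (υ : ℕ → SkewShape)
    (outer→ : (λ n → outer (υ n)) ⟶⟨ α , β ⟩) (inner→ : (λ n → inner (υ n)) ⟶⟨ π , τ ⟩) where

    m : ℕ
    m = k ℕ.+ k

    1≤m : 1 ℕ.≤ m
    1≤m = ℕ.≤-trans 1≤k (ℕ.m≤m+n k k)

    ξ : Fin m → ℝ
    ξ κ = limit α β (splitAt k κ) R.- limit π τ (splitAt k κ)

    x : Fin m → ℕ → ℚ
    x κ t = seq (limit α β (splitAt k κ)) t - seq (limit π τ (splitAt k κ)) t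

    γ c : ℝ
    γ = ∑ (λ i → α i R.+ β i R.- π i R.- τ i)
    c = xlogx γ R.- ∑ (λ i → xlogx (α i R.- π i)) R.- ∑ (λ i → xlogx (β i R.- τ i))

    sum-chains : (g : ℚ → ℚ) → ∀ t → Σℚ.sum (λ κ → g (x κ t)) ≡
      Σℚ.sum (λ i → g (seq (α i) t - seq (π i) t)) + Σℚ.sum (λ j → g (seq (β j) t - seq (τ j) t))
    sum-chains g t = trans (sum-↑ k (λ κ → g (x κ t))) (cong₂ _+_
      (Σℚ.sum-cong-≗ λ i → cong (λ s → g (seq (limit α β s) t - seq (limit π τ s) t)) (Fin.splitAt-↑ˡ k i k))
      (Σℚ.sum-cong-≗ λ j → cong (λ s → g (seq (limit α β s) t - seq (limit π τ s) t)) (Fin.splitAt-↑ʳ k k j)))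

    sum-ξ : ∀ t → Σℚ.sum (λ κ → x κ t) ≡ seq γ t
    sum-ξ t = begin-equality
      Σℚ.sum (λ κ → x κ t)
        ≡⟨ sum-chains (λ r → r) t ⟩
      Σℚ.sum (λ i → seq (α i) t - seq (π i) t) + Σℚ.sum (λ j → seq (β j) t - seq (τ j) t)
        ≡⟨ Σℚ.∑-distrib-+ (λ i → seq (α i) t - seq (π i) t) (λ j → seq (β j) t - seq (τ j) t) ⟨
      Σℚ.sum (λ i → (seq (α i) t - seq (π i) t) + (seq (β i) t - seq (τ i) t))
        ≡⟨ Σℚ.sum-cong-≗ (λ i → solve 4 (λ a b p q → (a :- p) :+ (b :- q) := ((a :+ b) :- p) :- q) refl (seq (α i) t) (seq (β i) t) (seq (π i) t) (seq (τ i) t)) ⟩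
      Σℚ.sum (λ i → seq (α i R.+ β i R.- π i R.- τ i) t)
        ≡⟨ seq-∑ (λ i → α i R.+ β i R.- π i R.- τ i) t ⟨
      seq γ t ∎

    -- An exact equality at every stage, since both sides are built from `η⁺ t`; only the sum over
    -- the chains is split into rows and columns.
    entropy⁺≡c : ∀ t → entropy⁺ x t ≡ seq c t
    entropy⁺≡c t = begin-equality
      η⁺ t (Σℚ.sum (λ κ → x κ t)) - Σℚ.sum (λ κ → η⁺ t (x κ t))
        ≡⟨ cong₂ (λ g s → η⁺ t g - s) (sum-ξ t) (sum-chains (η⁺ t) t) ⟩
      η⁺ t (seq γ t) - (A + B)
        ≡⟨ solve 3 (λ g a b → g :- (a :+ b) := (g :- a) :- b) refl (η⁺ t (seq γ t)) A B ⟩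
      (η⁺ t (seq γ t) - A) - B
        ≡⟨ cong₂ (λ a b → (η⁺ t (seq γ t) - a) - b) (seq-∑ (λ i → xlogx (α i R.- π i)) t) (seq-∑ (λ i → xlogx (β i R.- τ i)) t) ⟨
      seq c t ∎
      where
      A = Σℚ.sum (λ i → η⁺ t (seq (α i) t - seq (π i) t))
      B = Σℚ.sum (λ j → η⁺ t (seq (β j) t - seq (τ j) t))

    IsBound : ℚ → Set
    IsBound C = (∀ κ → Eventually λ t → ∣ x κ t ∣ ≤ C) × Eventually (λ t → ∣ Σℚ.sum (λ κ → x κ t) ∣ ≤ C)

    bounds : ∃[ C ] (0ℚ < C) × IsBound C
    bounds = combine (bounded-all ξ) (bounded (cauchy γ))
      where
      combine : (∃[ C ] (0ℚ < C) × (∀ κ → Eventually λ t → ∣ x κ t ∣ ≤ C)) → Bounded (seq γ) → ∃[ C ] (0ℚ < C) × IsBound C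
      combine (C , 0<C , x≤C) (D , 0<D , γ≤D) = C + D , 0<+ 0<C (ℚ.<⇒≤ 0<D) ,
        (λ κ → eventually (λ t h → ℚ.≤-trans h (≤-by D (ℚ.<⇒≤ 0<D) refl)) (x≤C κ)) ,
        eventually (λ t h → ℚ.≤-trans (ℚ.≤-reflexive (cong ∣_∣ (sum-ξ t))) (ℚ.≤-trans h (≤-by C (ℚ.<⇒≤ 0<C) (ℚ.+-comm D C)))) γ≤D

    module At (n : ℕ) (1≤n : 1 ℕ.≤ n) where
      d≤k : durfee (outer (υ n)) ℕ.≤ k
      d≤k = _⟶⟨_,_⟩.durfee≤k outer→ n 1≤n
      open ChainLimits k (υ n) d≤k public
      open Count k (υ n) d≤k public

    Close : ℚ → ℕ → (Fin m → ℕ) → Set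
    Close δ n u = ∀ κ → Eventually λ t → ∣ ι (u κ) - ι n * x κ t ∣ ≤ δ * ι n

    Within : ℕ → ℕ → (Fin m → ℕ) → Set
    Within d n u = ∀ κ → let a = frobenius (outer (υ n)) (splitAt k κ) ; p = frobenius (inner (υ n)) (splitAt k κ) in
      a ℕ.≤ u κ ℕ.+ p ℕ.+ d × u κ ℕ.+ p ℕ.≤ a ℕ.+ d

    within⇒close : ∀ d δ → 0ℚ < δ → Eventually λ n → 1 ℕ.≤ n → ∀ u → Within d n u → Close δ n u
    within⇒close d δ 0<δ = eventually (λ n h 1≤n u within κ → h κ 1≤n (u κ) (proj₁ (within κ)) (proj₂ (within κ)))
      (eventually-all λ κ → reorder κ (difference-close (λ n → frobenius (outer (υ n)) (splitAt k κ)) (λ n → frobenius (inner (υ n)) (splitAt k κ))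
        {limit α β (splitAt k κ)} {limit π τ (splitAt k κ)} (frobenius-limit outer→ (splitAt k κ)) (frobenius-limit inner→ (splitAt k κ)) d δ 0<δ))
      where
      Q : Fin m → ℕ → Set
      Q κ n = ∀ u → frobenius (outer (υ n)) (splitAt k κ) ℕ.≤ u ℕ.+ frobenius (inner (υ n)) (splitAt k κ) ℕ.+ d →
        u ℕ.+ frobenius (inner (υ n)) (splitAt k κ) ℕ.≤ frobenius (outer (υ n)) (splitAt k κ) ℕ.+ d →
        Eventually λ t → ∣ ι u - ι n * x κ t ∣ ≤ δ * ι n
      P : Fin m → ℕ → Set
      P κ n = 1 ℕ.≤ n → Q κ n
      reorder : ∀ κ → (∃[ N ] ∀ n → 1 ℕ.≤ n → N ℕ.≤ n → Q κ n) → Eventually (P κ)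
      reorder κ (N , h) = N , λ n N≤n 1≤n → h n 1≤n N≤n

    Upper Lower : ℚ → ℕ → Set
    Upper ε n = Log (e (υ n)) ≲ λ t → ι n * seq c t + ε * ι n
    Lower ε n = (λ t → ι n * seq c t) ≲ λ t → Log (e (υ n)) t + ε * ι n

    approx⇒≲ : ∀ {ε n} {u : Fin m → ℕ} → entropy u ≈[ ε * ι n ] (λ t → ι n * entropy⁺ x t) →
      entropy u ≲ (λ t → ι n * seq c t + ε * ι n) × (λ t → ι n * seq c t) ≲ (λ t → entropy u t + ε * ι n)
    approx⇒≲ {ε} {n} {u} (p , q) =
      ≲-trans p
        (≤⇒≲ λ t → ℚ.≤-reflexive (cong (λ z → ι n * z + ε * ι n) (entropy⁺≡c t))) ,
      ≲-trans
        (≤⇒≲ λ t → ℚ.≤-reflexive (cong (ι n *_) (sym (entropy⁺≡c t)))) q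

    module _ {C : ℚ} (0<C : 0ℚ < C) (bound-C : IsBound C) where

      upper : ∀ ε → 0ℚ < ε → Eventually λ n → 1 ℕ.≤ n → Upper ε n
      upper ε 0<ε = from-δ (entropy-approx C ε 0<C 0<ε)
        where
        from-δ : (∃[ δ ] (0ℚ < δ) × EntropyApprox {m} C ε δ) → Eventually λ n → 1 ℕ.≤ n → Upper ε n
        from-δ (δ , 0<δ , approx) = eventually at-n (within⇒close (k ℕ.+ 0) δ 0<δ)
          where
          at-n : ∀ n → (1 ℕ.≤ n → ∀ u → Within (k ℕ.+ 0) n u → Close δ n u) → 1 ℕ.≤ n → Upper ε n
          at-n n close 1≤n = ≲-trans
            (entropy-upper l (e-pos (υ n)) e-upper)
            (proj₁ (approx⇒≲ {ε} {n} {l} (approx n l x 1≤n (proj₁ bound-C) (proj₂ bound-C) (close 1≤n l chainLength-within))))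
            where
            open At n 1≤n
            l = chainLength

      lower : ∀ ε → 0ℚ < ε → Eventually λ n → 1 ℕ.≤ n → Lower ε n
      lower ε 0<ε = from-δ (entropy-approx C ε₂ 0<C 0<ε₂)
        where
        -- ε/2 is spent on replacing the entropy by n c, ε/4 on the k lost factors, and twice ε/8 on
        -- the polynomial factors.
        ε₂ ε₄ ε₈ : ℚ
        ε₂ = ½ * ε
        ε₄ = ½ * ε₂
        ε₈ = ½ * ε₄
        0<ε₂ = 0<* 0<½ 0<ε
        0<ε₄ = 0<* 0<½ 0<ε₂
        0<ε₈ = 0<* 0<½ 0<ε₄

        from-δ : (∃[ δ ] (0ℚ < δ) × EntropyApprox {m} C ε₂ δ) → Eventually λ n → 1 ℕ.≤ n → Lower ε n
        -- The order of the choices is δ, then B, then A, then n. Here B is made so large that the k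
        -- lost factors cost at most ε/4 per unit of n.
        from-δ (δ , 0<δ , approx) = from-b₁ (archimedean-* (ι k * ι m * C₂) ε₄ 0<ε₄)
          where
          -- An upper bound for B Q / n, where Q is the sum of the steps.
          C₂ : ℚ
          C₂ = ι m * (C + δ)

          from-b₁ : (∃[ N ] ∀ b → N ℕ.≤ b → ι k * ι m * C₂ ≤ ε₄ * ι b) → Eventually λ n → 1 ℕ.≤ n → Lower ε n
          -- With B fixed, log (Q + 1) ≤ (Q + 1)/A + A by `Log-growth`. A is chosen against the
          -- first term, and n later against the second.
          from-b₁ (b₁ , blocks) = from-a (archimedean-* (ι B * ι m * (C₂ + 1ℚ)) ε₈ 0<ε₈)
            where
            B = suc b₁ ℕ.+ k
            1≤B : 1 ℕ.≤ B
            1≤B = ℕ.s≤s ℕ.z≤n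

            from-a : (∃[ N ] ∀ a → N ℕ.≤ a → ι B * ι m * (C₂ + 1ℚ) ≤ ε₈ * ι a) → Eventually λ n → 1 ℕ.≤ n → Lower ε n
            from-a (a , scale) = eventually at-n (both (within⇒close (k ℕ.+ B) δ 0<δ) (archimedean-* (ι B * ι m * ι A) ε₈ 0<ε₈))
              where
              A = suc a
              1≤A : 1 ℕ.≤ A
              1≤A = ℕ.s≤s ℕ.z≤n

              at-n : ∀ n → (1 ℕ.≤ n → ∀ u → Within (k ℕ.+ B) n u → Close δ n u) × ι B * ι m * ι A ≤ ε₈ * ι n → 1 ℕ.≤ n → Lower ε n
              at-n n (close , large) 1≤n = ≲-trans
                (proj₂ (approx⇒≲ {ε₂} {n} {u} (approx n u x 1≤n (proj₁ bound-C) (proj₂ bound-C) u-close)))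
                (≲-trans
                  (+-mono-≲
                    (≲-trans
                      (proj₁ (entropy-scale q 1≤B))
                      (≲-trans
                        (entropy-lower q {E} {B} {k} (e-pos (υ n)) 1≤m (Lower.e-lower b₁))
                        (+-mono-≲ (≲-refl {Log E})
                          (+-mono-≲ (≤⇒≲ rest₁≤) rest₂≲))))
                    (≲-refl))
                  (≤⇒≲ λ t → ℚ.≤-reflexive (solve 3 (λ l ε n → (l :+ (con ½ :* (con ½ :* ε) :* n :+ con ½ :* (con ½ :* ε) :* n)) :+ con ½ :* ε :* n := l :+ ε :* n) refl (Log E t) ε (ι n))))
                where
                open At n 1≤n
                open Cutoffs b₁ using (advance)
                E = e (υ n)
                q u : Fin m → ℕ
                q κ = advance (split κ)
                u κ = B ℕ.* q κ
                Q = Σℕ.sum q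
                ν = ι n

                u-close : Close δ n u
                u-close = close 1≤n u (step-within b₁)

                u≤ : ∀ κ → ι (u κ) ≤ (C + δ) * ν
                u≤ κ = from-t (both (proj₁ bound-C κ) (u-close κ))
                  where
                  from-t : Eventually (λ t → ∣ x κ t ∣ ≤ C × ∣ ι (u κ) - ν * x κ t ∣ ≤ δ * ν) → ι (u κ) ≤ (C + δ) * ν
                  from-t (t , h) = begin
                    ι (u κ)                ≤⟨ ∣-∣≤⇒≤ (ι (u κ)) (ν * x κ t) (proj₂ (h t ℕ.≤-refl)) ⟩
                    ν * x κ t + δ * ν      ≤⟨ ℚ.+-monoˡ-≤ (δ * ν) (*ˡ (0≤ι n) (ℚ.≤-trans (≤∣∣ (x κ t)) (proj₁ (h t ℕ.≤-refl)))) ⟩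
                    ν * C + δ * ν          ≡⟨ solve 3 (λ n C δ → n :* C :+ δ :* n := (C :+ δ) :* n) refl ν C δ ⟩
                    (C + δ) * ν            ∎

                BQ≤ : ι B * ι Q ≤ C₂ * ν
                BQ≤ = begin
                  ι B * ι Q                  ≡⟨ trans (cong ι (Σ-scale B q)) (ι-* B Q) ⟨
                  ι (Σℕ.sum u)               ≡⟨ ι-sum u ⟩
                  Σℚ.sum (ι ∘ u)             ≤⟨ sum≤ (ι ∘ u) ((C + δ) * ν) u≤ ⟩
                  ι m * ((C + δ) * ν)        ≡⟨ ℚ.*-assoc (ι m) (C + δ) ν ⟨
                  C₂ * ν                     ∎

                rest₁ rest₂ : ℕ → ℚ
                rest₁ t = ι k * (ι Q * Log m t)
                rest₂ t = ι B * (ι m * Log (suc Q) t)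

                0<B : 0ℚ < ι B
                0<B = 0<ι 1≤B

                kQm≤ : ι k * (ι Q * ι m) ≤ ε₄ * ν
                -- Multiplication by B produces B Q ≤ C₂ n, and the choice of B pays for the
                -- constant k m C₂.
                kQm≤ = ℚ.*-cancelˡ-≤-pos (ι B) {{ℚ.positive 0<B}} (begin
                  ι B * (ι k * (ι Q * ι m))      ≡⟨ solve 4 (λ B k Q m → B :* (k :* (Q :* m)) := k :* m :* (B :* Q)) refl (ι B) (ι k) (ι Q) (ι m) ⟩
                  ι k * ι m * (ι B * ι Q)        ≤⟨ *ˡ (0≤* (0≤ι k) (0≤ι m)) BQ≤ ⟩
                  ι k * ι m * (C₂ * ν)           ≡⟨ ℚ.*-assoc (ι k * ι m) C₂ ν ⟨
                  ι k * ι m * C₂ * ν             ≤⟨ *ʳ (0≤ι n) (blocks B (ℕ.≤-trans (ℕ.n≤1+n b₁) (ℕ.m≤m+n (suc b₁) k))) ⟩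
                  ε₄ * ι B * ν                   ≡⟨ solve 3 (λ ε B n → ε :* B :* n := B :* (ε :* n)) refl ε₄ (ι B) ν ⟩
                  ι B * (ε₄ * ν)                 ∎)

                rest₁≤ : ∀ t → rest₁ t ≤ ε₄ * ν
                rest₁≤ t = ℚ.≤-trans (*ˡ (0≤ι k) (*ˡ (0≤ι Q) (ℚ.≤-trans (ρ-upper t (0<ι 1≤m))
                  (≤-by 1ℚ 0≤1 (solve 1 (λ m → m :- con 1ℚ :+ con 1ℚ := m) refl (ι m)))))) kQm≤

                sQ≤ : ι (suc Q) ≤ (C₂ + 1ℚ) * ν
                sQ≤ = begin
                  ι (suc Q)              ≡⟨ fromℕ-suc Q ⟩
                  ι Q + 1ℚ               ≤⟨ ℚ.+-mono-≤ (begin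
                    ι Q                    ≡⟨ ℚ.*-identityˡ (ι Q) ⟨
                    1ℚ * ι Q               ≤⟨ *ʳ (0≤ι Q) (1≤ι 1≤B) ⟩
                    ι B * ι Q              ≤⟨ BQ≤ ⟩
                    C₂ * ν                 ∎) (1≤ι 1≤n) ⟩
                  C₂ * ν + ν             ≡⟨ solve 2 (λ C n → C :* n :+ n := (C :+ con 1ℚ) :* n) refl C₂ ν ⟩
                  (C₂ + 1ℚ) * ν          ∎

                0<A : 0ℚ < ι A
                0<A = 0<ι 1≤A
                rA = recip (ι A)

                growth≤ : ι B * (ι m * (ι (suc Q) * rA + ι A)) ≤ ε₄ * ν
                growth≤ = begin
                  ι B * (ι m * (ι (suc Q) * rA + ι A))
                    ≤⟨ *ˡ (0≤ι B) (*ˡ (0≤ι m) (ℚ.+-monoˡ-≤ (ι A) (*ʳ (0≤recip 0<A) sQ≤))) ⟩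
                  ι B * (ι m * ((C₂ + 1ℚ) * ν * rA + ι A))
                    ≡⟨ solve 6 (λ B m C n r A → B :* (m :* (C :* n :* r :+ A)) := B :* m :* C :* (n :* r) :+ B :* m :* A) refl (ι B) (ι m) (C₂ + 1ℚ) ν rA (ι A) ⟩
                  ι B * ι m * (C₂ + 1ℚ) * (ν * rA) + ι B * ι m * ι A
                    ≤⟨ ℚ.+-mono-≤ (*ʳ (0≤* (0≤ι n) (0≤recip 0<A)) (scale A (ℕ.n≤1+n a))) large ⟩
                  ε₈ * ι A * (ν * rA) + ε₈ * ν
                    ≡⟨ solve 4 (λ ε A n r → ε :* A :* (n :* r) :+ ε :* n := (A :* r) :* (ε :* n) :+ ε :* n) refl ε₈ (ι A) ν rA ⟩
                  (ι A * rA) * (ε₈ * ν) + ε₈ * ν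
                    ≡⟨ cong (λ z → z * (ε₈ * ν) + ε₈ * ν) (recip-inverse 0<A) ⟩
                  1ℚ * (ε₈ * ν) + ε₈ * ν
                    ≡⟨ solve 2 (λ ε n → con 1ℚ :* (con ½ :* ε :* n) :+ con ½ :* ε :* n := ε :* n) refl ε₄ ν ⟩
                  ε₄ * ν ∎

                rest₂≲ : rest₂ ≲ λ _ → ε₄ * ν
                rest₂≲ = ≲-trans
                  (*-mono-≲ (0≤ι B)
                    (*-mono-≲ (0≤ι m) (Log-growth {suc Q} {A} (ℕ.s≤s ℕ.z≤n) 1≤A)))
                  (≤⇒≲ λ _ → growth≤)

    log-asymptotics : IsLittleO-n (λ n → log (fromℕ (e (υ n))) (0<fromℕ (e-pos (υ n))) R.- c R.* fromℕ n)
    log-asymptotics ε 0<ε = from-bounds bounds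
      where
      Error : ℕ → Set
      Error n = R.∣ log (fromℕ (e (υ n))) (0<fromℕ (e-pos (υ n))) R.- c R.* fromℕ n ∣ R.≤ fromℚ ε R.* fromℕ n

      from-bounds : (∃[ C ] (0ℚ < C) × IsBound C) → Eventually Error
      from-bounds (C , 0<C , bound-C) = combine (both (upper 0<C bound-C ε 0<ε) (lower 0<C bound-C ε 0<ε))
        where
        at-n : ∀ n → Upper ε n → Lower ε n → Error n
        at-n n up low ε′ 0<ε′ = eventually
          (λ t (p , q) → ∣∣≤
            (≤+⇒-≤ (ℚ.≤-trans p (ℚ.≤-reflexive (solve 4 (λ n c ε ε′ → n :* c :+ ε :* n :+ ε′ := c :* n :+ (ε :* n :+ ε′)) refl (ι n) (seq c t) ε ε′))))
            (subst (_≤ ε * ι n + ε′) (solve 2 (λ l c → c :- l := :- (l :- c)) refl (Log (e (υ n)) t) (seq c t * ι n))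
              (≤+⇒-≤ (ℚ.≤-trans (ℚ.≤-reflexive (ℚ.*-comm (seq c t) (ι n)))
                (ℚ.≤-trans q (ℚ.≤-reflexive (ℚ.+-assoc (Log (e (υ n)) t) (ε * ι n) ε′)))))))
          (both (up .eventually-≤ ε′ 0<ε′) (low .eventually-≤ ε′ 0<ε′))
        combine : Eventually (λ n → (1 ℕ.≤ n → Upper ε n) × (1 ℕ.≤ n → Lower ε n)) → Eventually Error
        -- `suc N` forces n ≥ 1, where the fractions by n and the bound on the Durfee square make
        -- sense.
        combine (N , h) = suc N , λ n N<n →
          let 1≤n = ℕ.≤-trans (ℕ.s≤s ℕ.z≤n) N<n
              up , low = h n (ℕ.<⇒≤ N<n)
          in at-n n (up 1≤n) (low 1≤n)

open import Defs
open import Data.Fin.Base using (Fin; fromℕ<)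
import Data.Nat.Base as ℕ
open ℕ using (ℕ)

theorem5p1 :
    (k : ℕ) (1≤k : 1 ℕ.≤ k) (α β π τ : Fin k → ℝ) →
    (∀ i → 0ℝ ≤ α i) → (∀ i → 0ℝ ≤ β i) → (∀ i → 0ℝ ≤ π i) → (∀ i → 0ℝ ≤ τ i) →
    0ℝ < α (fromℕ< 1≤k) → 0ℝ < β (fromℕ< 1≤k) →
    (υ : ℕ → SkewShape) →
    (∀ n → 1 ℕ.≤ n → Connected (υ n)) →
    (λ n → outer (υ n)) ⟶⟨ α , β ⟩ →
    (λ n → inner (υ n)) ⟶⟨ π , τ ⟩ →
    let γ = ∑ (λ i → α i + β i - π i - τ i)
        c = xlogx γ - ∑ (λ i → xlogx (α i - π i)) - ∑ (λ i → xlogx (β i - τ i))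
    in IsLittleO-n (λ n → log (fromℕ (e (υ n))) (0<fromℕ (e-pos (υ n))) - c * fromℕ n)
theorem5p1 k 1≤k α β π τ _ _ _ _ _ _ υ _ outer→ inner→ =
  Limits.Asymptotics.log-asymptotics 1≤k α β π τ υ outer→ inner→
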